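{- For every constant $c\in(0,1)$ and every integer $d\ge 1$ there are constants $\kappa>0$ and $n_0$, depending only on $c$ and $d$, such that the following holds for every $n\ge n_0$ for which $t=cn$ is an integer and for every finite field $\mathbb{F}_q$. If $C:\mathbb{F}_q^{t}\to\mathbb{F}_q^{n}$ is an unrestricted arithmetic circuit of depth $d$ (allowing arbitrary gates and unbounded fan-in) whose inputs consist of the secret together with $t-1$ random elements and whose outputs are the $n$ shares of a $(t,n)$-threshold secret sharing scheme, then the number of wires in $C$ is at least $\kappa\,\lambda_d(n)\,n$. (That is, the number of wires is $\Omega_{d,c}(\lambda_d(n)\cdot n)$.)
   Context: Unrestricted arithmetic circuit over $\mathbb{F}_q$: a finite directed acyclic graph with designated input vertices (having no incoming edges) and designated output vertices; each non-input vertex (gate) of in-degree $k$ computes an arbitrary function $\mathbb{F}_q^k\to\mathbb{F}_q$ of the values of its in-neighbours; $k$ is unbounded. Wires are the edges; depth is the maximum number of edges on a directed path from an input to an output. Computing the shares of a $(t,n)$-threshold secret sharing scheme: let $S$ (the value at the secret input) be uniform over $\mathbb{F}_q$, let the values at the $t-1$ random inputs be uniform over $\mathbb{F}_q$, with all inputs mutually independent, and let $Y_1,\dots,Y_n$ be the values of the $n$ outputs (the shares). For $T\subseteq[n]$ let $Y_T=(Y_i)_{i\in T}$. It is required that $H(S\mid Y_T)=0$ for every $T\subseteq[n]$ with $|T|=t$ and $H(S\mid Y_T)=H(S)$ for every $T\subseteq[n]$ with $|T|=t-1$, where $H$ is Shannon entropy. Functions $\lambda_d$: for $f:\mathbb{N}\to\mathbb{N}$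 with $f(n)<n$ for all $n>1$, let $f^{(i)}$ be the $i$-fold composition ($f^{(1)}=f$) and $f^*(n)=\min\{i\ge1: f^{(i)}(n)\le 1\}$. Define $\lambda_1(n)=\lfloor\sqrt n\rfloor$, $\lambda_2(n)=\lceil\log_2 n\rceil$, and $\lambda_d(n)=\lambda_{d-2}^*(n)$ for $d\ge3$. -}

module Defs where

open import Level using (0ℓ)
open import Algebra.Structures using (IsCommutativeRing)
open import Data.Bool.Base using (if_then_else_)
open import Data.Fin.Base using (Fin; zero; suc; splitAt; _↑ˡ_)
open import Data.Fin.Induction using (spo-wellFounded)
open import Data.Fin.Properties using (inj⇒≟)
open import Data.Fin.Subset using (Subset; inside; outside; _∈_; ∣_∣; ⊥)
import Data.Integer.Base as ℤ
open import Data.List.Base as List using (List; []; _∷_; length; filter; map; cartesianProductWith)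
open import Data.Nat.Base using (ℕ; zero; suc; _+_; _*_; _^_; _∸_; _≤_; _≤ᵇ_)
open import Data.Nat.GeneralisedArithmetic using (iterate)
open import Data.Nat.ListAction using (sum; product)
open import Data.Nat.Logarithm using (⌈log₂_⌉)
open import Data.Product.Base using (_×_; _,_; ∃-syntax)
open import Data.Product.Properties using () renaming (≡-dec to ×-≡-dec)
open import Data.Rational.Base using (ℚ; _/_)
open import Data.Sum.Base using ([_,_]′; inj₁; inj₂)
open import Data.Vec.Base as Vec using (Vec; []; _∷_; here; there; lookup)
open import Data.Vec.Properties using () renaming (≡-dec to Vec-≡-dec)
open import Function.Base using (_∘_)
open import Function.Bundles using (_↔_; Inverse)
open import Function.Definitions using (Injective)
open import Function.Properties.Inverse using (↔⇒↣)
open import Induction.WellFounded using (WellFounded; Acc; acc)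
open import Relation.Binary.Core using (Rel)
open import Relation.Binary.Definitions using (DecidableEquality)
open import Relation.Binary.Construct.Closure.Transitive using (TransClosure; _++_; wellFounded⁻)
open import Relation.Binary.PropositionalEquality
  using (_≡_; _≢_; refl; isEquivalence; resp₂)
open import Relation.Nullary.Negation using (¬_)

fromℕ : ℕ → ℚ
fromℕ n = ℤ.+ n / 1

------------------------------------------------------------------------
-- The functions λ_d

⌊√_⌋ : ℕ → ℕ
⌊√ zero ⌋  = 0
⌊√ suc n ⌋ = step ⌊√ n ⌋
  where
  step : ℕ → ℕ
  step r = if suc r * suc r ≤ᵇ suc n then suc r else r

-- f * n is the least i ≥ 1 with f⁽ⁱ⁾ n ≤ 1.  If f m < m for all m > 1
-- (and f 0, f 1 ≤ 1) then such an i exists and is at most max 1 (n ∸ 1),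
-- so that n candidates are enough.
_⋆ : (ℕ → ℕ) → ℕ → ℕ
(f ⋆) n = search n 1
  where
  search : ℕ → ℕ → ℕ
  search zero       i = i
  search (suc fuel) i = if iterate f n i ≤ᵇ 1 then i else search fuel (suc i)

-- Λ d is λ_d for d ≥ 1; the value at 0 is a dummy.
Λ : ℕ → ℕ → ℕ
Λ 0                   n = 0
Λ 1                   n = ⌊√ n ⌋
Λ 2                   n = ⌈log₂ n ⌉
Λ (suc (suc (suc d))) n = (Λ (suc d) ⋆) n

------------------------------------------------------------------------
-- Finite fields

-- A finite set has decidable equality, so propositional equality is used
-- on the carrier and the field axiom takes the form "x ≢ 0# implies x
-- invertible".
record FiniteField : Set₁ where
  infixl 7 _·_
  infixl 6 _⊕_
  field
    Carrier           : Set
    _⊕_ _·_           : Carrier → Carrier → Carrier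
    ⊖_                : Carrier → Carrier
    0# 1#             : Carrier
    isCommutativeRing : IsCommutativeRing _≡_ _⊕_ _·_ ⊖_ 0# 1#
    0#≢1#             : 0# ≢ 1#
    inverse           : ∀ x → x ≢ 0# → ∃[ y ] x · y ≡ 1#
    order             : ℕ
    enumeration       : Carrier ↔ Fin order

  elements : List Carrier
  elements = List.tabulate (Inverse.from enumeration)

  infix 4 _≟_
  _≟_ : DecidableEquality Carrier
  _≟_ = inj⇒≟ (↔⇒↣ enumeration)

vectors : ∀ {A : Set} → List A → (n : ℕ) → List (Vec A n)
vectors xs zero    = [] ∷ []
vectors xs (suc n) = cartesianProductWith _∷_ xs (vectors xs n)

-- The family (f i) for i ∈ p, in increasing order of i.
gather : ∀ {A : Set} {n} (p : Subset n) → (∀ {i} → i ∈ p → A) → Vec A ∣ p ∣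
gather []            f = []
gather (outside ∷ p) f = gather p (f ∘ there)
gather (inside  ∷ p) f = f here ∷ gather p (f ∘ there)

_↾_ : ∀ {A : Set} {n} → Vec A n → (p : Subset n) → Vec A ∣ p ∣
xs ↾ p = gather p (λ {i} _ → lookup xs i)

------------------------------------------------------------------------
-- Unrestricted circuits

-- The vertices are numbered so that the t inputs come first and the
-- non-input vertices (gates) follow; the numbering of the gates is
-- arbitrary, i.e. not assumed to be a topological order.  Gates of
-- in-degree 0 (constants) are allowed, and outputs may be inputs or have
-- outgoing wires.
record Circuit (A : Set) (t n : ℕ) : Set where
  field
    #gates : ℕ

  Vertex : Set
  Vertex = Fin (t + #gates)

  field
    inNeighbours : Fin #gates → Subset (t + #gates)
    gate         : (j : Fin #gates) → Vec A ∣ inNeighbours j ∣ → A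

  predecessors : Vertex → Subset (t + #gates)
  predecessors v = [ (λ _ → ⊥) , inNeighbours ]′ (splitAt t v)

  infix 4 _⟶_
  _⟶_ : Rel Vertex 0ℓ
  u ⟶ v = u ∈ predecessors v

  field
    acyclic          : ∀ v → ¬ TransClosure _⟶_ v v
    output           : Fin n → Vertex
    output-injective : Injective _≡_ _≡_ output

  input : Fin t → Vertex
  input i = i ↑ˡ #gates

  wires : ℕ
  wires = sum (List.tabulate (∣_∣ ∘ inNeighbours))

  data Path : ℕ → Rel Vertex 0ℓ where
    []  : ∀ {u} → Path 0 u u
    _∷_ : ∀ {u v w ℓ} → u ⟶ v → Path ℓ v w → Path (suc ℓ) u w

  HasIOPath : ℕ → Set
  HasIOPath ℓ = ∃[ i ] ∃[ o ] Path ℓ (input i) (output o)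

  HasDepth : ℕ → Set
  HasDepth d = HasIOPath d × (∀ ℓ → HasIOPath ℓ → ℓ ≤ d)

  ⟶-wellFounded : WellFounded _⟶_
  ⟶-wellFounded = wellFounded⁻ _⟶_ (spo-wellFounded {_≈_ = _≡_} record
    { isEquivalence = isEquivalence
    ; irrefl        = λ { refl → acyclic _ }
    ; trans         = _++_
    ; <-resp-≈      = resp₂ _
    })

  valueAcc : Vec A t → (v : Vertex) → Acc _⟶_ v → A
  valueAcc x v (acc rs) with splitAt t v
  ... | inj₁ i = lookup x i
  ... | inj₂ j = gate j (gather (inNeighbours j) (λ {u} u∈ → valueAcc x u (rs u∈)))

  value : Vec A t → Vertex → A
  value x v = valueAcc x v (⟶-wellFounded v)

  ⟦_⟧ : Vec A t → Vec A n
  ⟦_⟧ x = Vec.tabulate (value x ∘ output)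

------------------------------------------------------------------------
-- Shannon entropy for the uniform distribution on a finite list

-- (1/ k)log( a / b ) stands for the real number (1/k) · log (a/b), where
-- k, a, b are positive.  Such numbers contain all the entropies of
-- distributions with rational probabilities, and x ≋ y is their equality
-- as real numbers (for any base of the logarithm).
record LogNumber : Set where
  constructor 1/_log_/_
  field
    root num den : ℕ

infix 4 _≋_
_≋_ : Rel LogNumber 0ℓ
(1/ k log a / b) ≋ (1/ k′ log a′ / b′) = a ^ k′ * b′ ^ k ≡ a′ ^ k * b ^ k′

0log : LogNumber
0log = 1/ 1 log 1 / 1

module Entropy {Ω : Set} (outcomes : List Ω) where

  -- The expectation of log (a ω / b ω).
  𝔼log : (a b : Ω → ℕ) → LogNumber
  𝔼log a b = 1/ length outcomes log product (map a outcomes) / product (map b outcomes)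

  module _ {B : Set} (_≟_ : DecidableEquality B) where

    -- The number of outcomes at which Y takes the same value as at ω:
    -- P(Y = Y ω) = #fibre Y ω / length outcomes.  As ω itself is counted,
    -- this is positive.
    #fibre : (Ω → B) → Ω → ℕ
    #fibre Y ω = length (filter (λ ω′ → Y ω′ ≟ Y ω) outcomes)

    -- H(X) = 𝔼 log (1 / P(X))
    H : (Ω → B) → LogNumber
    H X = 𝔼log (λ _ → length outcomes) (#fibre X)

  -- H(X | Y) = 𝔼 log (1 / P(X | Y)) = 𝔼 log (P(Y) / P(X , Y))
  H[_,_][_∣_] : ∀ {B C : Set} → DecidableEquality B → DecidableEquality C →
                (Ω → B) → (Ω → C) → LogNumber
  H[ _≟ᴮ_ , _≟ᶜ_ ][ X ∣ Y ] =
    𝔼log (#fibre _≟ᶜ_ Y) (#fibre (×-≡-dec _≟ᴮ_ _≟ᶜ_) (λ ω → X ω , Y ω))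

------------------------------------------------------------------------
-- Threshold secret sharing

module _ (𝔽 : FiniteField) where
  open FiniteField 𝔽

  -- The sample space is 𝔽ᵗ with the uniform distribution: the secret
  -- S = lookup x secret and the other t ∸ 1 (random) inputs are uniform
  -- and mutually independent.
  IsThresholdScheme : (t n : ℕ) → Fin t → (Vec Carrier t → Vec Carrier n) → Set
  IsThresholdScheme t n secret shares =
      (∀ T → ∣ T ∣ ≡ t     → H[S∣Y T ] ≋ 0log)
    × (∀ T → ∣ T ∣ ≡ t ∸ 1 → H[S∣Y T ] ≋ H _≟_ S)
    where
    open Entropy (vectors elements t)

    S : Vec Carrier t → Carrier
    S x = lookup x secret

    H[S∣Y_] : Subset n → LogNumber
    H[S∣Y T ] = H[ _≟_ , Vec-≡-dec _≟_ ][ S ∣ (λ x → shares x ↾ T) ]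

{-# OPTIONS --safe #-}

-- By the entropy conditions any t shares take all q^t values, each once: the
-- secret is determined by t shares and free given t - 1 of them, so every
-- share can be changed arbitrarily while t - 1 others are kept.  Hence k + 1
-- inputs cannot be separated from t outputs by k vertices of the circuit.
--
-- A network of depth d with few wires does have such a separation.  At a
-- scale r_i of the sequence r, f r, f (f r), ... (f = Λ d) that is average
-- in a suitable sense, the vertices of the first and last inner layers are
-- treated by their degree towards the inputs, respectively outputs: those of
-- degree at least r_i are few and are removed, those of degree at least
-- r_{i+1} have few wires, which are charged to their inputs and outputs, and
-- the remaining ones are contracted.  This increases the number of wires by a
-- factor of r_{i+1} = f r_i and leaves a network whose depth is smaller by
-- two.  As the number of scales is the number of iterations of f from r, the
-- bound f for depth d yields f ⋆ for depth d + 2.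
module Submission where

open import Defs

module Sums where
  open import Data.Fin.Base using (Fin; zero; suc)
  open import Data.Fin.Properties using (_≟_; suc-injective)
  open import Data.Nat.Base
  open import Data.Nat.Properties hiding (_≟_; suc-injective)
  open import Algebra.Properties.Semiring.Sum +-*-semiring public
    using (sum; sum-syntax; sum-cong-≗; ∑-distrib-+; ∑-comm; *-distribˡ-sum; *-distribʳ-sum; sum-replicate-zero)
  open import Data.Product.Base using (_×_; _,_; ∃-syntax)
  open import Data.Sum.Base using (inj₁; inj₂)
  open import Function.Base using (_∘_)
  open import Function.Definitions using (Injective)
  open import Relation.Binary.PropositionalEquality
  open import Relation.Nullary using (Dec; yes; no; ¬_; contradiction)
  open import Data.Nat.Tactic.RingSolver using (solve-∀)

  ⟦_⟧ᵈ : ∀ {p} {P : Set p} → Dec P → ℕ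
  ⟦ yes _ ⟧ᵈ = 1
  ⟦ no  _ ⟧ᵈ = 0

  module _ {p} {P : Set p} where

    ⟦⟧ᵈ≤1 : (P? : Dec P) → ⟦ P? ⟧ᵈ ≤ 1
    ⟦⟧ᵈ≤1 (yes _) = ≤-refl
    ⟦⟧ᵈ≤1 (no _)  = z≤n

    ⟦⟧ᵈ-true : (P? : Dec P) → P → ⟦ P? ⟧ᵈ ≡ 1
    ⟦⟧ᵈ-true (yes _) _ = refl
    ⟦⟧ᵈ-true (no ¬p) p = contradiction p ¬p

    ⟦⟧ᵈ-false : (P? : Dec P) → ¬ P → ⟦ P? ⟧ᵈ ≡ 0
    ⟦⟧ᵈ-false (yes p) ¬p = contradiction p ¬p
    ⟦⟧ᵈ-false (no _)  _  = refl

    ⟦⟧ᵈ*≤ : (P? : Dec P) {x y : ℕ} → (P → x ≤ y) → ⟦ P? ⟧ᵈ * x ≤ y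
    ⟦⟧ᵈ*≤ (yes p) {x} f = ≤-trans (≤-reflexive (*-identityˡ x)) (f p)
    ⟦⟧ᵈ*≤ (no _)      _ = z≤n

  ∑-mono-≤ : ∀ {n} {f g : Fin n → ℕ} → (∀ i → f i ≤ g i) → sum f ≤ sum g
  ∑-mono-≤ {zero}  le = z≤n
  ∑-mono-≤ {suc n} le = +-mono-≤ (le zero) (∑-mono-≤ (le ∘ suc))

  ∑-const : ∀ n c → ∑[ i < n ] c ≡ n * c
  ∑-const zero    c = refl
  ∑-const (suc n) c = cong (c +_) (∑-const n c)

  ∑-zero : ∀ {n} {f : Fin n → ℕ} → (∀ i → f i ≡ 0) → sum f ≡ 0
  ∑-zero {n} eq = trans (sum-cong-≗ eq) (sum-replicate-zero n)

  term≤∑ : ∀ {n} (f : Fin n → ℕ) i → f i ≤ sum f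
  term≤∑ f zero    = m≤m+n _ _
  term≤∑ f (suc i) = ≤-trans (term≤∑ (f ∘ suc) i) (m≤n+m _ _)

  ∑*-mono : ∀ {n} c {f g : Fin n → ℕ} → (∀ i → c * f i ≤ g i) → c * sum f ≤ sum g
  ∑*-mono c {f} le = ≤-trans (≤-reflexive (*-distribˡ-sum c f)) (∑-mono-≤ le)

  ∑-δ : ∀ {n} (f : Fin n → ℕ) i → ∑[ j < n ] (⟦ i ≟ j ⟧ᵈ * f j) ≡ f i
  ∑-δ {suc n} f zero = trans
    (cong (f zero + 0 +_) (∑-zero {f = λ j → 0 * f (suc j)} (λ j → refl)))
    (trans (+-identityʳ _) (+-identityʳ _))
  ∑-δ {suc n} f (suc i) = trans (sum-cong-≗ shift) (∑-δ (f ∘ suc) i)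
    where
    shift : ∀ j → ⟦ suc i ≟ suc j ⟧ᵈ * f (suc j) ≡ ⟦ i ≟ j ⟧ᵈ * f (suc j)
    shift j with i ≟ j
    ... | yes _ = refl
    ... | no  _ = refl

  ∑-injective-≤ : ∀ {m n} (f : Fin n → ℕ) {φ : Fin m → Fin n} → Injective _≡_ _≡_ φ →
                  sum (f ∘ φ) ≤ sum f
  ∑-injective-≤ {m} {n} f {φ} inj = begin
    ∑[ i < m ] f (φ i)                              ≡⟨ sum-cong-≗ (λ i → sym (∑-δ f (φ i))) ⟩
    ∑[ i < m ] ∑[ j < n ] (⟦ φ i ≟ j ⟧ᵈ * f j)      ≡⟨ ∑-comm (λ i j → ⟦ φ i ≟ j ⟧ᵈ * f j) ⟩
    ∑[ j < n ] ∑[ i < m ] (⟦ φ i ≟ j ⟧ᵈ * f j)      ≡⟨ sum-cong-≗ (λ j → sym (*-distribʳ-sum (f j) (λ i → ⟦ φ i ≟ j ⟧ᵈ))) ⟩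
    ∑[ j < n ] (∑[ i < m ] ⟦ φ i ≟ j ⟧ᵈ * f j)      ≤⟨ ∑-mono-≤ (λ j → ≤-trans (*-monoˡ-≤ (f j) (preimages j φ inj)) (≤-reflexive (*-identityˡ _))) ⟩
    sum f                                           ∎
    where
    open ≤-Reasoning
    preimages : ∀ {m n} (j : Fin n) (φ : Fin m → Fin n) → Injective _≡_ _≡_ φ → ∑[ i < m ] ⟦ φ i ≟ j ⟧ᵈ ≤ 1
    preimages {zero}  j φ inj = z≤n
    preimages {suc m} j φ inj with φ zero ≟ j
    ... | no  _    = preimages j (φ ∘ suc) (suc-injective ∘ inj)
    ... | yes refl = ≤-reflexive (cong suc (∑-zero {f = λ i → ⟦ φ (suc i) ≟ φ zero ⟧ᵈ}
                       (λ i → ⟦⟧ᵈ-false (φ (suc i) ≟ φ zero) (λ eq → case inj eq of λ ()))))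
      where open import Function.Base using (case_of_)

  ∑< : (ℕ → ℕ) → ℕ → ℕ
  ∑< f zero    = 0
  ∑< f (suc h) = ∑< f h + f h

  ∑<-∑-comm : ∀ {n} (f : ℕ → Fin n → ℕ) h →
              ∑< (λ i → sum (f i)) h ≡ ∑[ v < n ] ∑< (λ i → f i v) h
  ∑<-∑-comm {n} f zero    = sym (sum-replicate-zero n)
  ∑<-∑-comm f (suc h) = trans (cong (_+ sum (f h)) (∑<-∑-comm f h)) (sym (∑-distrib-+ (λ v → ∑< (λ i → f i v) h) (f h)))

  ∑<-+ : ∀ f g h → ∑< (λ i → f i + g i) h ≡ ∑< f h + ∑< g h
  ∑<-+ f g zero    = refl
  ∑<-+ f g (suc h) = trans (cong (_+ (f h + g h)) (∑<-+ f g h)) (interchange (∑< f h) (∑< g h) (f h) (g h))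
    where
    interchange : ∀ a b c d → a + b + (c + d) ≡ a + c + (b + d)
    interchange = solve-∀

  ∑<-*ˡ : ∀ c f h → ∑< (λ i → c * f i) h ≡ c * ∑< f h
  ∑<-*ˡ c f zero    = sym (*-zeroʳ c)
  ∑<-*ˡ c f (suc h) = trans (cong (_+ c * f h) (∑<-*ˡ c f h)) (sym (*-distribˡ-+ c (∑< f h) (f h)))

  ∑<-*ʳ : ∀ c f h → ∑< (λ i → f i * c) h ≡ ∑< f h * c
  ∑<-*ʳ c f zero    = refl
  ∑<-*ʳ c f (suc h) = trans (cong (_+ f h * c) (∑<-*ʳ c f h)) (sym (*-distribʳ-+ c (∑< f h) (f h)))

  min≤average : ∀ f h → 1 ≤ h → ∃[ i ] (i < h × h * f i ≤ ∑< f h)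
  min≤average f (suc zero)    _ = 0 , ≤-refl , ≤-reflexive (*-identityˡ (f 0))
  min≤average f (suc (suc h)) _ with min≤average f (suc h) (s≤s z≤n)
  ... | i , i<h , le with ≤-total (f i) (f (suc h))
  ...   | inj₁ fi≤ = i , m≤n⇒m≤1+n i<h , ≤-trans (≤-reflexive (+-comm (f i) _)) (+-mono-≤ le fi≤)
  ...   | inj₂ ≤fi = suc h , ≤-refl , ≤-trans (≤-reflexive (+-comm (f (suc h)) _))
                       (+-monoˡ-≤ (f (suc h)) (≤-trans (*-monoʳ-≤ (suc h) ≤fi) le))

module Scales where
  open Sums
  open import Data.Fin.Base using (Fin)
  open import Data.Nat.Base
  open import Data.Nat.DivMod using (_/_; m/n*n≡m)
  open import Data.Nat.Divisibility using (_∣_; ∣m⇒∣m*n; ∣n⇒∣m*n; ∣-reflexive)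
  open import Data.Nat.Properties
  open import Data.Nat.Tactic.RingSolver using (solve-∀)
  open import Data.Product.Base using (_×_; _,_; ∃-syntax)
  open import Data.Sum.Base using (_⊎_; inj₁; inj₂)
  open import Function.Base using (_∘_)
  open import Relation.Binary.PropositionalEquality
  open import Relation.Nullary using (yes; no; contradiction)

  middle : (lo hi x : ℕ) → ℕ
  middle lo hi x = ⟦ lo ≤? x ⟧ᵈ * ⟦ suc x ≤? hi ⟧ᵈ * x

  high : (hi x : ℕ) → ℕ
  high hi x = ⟦ hi ≤? x ⟧ᵈ * hi

  low : (lo x y : ℕ) → ℕ
  low lo x y = ⟦ suc x ≤? lo ⟧ᵈ * (x * y)

  geometric : (b : ℕ → ℕ) (h : ℕ) → (∀ i → i < h → 3 * b i ≤ 2 * b (suc i)) →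
              ∑< b (suc h) ≤ 3 * b h
  geometric b zero    grow = m≤m+n (b 0) _
  geometric b (suc h) grow = begin
    ∑< b (suc h) + b (suc h)     ≤⟨ +-monoˡ-≤ _ (geometric b h (λ i → grow i ∘ m≤n⇒m≤1+n)) ⟩
    3 * b h + b (suc h)          ≤⟨ +-monoˡ-≤ _ (grow h ≤-refl) ⟩
    2 * b (suc h) + b (suc h)    ≡⟨ +-comm (2 * b (suc h)) _ ⟩
    3 * b (suc h)                ∎
    where open ≤-Reasoning

  ∏≤ : (ℕ → ℕ) → ℕ → ℕ
  ∏≤ r zero    = r 0
  ∏≤ r (suc h) = ∏≤ r h * r (suc h)

  ∣∏≤ : ∀ r h i → i ≤ h → r i ∣ ∏≤ r h
  ∣∏≤ r zero    .zero z≤n = ∣-reflexive refl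
  ∣∏≤ r (suc h) i i≤ with m≤n⇒m<n∨m≡n i≤
  ... | inj₁ (s≤s i≤h) = ∣m⇒∣m*n (r (suc h)) (∣∏≤ r h i i≤h)
  ... | inj₂ refl      = ∣n⇒∣m*n (∏≤ r h) (∣-reflexive refl)

  1≤∏≤ : ∀ r h → (∀ i → i ≤ h → 1 ≤ r i) → 1 ≤ ∏≤ r h
  1≤∏≤ r zero    pos = pos 0 z≤n
  1≤∏≤ r (suc h) pos = *-mono-≤ (1≤∏≤ r h (λ i → pos i ∘ m≤n⇒m≤1+n)) (pos (suc h) ≤-refl)

  cancelˡ : ∀ {c x y} → 1 ≤ c → c * x ≤ c * y → x ≤ y
  cancelˡ {c} 1≤c = *-cancelˡ-≤ c {{>-nonZero 1≤c}}

  cancelʳ : ∀ {c x y} → 1 ≤ c → x * c ≤ y * c → x ≤ y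
  cancelʳ {c} 1≤c = *-cancelʳ-≤ _ _ c {{>-nonZero 1≤c}}

  ∑<-low : ∀ (r : ℕ → ℕ) h D (b : ℕ → ℕ) → (∀ i → i < h → b i * r i ≡ D) →
           (∀ i → suc i < h → 3 * b i ≤ 2 * b (suc i)) →
           ∀ x y → ∑< (λ i → b i * low (r i) x y) h ≤ 3 * D * y
  ∑<-low r zero    D b bD grow x y = z≤n
  ∑<-low r (suc h) D b bD grow x y with suc x ≤? r h
  ... | no _ = begin
    ∑< (λ i → b i * low (r i) x y) h + b h * 0  ≡⟨ cong (∑< (λ i → b i * low (r i) x y) h +_) (*-zeroʳ (b h)) ⟩
    ∑< (λ i → b i * low (r i) x y) h + 0        ≡⟨ +-identityʳ _ ⟩
    ∑< (λ i → b i * low (r i) x y) h            ≤⟨ ∑<-low r h D b (λ i → bD i ∘ m≤n⇒m≤1+n) (λ i → grow i ∘ m≤n⇒m≤1+n) x y ⟩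
    3 * D * y                                   ∎
    where open ≤-Reasoning
  ... | yes x<rh = begin
    ∑< (λ i → b i * low (r i) x y) h + b h * (1 * (x * y))
      ≤⟨ +-mono-≤ (drop h) (≤-reflexive (cong (b h *_) (*-identityˡ (x * y)))) ⟩
    ∑< (λ i → b i * (x * y)) (suc h)   ≡⟨ ∑<-*ʳ (x * y) b (suc h) ⟩
    ∑< b (suc h) * (x * y)             ≤⟨ *-monoˡ-≤ (x * y) (geometric b h (λ i → grow i ∘ s≤s)) ⟩
    3 * b h * (x * y)                  ≡⟨ regroup (b h) x y ⟩
    3 * (b h * x) * y                  ≤⟨ *-monoˡ-≤ y (*-monoʳ-≤ 3 (*-monoʳ-≤ (b h) (<⇒≤ x<rh))) ⟩
    3 * (b h * r h) * y                ≡⟨ cong (λ z → 3 * z * y) (bD h ≤-refl) ⟩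
    3 * D * y                          ∎
    where
    open ≤-Reasoning
    regroup : ∀ b x y → 3 * b * (x * y) ≡ 3 * (b * x) * y
    regroup = solve-∀
    drop : ∀ h → ∑< (λ i → b i * low (r i) x y) h ≤ ∑< (λ i → b i * (x * y)) h
    drop zero    = z≤n
    drop (suc h) = +-mono-≤ (drop h) (*-monoʳ-≤ (b h) (⟦⟧ᵈ*≤ (suc x ≤? r h) (λ _ → ≤-refl)))

  module _ (r : ℕ → ℕ) where

    Shrinks : ℕ → Set
    Shrinks h = ∀ i → i < h → 3 * r (suc i) ≤ 2 * r i

    decreasing : ∀ {h} → Shrinks h → ∀ i → i < h → r (suc i) ≤ r i
    decreasing shr i i<h = *-cancelˡ-≤ 3 (≤-trans (shr i i<h) (m≤n+m _ (r i)))

    ∑<-middle : ∀ h → Shrinks h → ∀ x → ∑< (λ i → middle (r (suc i)) (r i) x) h ≤ x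
    ∑<-middle h shr x = begin
      ∑< (λ i → middle (r (suc i)) (r i) x) h  ≡⟨ ∑<-*ʳ x χ h ⟩
      ∑< χ h * x                               ≤⟨ *-monoˡ-≤ x (atMostOne (invariant h shr)) ⟩
      1 * x                                    ≡⟨ *-identityˡ x ⟩
      x                                        ∎
      where
      open ≤-Reasoning
      χ : ℕ → ℕ
      χ i = ⟦ r (suc i) ≤? x ⟧ᵈ * ⟦ suc x ≤? r i ⟧ᵈ
      Inv : ℕ → Set
      Inv h = ∑< χ h ≡ 0 ⊎ (∑< χ h ≤ 1 × r h ≤ x)
      atMostOne : Inv h → ∑< χ h ≤ 1
      atMostOne (inj₁ eq) = ≤-trans (≤-reflexive eq) z≤n
      atMostOne (inj₂ (le , _)) = le
      invariant : ∀ h → Shrinks h → Inv h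
      invariant zero    shr = inj₁ refl
      invariant (suc h) shr with invariant h (λ i → shr i ∘ m≤n⇒m≤1+n)
      ... | inj₂ (le , rh≤x) = inj₂
        ( ≤-trans (≤-reflexive (trans (cong (λ z → ∑< χ h + ⟦ r (suc h) ≤? x ⟧ᵈ * z)
            (⟦⟧ᵈ-false (suc x ≤? r h) (λ x<r → <-irrefl refl (<-≤-trans x<r rh≤x))))
            (trans (cong (∑< χ h +_) (*-zeroʳ ⟦ r (suc h) ≤? x ⟧ᵈ)) (+-identityʳ _)))) le
        , ≤-trans (decreasing shr h ≤-refl) rh≤x )
      ... | inj₁ eq with r (suc h) ≤? x
      ...   | yes le = inj₂ ( ≤-trans (≤-reflexive (cong₂ _+_ eq (*-identityˡ ⟦ suc x ≤? r h ⟧ᵈ))) (⟦⟧ᵈ≤1 (suc x ≤? r h)) , le )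
      ...   | no  _  = inj₁ (trans (+-identityʳ _) eq)

    ∑<-high : ∀ h → Shrinks h → ∀ x → ∑< (λ i → high (r i) x) h ≤ 3 * x
    ∑<-high h shr x = conclude (invariant h shr)
      where
      S : ℕ → ℕ
      S = ∑< (λ i → high (r i) x)
      -- The terms from h on add up to at most 3 r h.
      Inv : ℕ → Set
      Inv h = S h ≡ 0 ⊎ S h + 3 * r h ≤ 3 * x
      conclude : Inv h → S h ≤ 3 * x
      conclude (inj₁ eq) = ≤-trans (≤-reflexive eq) z≤n
      conclude (inj₂ le) = ≤-trans (m≤m+n _ _) le
      step : ∀ h s → 3 * r (suc h) ≤ 2 * r h → s + 3 * r h ≤ 3 * x →
             s + 1 * r h + 3 * r (suc h) ≤ 3 * x
      step h s shr le = begin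
        s + 1 * r h + 3 * r (suc h)  ≤⟨ +-monoʳ-≤ (s + 1 * r h) shr ⟩
        s + 1 * r h + 2 * r h        ≡⟨ collect s (r h) ⟩
        s + 3 * r h                  ≤⟨ le ⟩
        3 * x                        ∎
        where
        open ≤-Reasoning
        collect : ∀ s a → s + 1 * a + 2 * a ≡ s + 3 * a
        collect = solve-∀
      invariant : ∀ h → Shrinks h → Inv h
      invariant zero    shr = inj₁ refl
      invariant (suc h) shr with invariant h (λ i → shr i ∘ m≤n⇒m≤1+n) | r h ≤? x
      ... | inj₁ eq | no  _    = inj₁ (trans (+-identityʳ _) eq)
      ... | inj₁ eq | yes rh≤x = inj₂ (step h (S h) (shr h ≤-refl) (≤-trans (≤-reflexive (cong (_+ 3 * r h) eq)) (*-monoʳ-≤ 3 rh≤x)))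
      ... | inj₂ le | yes _    = inj₂ (step h (S h) (shr h ≤-refl) le)
      ... | inj₂ le | no rh≰x  = contradiction (*-cancelˡ-≤ 3 (≤-trans (m≤n+m _ (S h)) le)) rh≰x

    GoodScale : ∀ (h : ℕ) {p m} (x y : Fin p → Fin m → ℕ) (E : ℕ) → Set
    GoodScale h {m = m} x y E = ∃[ i ] (i < h × (∀ s →
        h * (∑[ v < m ] middle (r (suc i)) (r i) (x s v)) ≤ 7 * E ×
        h * (∑[ v < m ] high (r i) (x s v))               ≤ 7 * E ×
        h * (∑[ v < m ] low (r (suc i)) (x s v) (y s v))  ≤ 7 * E * r (suc i)))

    goodScale′ : ∀ h → 1 ≤ h → (∀ i → i ≤ h → 1 ≤ r i) → Shrinks h →
      ∀ D → 1 ≤ D → (c : ℕ → ℕ) → (∀ i → i ≤ h → c i * r i ≡ D) →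
      ∀ {p m} (x y : Fin p → Fin m → ℕ) E →
      ∑[ s < p ] ∑[ v < m ] (4 * x s v + 3 * y s v) ≤ 7 * E →
      GoodScale h x y E
    goodScale′ h 1≤h pos shr D 1≤D c cD {p} {m} x y E bound = extract (min≤average cost h 1≤h)
      where
      open ≤-Reasoning
      b : ℕ → ℕ
      b = c ∘ suc
      grow : ∀ i → suc i < h → 3 * b i ≤ 2 * b (suc i)
      grow i si<h = cancelʳ (pos (suc (suc i)) si<h) (begin
        3 * b i * r (2 + i)        ≡⟨ swap (b i) (r (2 + i)) ⟩
        b i * (3 * r (2 + i))      ≤⟨ *-monoʳ-≤ (b i) (shr (suc i) si<h) ⟩
        b i * (2 * r (suc i))      ≡⟨ swap′ (b i) (r (suc i)) ⟩
        2 * (b i * r (suc i))      ≡⟨ cong (2 *_) (trans (cD (suc i) (<⇒≤ si<h)) (sym (cD (suc (suc i)) si<h))) ⟩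
        2 * (b (suc i) * r (2 + i)) ≡⟨ sym (*-assoc 2 (b (suc i)) _) ⟩
        2 * b (suc i) * r (2 + i)  ∎)
        where
        swap : ∀ b r → 3 * b * r ≡ b * (3 * r)
        swap = solve-∀
        swap′ : ∀ b r → b * (2 * r) ≡ 2 * (b * r)
        swap′ = solve-∀
      cost₁ : ℕ → ℕ → ℕ → ℕ
      cost₁ i x y = D * middle (r (suc i)) (r i) x + D * high (r i) x + b i * low (r (suc i)) x y
      cost : ℕ → ℕ
      cost i = ∑[ s < p ] ∑[ v < m ] cost₁ i (x s v) (y s v)
      ∑<-cost₁ : ∀ x y → ∑< (λ i → cost₁ i x y) h ≤ D * (4 * x + 3 * y)
      ∑<-cost₁ x y = begin
        ∑< (λ i → cost₁ i x y) h
          ≡⟨ ∑<-+ (λ i → D * middle (r (suc i)) (r i) x + D * high (r i) x) (λ i → b i * low (r (suc i)) x y) h ⟩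
        ∑< (λ i → D * middle (r (suc i)) (r i) x + D * high (r i) x) h + L
          ≡⟨ cong (_+ L) (∑<-+ (λ i → D * middle (r (suc i)) (r i) x) (λ i → D * high (r i) x) h) ⟩
        ∑< (λ i → D * middle (r (suc i)) (r i) x) h + ∑< (λ i → D * high (r i) x) h + L
          ≡⟨ cong₂ (λ u v → u + v + L) (∑<-*ˡ D (λ i → middle (r (suc i)) (r i) x) h) (∑<-*ˡ D (λ i → high (r i) x) h) ⟩
        D * ∑< (λ i → middle (r (suc i)) (r i) x) h + D * ∑< (λ i → high (r i) x) h + L
          ≤⟨ +-mono-≤ (+-mono-≤ (*-monoʳ-≤ D (∑<-middle h shr x)) (*-monoʳ-≤ D (∑<-high h shr x)))
               lowBound ⟩
        D * x + D * (3 * x) + 3 * D * y ≡⟨ collect D x y ⟩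
        D * (4 * x + 3 * y)             ∎
        where
        L : ℕ
        L = ∑< (λ i → b i * low (r (suc i)) x y) h
        collect : ∀ D x y → D * x + D * (3 * x) + 3 * D * y ≡ D * (4 * x + 3 * y)
        collect = solve-∀
        lowBound : L ≤ 3 * D * y
        lowBound = ∑<-low (r ∘ suc) h D b (λ i i<h → cD (suc i) i<h) grow x y
      ∑<-cost : ∑< cost h ≤ D * (7 * E)
      ∑<-cost = begin
        ∑< cost h
          ≡⟨ ∑<-∑-comm (λ i s → ∑[ v < m ] cost₁ i (x s v) (y s v)) h ⟩
        ∑[ s < p ] ∑< (λ i → ∑[ v < m ] cost₁ i (x s v) (y s v)) h
          ≡⟨ sum-cong-≗ (λ s → ∑<-∑-comm (λ i v → cost₁ i (x s v) (y s v)) h) ⟩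
        ∑[ s < p ] ∑[ v < m ] ∑< (λ i → cost₁ i (x s v) (y s v)) h
          ≤⟨ ∑-mono-≤ (λ s → ∑-mono-≤ (λ v → ∑<-cost₁ (x s v) (y s v))) ⟩
        ∑[ s < p ] ∑[ v < m ] (D * (4 * x s v + 3 * y s v))
          ≡⟨ sum-cong-≗ (λ s → sym (*-distribˡ-sum D (λ v → 4 * x s v + 3 * y s v))) ⟩
        ∑[ s < p ] (D * (∑[ v < m ] (4 * x s v + 3 * y s v)))
          ≡⟨ sym (*-distribˡ-sum D (λ s → ∑[ v < m ] (4 * x s v + 3 * y s v))) ⟩
        D * (∑[ s < p ] ∑[ v < m ] (4 * x s v + 3 * y s v))
          ≤⟨ *-monoʳ-≤ D bound ⟩
        D * (7 * E) ∎
      component : ∀ i → h * cost i ≤ ∑< cost h → (k : ℕ) (g : ℕ → ℕ → ℕ) →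
                  (∀ x y → k * g x y ≤ cost₁ i x y) → ∀ s →
                  k * (h * (∑[ v < m ] g (x s v) (y s v))) ≤ D * (7 * E)
      component i avg k g part s = begin
        k * (h * (∑[ v < m ] g (x s v) (y s v)))
          ≡⟨ exchange k h _ ⟩
        h * (k * (∑[ v < m ] g (x s v) (y s v)))
          ≤⟨ *-monoʳ-≤ h (∑*-mono k (λ v → part (x s v) (y s v))) ⟩
        h * (∑[ v < m ] cost₁ i (x s v) (y s v))
          ≤⟨ *-monoʳ-≤ h (term≤∑ (λ s → ∑[ v < m ] cost₁ i (x s v) (y s v)) s) ⟩
        h * cost i  ≤⟨ avg ⟩
        ∑< cost h   ≤⟨ ∑<-cost ⟩
        D * (7 * E) ∎
        where
        exchange : ∀ a b c → a * (b * c) ≡ b * (a * c)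
        exchange = solve-∀
      extract : ∃[ i ] (i < h × h * cost i ≤ ∑< cost h) → GoodScale h x y E
      extract (i , i<h , avg) = i , i<h , λ s →
          cancelˡ 1≤D (component i avg D (λ x _ → middle (r (suc i)) (r i) x)
            (λ x y → ≤-trans (m≤m+n _ (D * high (r i) x)) (m≤m+n _ (b i * low (r (suc i)) x y))) s)
        , cancelˡ 1≤D (component i avg D (λ x _ → high (r i) x)
            (λ x y → ≤-trans (m≤n+m _ (D * middle (r (suc i)) (r i) x)) (m≤m+n _ (b i * low (r (suc i)) x y))) s)
        , cancelˡ {b i} (*≥1ˡ (≤-trans 1≤D (≤-reflexive (sym (cD (suc i) i<h)))))
            (≤-trans (component i avg (b i) (low (r (suc i)))
                (λ x y → m≤n+m _ (D * middle (r (suc i)) (r i) x + D * high (r i) x)) s)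
              (≤-reflexive (trans (cong (_* (7 * E)) (sym (cD (suc i) i<h))) (rearrange (b i) (r (suc i)) (7 * E)))))
        where
        rearrange : ∀ b r e → b * r * e ≡ b * (e * r)
        rearrange = solve-∀
        *≥1ˡ : ∀ {a b} → 1 ≤ a * b → 1 ≤ a
        *≥1ˡ {suc a} _ = s≤s z≤n

    goodScale : ∀ h → 1 ≤ h → (∀ i → i ≤ h → 1 ≤ r i) → Shrinks h →
      ∀ {p m} (x y : Fin p → Fin m → ℕ) E →
      ∑[ s < p ] ∑[ v < m ] (4 * x s v + 3 * y s v) ≤ 7 * E →
      GoodScale h x y E
    goodScale h 1≤h pos shr = goodScale′ h 1≤h pos shr (∏≤ r h) (1≤∏≤ r h pos)
      (λ i → ∏≤ r h / suc (pred (r i)))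
      (λ i i≤h → let r≡ = suc-pred (r i) {{>-nonZero (pos i i≤h)}} in
        subst (λ z → ∏≤ r h / suc (pred (r i)) * z ≡ ∏≤ r h) r≡
          (m/n*n≡m (subst (_∣ ∏≤ r h) (sym r≡) (∣∏≤ r h i i≤h))))

module Networks where
  open Sums
  open Scales
  open import Data.Bool.Base using (Bool; true; false)
  open import Data.Fin.Base using (Fin; zero; suc)
  open import Data.Nat.Base
  open import Data.Nat.Properties
  open import Data.Nat.Tactic.RingSolver using (solve-∀)
  open import Relation.Binary.PropositionalEquality

  infixr 7 _⊗_ _·_ _↿_

  Mat : ℕ → ℕ → Set
  Mat a b = Fin a → Fin b → ℕ

  row : ∀ {a b} → Mat a b → Fin a → ℕ
  row A x = sum (A x)

  col : ∀ {a b} → Mat a b → Fin b → ℕ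
  col {a} A y = ∑[ x < a ] A x y

  total : ∀ {a b} → Mat a b → ℕ
  total A = sum (row A)

  _⊗_ : ∀ {a b c} → Mat a b → Mat b c → Mat a c
  _⊗_ {b = b} A B x z = ∑[ y < b ] (A x y * B y z)

  _·_ : ∀ {a b} → Mat a b → (Fin b → ℕ) → Fin a → ℕ
  _·_ {b = b} A X x = ∑[ y < b ] (A x y * X y)

  χ : Bool → ℕ
  χ true  = 1
  χ false = 0

  keep : Bool → ℕ
  keep true  = 0
  keep false = 1

  _↿_ : ∀ {m} → (Fin m → Bool) → (Fin m → ℕ) → Fin m → ℕ
  (M ↿ X) v = keep (M v) * X v

  total≡∑col : ∀ {a b} (A : Mat a b) → total A ≡ sum (col A)
  total≡∑col A = ∑-comm A

  row-⊗ : ∀ {a b c} (A : Mat a b) (B : Mat b c) x → row (A ⊗ B) x ≡ ∑[ y < b ] (A x y * row B y)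
  row-⊗ A B x = trans (∑-comm (λ z y → A x y * B y z)) (sum-cong-≗ (λ y → sym (*-distribˡ-sum (A x y) (B y))))

  total-⊗ : ∀ {a b c} (A : Mat a b) (B : Mat b c) → total (A ⊗ B) ≡ ∑[ y < b ] (col A y * row B y)
  total-⊗ A B = trans (sum-cong-≗ (row-⊗ A B))
    (trans (∑-comm (λ x y → A x y * row B y)) (sum-cong-≗ (λ y → sym (*-distribʳ-sum (row B y) (λ x → A x y)))))

  ·-assoc : ∀ {a b c} (A : Mat a b) (B : Mat b c) X x → ((A ⊗ B) · X) x ≡ (A · (B · X)) x
  ·-assoc {b = b} {c} A B X x = begin
    ∑[ z < c ] (∑[ y < b ] (A x y * B y z) * X z)    ≡⟨ sum-cong-≗ (λ z → *-distribʳ-sum (X z) (λ y → A x y * B y z)) ⟩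
    ∑[ z < c ] ∑[ y < b ] (A x y * B y z * X z)      ≡⟨ ∑-comm (λ z y → A x y * B y z * X z) ⟩
    ∑[ y < b ] ∑[ z < c ] (A x y * B y z * X z)      ≡⟨ sum-cong-≗ (λ y → sum-cong-≗ (λ z → *-assoc (A x y) (B y z) (X z))) ⟩
    ∑[ y < b ] ∑[ z < c ] (A x y * (B y z * X z))    ≡⟨ sum-cong-≗ (λ y → sym (*-distribˡ-sum (A x y) (λ z → B y z * X z))) ⟩
    ∑[ y < b ] (A x y * ∑[ z < c ] (B y z * X z))    ∎
    where open ≡-Reasoning

  ·-cong : ∀ {a b} (A : Mat a b) {X Y} → (∀ y → X y ≡ Y y) → ∀ x → (A · X) x ≡ (A · Y) x
  ·-cong A eq x = sum-cong-≗ (λ y → cong (A x y *_) (eq y))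

  ·-mono : ∀ {a b} (A : Mat a b) {X Y} → (∀ y → X y ≤ Y y) → ∀ x → (A · X) x ≤ (A · Y) x
  ·-mono A le x = ∑-mono-≤ (λ y → *-monoʳ-≤ (A x y) (le y))

  ·-∑ : ∀ {a b k} (A : Mat a b) (F : Fin k → Fin b → ℕ) x →
        (A · (λ y → ∑[ i < k ] F i y)) x ≡ ∑[ i < k ] (A · F i) x
  ·-∑ A F x = trans (sum-cong-≗ (λ y → *-distribˡ-sum (A x y) (λ i → F i y))) (∑-comm (λ y i → A x y * F i y))

  -- A layered network of depth d whose inner layers all have m vertices,
  -- given by the (weighted) adjacency matrices of consecutive layers.
  data Net (m : ℕ) : (d a b : ℕ) → Set where
    idle : Net m 0 m m
    one  : ∀ {a b} → Mat a b → Net m 1 a b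
    wrap : ∀ {d a b} → Mat a m → Net m d m m → Mat m b → Net m (2 + d) a b

  size : ∀ {m d a b} → Net m d a b → ℕ
  size idle         = 0
  size (one A)      = total A
  size (wrap A N B) = total A + size N + total B

  -- act N M X x = Σ_y p(x,y) X(y), where p(x,y) counts the paths from x to
  -- y whose inner vertices avoid M.
  act : ∀ {m d a b} → Net m d a b → (Fin m → Bool) → (Fin b → ℕ) → Fin a → ℕ
  act idle         M X = X
  act (one A)      M X = A · X
  act (wrap A N B) M X = A · M ↿ act N M (M ↿ B · X)

  act-cong : ∀ {m d a b} (N : Net m d a b) M {X Y} → (∀ y → X y ≡ Y y) → ∀ x → act N M X x ≡ act N M Y x
  act-cong idle         M eq x = eq x
  act-cong (one A)      M eq x = ·-cong A eq x
  act-cong (wrap A N B) M eq x = ·-cong A (λ v → cong (keep (M v) *_)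
    (act-cong N M (λ w → cong (keep (M w) *_) (·-cong B eq w)) v)) x

  act-mono : ∀ {m d a b} (N : Net m d a b) {M M′ X Y} → (∀ v → keep (M v) ≤ keep (M′ v)) →
             (∀ y → X y ≤ Y y) → ∀ x → act N M X x ≤ act N M′ Y x
  act-mono idle         M≤ le x = le x
  act-mono (one A)      M≤ le x = ·-mono A le x
  act-mono (wrap A N B) M≤ le x = ·-mono A (λ v → *-mono-≤ (M≤ v)
    (act-mono N M≤ (λ w → *-mono-≤ (M≤ w) (·-mono B le w)) v)) x

  act-∑ : ∀ {m d a b k} (N : Net m d a b) M (F : Fin k → Fin b → ℕ) x →
          act N M (λ y → ∑[ i < k ] F i y) x ≡ ∑[ i < k ] act N M (F i) x
  act-∑ idle         M F x = refl
  act-∑ (one A)      M F x = ·-∑ A F x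
  act-∑ {k = k} (wrap A N B) M F x = trans (·-cong A layer x) (·-∑ A (λ i → M ↿ act N M (M ↿ B · F i)) x)
    where
    masked : ∀ v (G : Fin k → ℕ) {z} → z ≡ sum G → keep (M v) * z ≡ ∑[ i < k ] (keep (M v) * G i)
    masked v G eq = trans (cong (keep (M v) *_) eq) (*-distribˡ-sum (keep (M v)) G)
    layer : ∀ v → (M ↿ act N M (M ↿ B · (λ y → ∑[ i < k ] F i y))) v ≡
                  ∑[ i < k ] (M ↿ act N M (M ↿ B · F i)) v
    layer v = masked v (λ i → act N M (M ↿ B · F i) v)
      (trans (act-cong N M (λ w → masked w (λ i → (B · F i) w) (·-∑ B F w)) v)
             (act-∑ N M (λ i → M ↿ B · F i) v))

  contracted : ℕ → ℕ
  contracted zero    = 1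
  contracted (suc d) = suc d

  sandwich : ∀ {m d a b} → Mat a m → Net m d m m → Mat m b → Net m (contracted d) a b
  sandwich P idle         Q = one (P ⊗ Q)
  sandwich P (one A)      Q = one (P ⊗ A ⊗ Q)
  sandwich P (wrap A N B) Q = wrap (P ⊗ A) N (B ⊗ Q)

  act-sandwich : ∀ {m d a b} (P : Mat a m) (N : Net m d m m) (Q : Mat m b) M X x →
                 act (sandwich P N Q) M X x ≡ (P · act N M (Q · X)) x
  act-sandwich P idle         Q M X x = ·-assoc P Q X x
  act-sandwich P (one A)      Q M X x = trans (·-assoc P (A ⊗ Q) X x) (·-cong P (·-assoc A Q X) x)
  act-sandwich P (wrap A N B) Q M X x = trans (·-assoc P A _ x)
    (·-cong P (·-cong A (λ v → cong (keep (M v) *_)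
      (act-cong N M (λ w → cong (keep (M w) *_) (·-assoc B Q X w)) v))) x)

  -- The number of wires with which contracting the first (last) inner layer
  -- of wrap R N S replaces each wire into (out of) it.
  fanOut : ∀ {m d b} → Net m d m m → Mat m b → Fin m → ℕ
  fanOut idle         S = row S
  fanOut (one A)      S = row A
  fanOut (wrap A N B) S = row A

  fanIn : ∀ {m d} → Net m d m m → Fin m → ℕ
  fanIn idle         _ = 0
  fanIn (one A)        = col A
  fanIn (wrap A N B)   = col B

  ∑fan≤ : ∀ {m d b} (N : Net m d m m) (S : Mat m b) →
          sum (fanOut N S) + sum (fanIn N) ≤ 2 * size N + total S
  ∑fan≤ {m} idle S = ≤-reflexive (trans (cong (total S +_) (sum-replicate-zero m)) (+-identityʳ _))
  ∑fan≤ (one A) S = ≤-trans (≤-reflexive (cong (total A +_) (trans (sym (total≡∑col A)) (sym (+-identityʳ _))))) (m≤m+n _ _)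
  ∑fan≤ (wrap A N B) S = begin
    total A + sum (col B)                           ≡⟨ cong (total A +_) (sym (total≡∑col B)) ⟩
    total A + total B                               ≤⟨ +-monoˡ-≤ (total B) (m≤m+n (total A) (size N)) ⟩
    size (wrap A N B)                               ≤⟨ m≤m+n _ _ ⟩
    2 * size (wrap A N B)                           ≤⟨ m≤m+n _ _ ⟩
    2 * size (wrap A N B) + total S                 ∎
    where open ≤-Reasoning

  -- In depth 1 the degree bound c is lost on both sides of the only
  -- remaining matrix.
  inflate : ℕ → ℕ → ℕ
  inflate 1 x = x * x
  inflate _ x = x

  module _ {m a b : ℕ} (c : ℕ) (R : Mat a m) (S : Mat m b) where

    lowCols : Mat a m
    lowCols x v = R x v * ⟦ suc (col R v) ≤? c ⟧ᵈ

    lowRows : Mat m b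
    lowRows w y = ⟦ suc (row S w) ≤? c ⟧ᵈ * S w y

    col-lowCols : ∀ v → col lowCols v ≡ ⟦ suc (col R v) ≤? c ⟧ᵈ * col R v
    col-lowCols v = trans (sym (*-distribʳ-sum ⟦ suc (col R v) ≤? c ⟧ᵈ (λ x → R x v))) (*-comm (col R v) _)

    row-lowRows : ∀ w → row lowRows w ≡ ⟦ suc (row S w) ≤? c ⟧ᵈ * row S w
    row-lowRows w = sym (*-distribˡ-sum ⟦ suc (row S w) ≤? c ⟧ᵈ (S w))

    col-lowCols≤ : ∀ v → col lowCols v ≤ c
    col-lowCols≤ v = ≤-trans (≤-reflexive (col-lowCols v)) (⟦⟧ᵈ*≤ (suc (col R v) ≤? c) <⇒≤)

    row-lowRows≤ : ∀ w → row lowRows w ≤ row S w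
    row-lowRows≤ w = ≤-trans (≤-reflexive (row-lowRows w)) (⟦⟧ᵈ*≤ (suc (row S w) ≤? c) (λ _ → ≤-refl))

    lowˡ : ∀ {d} → Net m d m m → ℕ
    lowˡ N = ∑[ v < m ] low c (col R v) (fanOut N S v)

    lowʳ : ∀ {d} → Net m d m m → ℕ
    lowʳ N = ∑[ w < m ] low c (row S w) (fanIn N w)

    total-lowCols-⊗ : ∀ {k} (A : Mat m k) → total (lowCols ⊗ A) ≡ ∑[ v < m ] low c (col R v) (row A v)
    total-lowCols-⊗ A = trans (total-⊗ lowCols A) (sum-cong-≗ (λ v →
      trans (cong (_* row A v) (col-lowCols v)) (*-assoc ⟦ suc (col R v) ≤? c ⟧ᵈ (col R v) (row A v))))

    total-⊗-lowRows : ∀ {k} (A : Mat k m) → total (A ⊗ lowRows) ≡ ∑[ w < m ] low c (row S w) (col A w)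
    total-⊗-lowRows A = trans (total-⊗ A lowRows) (sum-cong-≗ (λ w →
      trans (*-comm (col A w) _) (trans (cong (_* col A w) (row-lowRows w)) (*-assoc ⟦ suc (row S w) ≤? c ⟧ᵈ (row S w) (col A w)))))

    size-sandwich : ∀ {d} (N : Net m d m m) K n →
      4 * (K * size N) ≤ n * c → 4 * (K * lowˡ N) ≤ n * c → 4 * (K * lowʳ N) ≤ n * c →
      K * size (sandwich lowCols N lowRows) ≤ n * inflate d c
    size-sandwich idle K n _ leˡ _ = begin
      K * total (lowCols ⊗ lowRows)                        ≡⟨ cong (K *_) (total-⊗ lowCols lowRows) ⟩
      K * ∑[ v < m ] (col lowCols v * row lowRows v)       ≤⟨ *-monoʳ-≤ K (∑-mono-≤ (λ v → *-monoʳ-≤ (col lowCols v) (row-lowRows≤ v))) ⟩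
      K * ∑[ v < m ] (col lowCols v * row S v)             ≡⟨ cong (K *_) (trans (sym (total-⊗ lowCols S)) (total-lowCols-⊗ S)) ⟩
      K * lowˡ idle                                        ≤⟨ m≤m+n _ _ ⟩
      4 * (K * lowˡ idle)                                  ≤⟨ leˡ ⟩
      n * c                                                ∎
      where open ≤-Reasoning
    size-sandwich (one A) K n _ _ leʳ = begin
      K * total (lowCols ⊗ A ⊗ lowRows)                    ≡⟨ cong (K *_) (total-⊗ lowCols (A ⊗ lowRows)) ⟩
      K * ∑[ v < m ] (col lowCols v * row (A ⊗ lowRows) v) ≤⟨ *-monoʳ-≤ K (∑-mono-≤ (λ v → *-monoˡ-≤ (row (A ⊗ lowRows) v) (col-lowCols≤ v))) ⟩
      K * ∑[ v < m ] (c * row (A ⊗ lowRows) v)             ≡⟨ cong (K *_) (sym (*-distribˡ-sum c (row (A ⊗ lowRows)))) ⟩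
      K * (c * total (A ⊗ lowRows))                        ≡⟨ cong (λ z → K * (c * z)) (total-⊗-lowRows A) ⟩
      K * (c * lowʳ (one A))                               ≡⟨ exchange K c (lowʳ (one A)) ⟩
      K * lowʳ (one A) * c                                 ≤⟨ *-monoˡ-≤ c (≤-trans (m≤m+n (K * lowʳ (one A)) _) leʳ) ⟩
      n * c * c                                            ≡⟨ *-assoc n c c ⟩
      n * (c * c)                                          ∎
      where
      open ≤-Reasoning
      exchange : ∀ a b c → a * (b * c) ≡ a * c * b
      exchange = solve-∀
    size-sandwich {d} (wrap A N B) K n le leˡ leʳ = *-cancelˡ-≤ 4 (begin
      4 * (K * (total (lowCols ⊗ A) + size N + total (B ⊗ lowRows)))
        ≡⟨ cong₂ (λ u v → 4 * (K * (u + size N + v))) (total-lowCols-⊗ A) (total-⊗-lowRows B) ⟩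
      4 * (K * (lowˡ (wrap A N B) + size N + lowʳ (wrap A N B)))
        ≡⟨ distribute K (lowˡ (wrap A N B)) (size N) (lowʳ (wrap A N B)) ⟩
      4 * (K * lowˡ (wrap A N B)) + 4 * (K * size N) + 4 * (K * lowʳ (wrap A N B))
        ≤⟨ +-mono-≤ (+-mono-≤ leˡ (≤-trans (*-monoʳ-≤ 4 (*-monoʳ-≤ K (≤-trans (m≤n+m _ (total A)) (m≤m+n _ (total B))))) le)) leʳ ⟩
      n * c + n * c + n * c          ≤⟨ m≤m+n _ (n * c) ⟩
      n * c + n * c + n * c + n * c  ≡⟨ fourfold (n * c) ⟩
      4 * (n * c)                    ∎)
      where
      open ≤-Reasoning
      distribute : ∀ K a b c → 4 * (K * (a + b + c)) ≡ 4 * (K * a) + 4 * (K * b) + 4 * (K * c)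
      distribute = solve-∀
      fourfold : ∀ z → z + z + z + z ≡ 4 * z
      fourfold = solve-∀

module LowerBound where
  open Sums
  open Scales
  open Networks
  open import Data.Bool.Base using (Bool; true; false; _∨_)
  open import Data.Fin.Base using (Fin; zero; suc)
  open import Data.Nat.Base
  open import Data.Nat.GeneralisedArithmetic using (fold)
  open import Data.Nat.Properties
  open import Data.Nat.Tactic.RingSolver using (solve-∀)
  open import Data.Product.Base using (_×_; _,_; ∃-syntax; proj₁; proj₂)
  open import Function.Base using (_∘_)
  open import Relation.Binary.PropositionalEquality
  open import Relation.Nullary using (Dec; yes; no; ¬_; does; contradiction)

  count : ∀ {n} → (Fin n → Bool) → ℕ
  count p = sum (χ ∘ p)

  record Sparse (e n s : ℕ) {m d a b} (N : Net m d a b) : Set where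
    field
      I     : Fin a → Bool
      O     : Fin b → Bool
      M     : Fin m → Bool
      few-I : e * count I ≤ n
      few-O : e * count O ≤ n
      few-M : e * (s * count M) ≤ n
      reach : ∀ x → I x ≡ false → e * act N M (keep ∘ O) x ≤ s

  LowerBound : ℕ → (ℕ → ℕ) → Set
  LowerBound d f = ∀ e → 1 ≤ e → ∃[ K ] (1 ≤ K × (∀ {m a b} n r → 1 ≤ n → 2 ≤ r → (N : Net m d a b) →
    K * size N ≤ n * f r → ∃[ s ] (1 ≤ s × s ≤ r × Sparse e n s N)))

  χ-does : ∀ {p} {P : Set p} (P? : Dec P) → χ (does P?) ≡ ⟦ P? ⟧ᵈ
  χ-does (yes _) = refl
  χ-does (no _)  = refl

  does-false : ∀ {p} {P : Set p} (P? : Dec P) → does P? ≡ false → ¬ P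
  does-false (no ¬p) _ = ¬p

  count-∨ : ∀ {n} (p q : Fin n → Bool) → count (λ v → p v ∨ q v) ≤ count p + count q
  count-∨ p q = ≤-trans (∑-mono-≤ (λ v → χ-∨ (p v) (q v))) (≤-reflexive (∑-distrib-+ (χ ∘ p) (χ ∘ q)))
    where
    χ-∨ : ∀ x y → χ (x ∨ y) ≤ χ x + χ y
    χ-∨ true  y = s≤s z≤n
    χ-∨ false y = ≤-refl

  ∨-false : ∀ x {y} → x ∨ y ≡ false → x ≡ false × y ≡ false
  ∨-false false eq = refl , eq

  keep-∨ˡ : ∀ x y → keep (x ∨ y) ≤ keep x
  keep-∨ˡ true  y     = z≤n
  keep-∨ˡ false true  = z≤n
  keep-∨ˡ false false = ≤-refl

  keep-∨ʳ : ∀ x y → keep (x ∨ y) ≤ keep y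
  keep-∨ʳ true  y = z≤n
  keep-∨ʳ false y = ≤-refl

  lowerBound-1 : LowerBound 1 (λ r → r)
  lowerBound-1 e 1≤e = e * e , *-mono-≤ 1≤e 1≤e , λ { n r 1≤n 2≤r (one A) le → r , <⇒≤ 2≤r , ≤-refl , sparse n r 2≤r A le }
    where
    sparse : ∀ {m a b} n r → 2 ≤ r → (A : Mat a b) → e * e * total A ≤ n * r → Sparse e n r (one {m} A)
    sparse {m} {a} {b} n r 2≤r A le = record
      { I     = I
      ; O     = λ _ → false
      ; M     = λ _ → false
      ; few-I = cancelʳ (<⇒≤ 2≤r) (begin
          e * count I * r         ≡⟨ *-assoc e _ r ⟩
          e * (count I * r)       ≡⟨ cong (e *_) (*-comm _ r) ⟩
          e * (r * count I)       ≤⟨ *-monoʳ-≤ e (∑*-mono r heavy) ⟩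
          e * ∑[ x < a ] (e * row A x) ≡⟨ cong (e *_) (sym (*-distribˡ-sum e (row A))) ⟩
          e * (e * total A)       ≡⟨ sym (*-assoc e e _) ⟩
          e * e * total A         ≤⟨ le ⟩
          n * r                   ∎)
      ; few-O = none {b} e
      ; few-M = ≤-trans (≤-reflexive (sym (*-assoc e r _))) (none {m} (e * r))
      ; reach = λ x light → ≤-trans (≤-reflexive (cong (e *_) (sum-cong-≗ (λ y → *-identityʳ (A x y)))))
                  (≤-pred (≰⇒> (does-false (suc r ≤? e * row A x) light)))
      }
      where
      open ≤-Reasoning
      I : Fin a → Bool
      I x = does (suc r ≤? e * row A x)
      none : ∀ {k} c → c * count {k} (λ _ → false) ≤ n
      none {k} c = ≤-trans (≤-reflexive (trans (cong (c *_) (sum-replicate-zero k)) (*-zeroʳ c))) z≤n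
      heavy : ∀ x → r * χ (I x) ≤ e * row A x
      heavy x = ≤-trans (≤-reflexive (trans (*-comm r _) (cong (_* r) (χ-does (suc r ≤? e * row A x)))))
        (⟦⟧ᵈ*≤ (suc r ≤? e * row A x) <⇒≤)

  weaken : ∀ {d f g} → (∀ m → g m ≤ f m) → LowerBound d f → LowerBound d g
  weaken g≤f lb e 1≤e with lb e 1≤e
  ... | K , 1≤K , sep = K , 1≤K , λ n r 1≤n 2≤r N le → sep n r 1≤n 2≤r N (≤-trans le (*-monoʳ-≤ n (g≤f r)))

  Contracts : (ℕ → ℕ) → Set
  Contracts f = ∀ m → 2 ≤ m → 1 ≤ f m × 3 * f m ≤ 2 * m

  Lasts : (ℕ → ℕ) → ℕ → ℕ → Set
  Lasts f r L = ∀ i → i < L → 2 ≤ fold r f i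

  module _ {f : ℕ → ℕ} (contracts : Contracts f) {r L : ℕ} (lasts : Lasts f r L) (2≤r : 2 ≤ r) where

    iterate-decreasing : ∀ i → i < L → fold r f (suc i) < fold r f i
    iterate-decreasing i i<L = *-cancelˡ-< 3 _ _ (begin-strict
      3 * fold r f (suc i) ≤⟨ proj₂ (contracts _ (lasts i i<L)) ⟩
      2 * fold r f i       <⟨ m<n+m (2 * fold r f i) (≤-trans (s≤s z≤n) (lasts i i<L)) ⟩
      3 * fold r f i       ∎)
      where open ≤-Reasoning

    iterate≥1 : ∀ i → i ≤ L → 1 ≤ fold r f i
    iterate≥1 zero    _   = <⇒≤ 2≤r
    iterate≥1 (suc i) i<L = proj₁ (contracts _ (lasts i i<L))

    iterate≥remaining : ∀ k j → k + j ≡ L → suc k ≤ fold r f j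
    iterate≥remaining zero    j refl = iterate≥1 j ≤-refl
    iterate≥remaining (suc k) j eq   = ≤-trans
      (s≤s (iterate≥remaining k (suc j) (trans (+-suc k j) eq)))
      (iterate-decreasing j (≤-trans (s≤s (m≤n+m j k)) (≤-reflexive eq)))

    iterate≤start : ∀ i → i ≤ L → fold r f i ≤ r
    iterate≤start zero    _   = ≤-refl
    iterate≤start (suc i) i<L = ≤-trans (<⇒≤ (iterate-decreasing i i<L)) (iterate≤start i (<⇒≤ i<L))

  half : ∀ L → ∃[ h ] (L ≤ 2 * h × 2 * h ≤ suc L)
  half zero          = 0 , z≤n , z≤n
  half (suc zero)    = 1 , s≤s z≤n , ≤-refl
  half (suc (suc L)) with half L
  ... | h , lo , hi = suc h , ≤-trans (s≤s (s≤s lo)) (≤-reflexive (sym (double h)))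
                    , ≤-trans (≤-reflexive (double h)) (s≤s (s≤s hi))
    where
    double : ∀ h → 2 * suc h ≡ suc (suc (2 * h))
    double = solve-∀

  -- Wires at inner vertices of middle degree are charged to the exceptional
  -- inputs I and outputs O, vertices of high degree are put into M, and the
  -- vertices of low degree are contracted.
  module Step {d m a b : ℕ} (lo hi : ℕ) (R : Mat a m) (N : Net m d m m) (S : Mat m b) where

    P : Mat a m
    P = lowCols lo R S

    Q : Mat m b
    Q = lowRows lo R S

    middleˡ middleʳ highˡ highʳ : ℕ
    middleˡ = ∑[ v < m ] middle lo hi (col R v)
    middleʳ = ∑[ w < m ] middle lo hi (row S w)
    highˡ   = ∑[ v < m ] high hi (col R v)
    highʳ   = ∑[ w < m ] high hi (row S w)

    mid? : (x : ℕ) → ℕ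
    mid? x = ⟦ lo ≤? x ⟧ᵈ * ⟦ suc x ≤? hi ⟧ᵈ

    Iᵐ : Fin a → Bool
    Iᵐ x = does (1 ≤? ∑[ v < m ] (mid? (col R v) * R x v))

    Oᵐ : Fin b → Bool
    Oᵐ y = does (1 ≤? ∑[ w < m ] (mid? (row S w) * S w y))

    Mˡ Mʳ : Fin m → Bool
    Mˡ v = does (hi ≤? col R v)
    Mʳ w = does (hi ≤? row S w)

    count-nonzero : ∀ {k} (g : Fin k → ℕ) → count (λ x → does (1 ≤? g x)) ≤ sum g
    count-nonzero g = ∑-mono-≤ (λ x → ≤-trans (≤-reflexive (trans (χ-does (1 ≤? g x)) (sym (*-identityʳ _))))
      (⟦⟧ᵈ*≤ (1 ≤? g x) (λ le → le)))

    count-Iᵐ : count Iᵐ ≤ middleˡ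
    count-Iᵐ = ≤-trans (count-nonzero (λ x → ∑[ v < m ] (mid? (col R v) * R x v))) (≤-reflexive (trans (∑-comm (λ x v → mid? (col R v) * R x v))
      (sum-cong-≗ (λ v → sym (*-distribˡ-sum (mid? (col R v)) (λ x → R x v))))))

    count-Oᵐ : count Oᵐ ≤ middleʳ
    count-Oᵐ = ≤-trans (count-nonzero (λ y → ∑[ w < m ] (mid? (row S w) * S w y))) (≤-reflexive (trans (∑-comm (λ y w → mid? (row S w) * S w y))
      (sum-cong-≗ (λ w → sym (*-distribˡ-sum (mid? (row S w)) (S w))))))

    count-high : ∀ {k} (g : Fin k → ℕ) → hi * count (λ v → does (hi ≤? g v)) ≤ ∑[ v < k ] high hi (g v)
    count-high g = ∑*-mono hi (λ v → ≤-reflexive (trans (*-comm hi _) (cong (_* hi) (χ-does (hi ≤? g v)))))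

    low-or-removed : ∀ x z → mid? x * z ≡ 0 → z * keep (does (hi ≤? x)) ≤ z * ⟦ suc x ≤? lo ⟧ᵈ
    low-or-removed x z eq = cases (hi ≤? x) (suc x ≤? lo)
      where
      cases : (hi≤? : Dec (hi ≤ x)) (<lo? : Dec (suc x ≤ lo)) → z * keep (does hi≤?) ≤ z * ⟦ <lo? ⟧ᵈ
      cases (yes _)    _        = ≤-trans (≤-reflexive (*-zeroʳ z)) z≤n
      cases (no _)     (yes _)  = ≤-refl
      cases (no hi≰x) (no x≮lo) = ≤-reflexive (trans (cong (_* 1) z≡0) (sym (cong (_* 0) z≡0)))
        where
        z≡0 : z ≡ 0
        z≡0 = trans (sym (*-identityˡ z)) (trans (cong (_* z) (sym
          (cong₂ _*_ (⟦⟧ᵈ-true (lo ≤? x) (≮⇒≥ x≮lo)) (⟦⟧ᵈ-true (suc x ≤? hi) (≰⇒> hi≰x))))) eq)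

    vanishes : ∀ {k} (g : Fin k → ℕ) → does (1 ≤? sum g) ≡ false → ∀ i → g i ≡ 0
    vanishes g eq i = n≤0⇒n≡0 (≤-trans (term≤∑ g i) (≤-pred (≰⇒> (does-false (1 ≤? sum g) eq))))

    module _ (O : Fin b → Bool) (M : Fin m → Bool) where

      O∪ : Fin b → Bool
      O∪ y = O y ∨ Oᵐ y

      M∪ : Fin m → Bool
      M∪ v = M v ∨ (Mˡ v ∨ Mʳ v)

      first-layer : ∀ x → Iᵐ x ≡ false → ∀ v → R x v * keep (M∪ v) ≤ P x v
      first-layer x x∉I v = ≤-trans
        (*-monoʳ-≤ (R x v) (≤-trans (keep-∨ʳ (M v) _) (keep-∨ˡ (Mˡ v) (Mʳ v))))
        (low-or-removed (col R v) (R x v) (vanishes _ x∉I v))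

      last-layer : ∀ w y → keep (M∪ w) * (S w y * keep (O∪ y)) ≤ Q w y * keep (O y)
      last-layer w y with Oᵐ y in eq
      ... | true = ≤-trans (≤-reflexive (trans (cong (λ z → keep (M∪ w) * (S w y * z)) (keep-true (O y)))
                     (trans (cong (keep (M∪ w) *_) (*-zeroʳ (S w y))) (*-zeroʳ (keep (M∪ w)))))) z≤n
        where
        keep-true : ∀ x → keep (x ∨ true) ≡ 0
        keep-true true  = refl
        keep-true false = refl
      ... | false = begin
        keep (M∪ w) * (S w y * keep (O y ∨ false))  ≤⟨ *-monoʳ-≤ (keep (M∪ w)) (*-monoʳ-≤ (S w y) (keep-∨ˡ (O y) false)) ⟩
        keep (M∪ w) * (S w y * keep (O y))          ≡⟨ rotate (keep (M∪ w)) (S w y) (keep (O y)) ⟩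
        S w y * keep (M∪ w) * keep (O y)            ≤⟨ *-monoˡ-≤ (keep (O y)) (≤-trans
            (*-monoʳ-≤ (S w y) (≤-trans (keep-∨ʳ (M w) _) (keep-∨ʳ (Mˡ w) (Mʳ w))))
            (low-or-removed (row S w) (S w y) (vanishes _ eq w))) ⟩
        S w y * ⟦ suc (row S w) ≤? lo ⟧ᵈ * keep (O y) ≡⟨ cong (_* keep (O y)) (*-comm (S w y) _) ⟩
        Q w y * keep (O y)                          ∎
        where
        open ≤-Reasoning
        rotate : ∀ a b c → a * (b * c) ≡ b * a * c
        rotate = solve-∀

      act-wrap≤ : ∀ x → Iᵐ x ≡ false →
        act (wrap R N S) M∪ (keep ∘ O∪) x ≤ act (sandwich P N Q) M (keep ∘ O) x
      act-wrap≤ x x∉I = begin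
        ∑[ v < m ] (R x v * (keep (M∪ v) * act N M∪ last∪ v))
          ≡⟨ sum-cong-≗ (λ v → sym (*-assoc (R x v) (keep (M∪ v)) _)) ⟩
        ∑[ v < m ] (R x v * keep (M∪ v) * act N M∪ last∪ v)
          ≤⟨ ∑-mono-≤ (λ v → *-mono-≤ (first-layer x x∉I v)
               (act-mono N (λ u → keep-∨ˡ (M u) _) (λ w → ∑*-mono (keep (M∪ w)) (last-layer w)) v)) ⟩
        ∑[ v < m ] (P x v * act N M (Q · keep ∘ O) v)
          ≡⟨ sym (act-sandwich P N Q M (keep ∘ O) x) ⟩
        act (sandwich P N Q) M (keep ∘ O) x ∎
        where
        open ≤-Reasoning
        last∪ : Fin m → ℕ
        last∪ = M∪ ↿ S · keep ∘ O∪

  lowerBound-step : ∀ d {F f g} → LowerBound (contracted d) F → Contracts f →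
    (∀ b → 2 ≤ b → inflate d (f b) ≤ F b) →
    (∀ r → 2 ≤ r → 1 ≤ g r × Lasts f r (g r)) →
    LowerBound (2 + d) g
  lowerBound-step d {F} {f} {g} lb contracts inflate≤F lasts e 1≤e
    with lb (3 * e) (≤-trans 1≤e (m≤m+n e _))
  ... | K′ , 1≤K′ , rec = K , *-mono-≤ {1} {56} (s≤s z≤n) (≤-trans 1≤e (m≤m+n e K′)) , bound
    where
    open ≤-Reasoning
    K : ℕ
    K = 56 * (e + K′)
    scaled : ∀ n {E h z c} → 1 ≤ h → K * E ≤ n * (2 * h) → h * z ≤ 7 * E * c →
             4 * ((e + K′) * z) ≤ n * c
    scaled n {E} {h} {z} {c} 1≤h KE≤ hz≤ = cancelˡ {14 * h} (*-mono-≤ {1} {14} (s≤s z≤n) 1≤h) (begin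
      14 * h * (4 * ((e + K′) * z))  ≡⟨ regroup h (e + K′) z ⟩
      K * (h * z)                    ≤⟨ *-monoʳ-≤ K hz≤ ⟩
      K * (7 * E * c)                ≡⟨ regroup′ K E c ⟩
      7 * c * (K * E)                ≤⟨ *-monoʳ-≤ (7 * c) KE≤ ⟩
      7 * c * (n * (2 * h))          ≡⟨ regroup″ c n h ⟩
      14 * h * (n * c)               ∎)
      where
      regroup : ∀ h k z → 14 * h * (4 * (k * z)) ≡ 56 * k * (h * z)
      regroup = solve-∀
      regroup′ : ∀ k E c → k * (7 * E * c) ≡ 7 * c * (k * E)
      regroup′ = solve-∀
      regroup″ : ∀ c n h → 7 * c * (n * (2 * h)) ≡ 14 * h * (n * c)
      regroup″ = solve-∀
    e-part : ∀ {y z} → 4 * ((e + K′) * y) ≤ z → 3 * e * y ≤ z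
    e-part {y} {z} le = begin
      3 * e * y              ≤⟨ *-monoˡ-≤ y (*-mono-≤ {3} {4} (s≤s (s≤s (s≤s z≤n))) (m≤m+n e K′)) ⟩
      4 * (e + K′) * y       ≡⟨ *-assoc 4 (e + K′) y ⟩
      4 * ((e + K′) * y)     ≤⟨ le ⟩
      z                      ∎
    K-part : ∀ {y z} → 4 * ((e + K′) * y) ≤ z → 4 * (K′ * y) ≤ z
    K-part {y} le = ≤-trans (*-monoʳ-≤ 4 (*-monoˡ-≤ y (m≤n+m K′ e))) le
    bound : ∀ {m a b} n r → 1 ≤ n → 2 ≤ r → (N : Net m (2 + d) a b) →
            K * size N ≤ n * g r → ∃[ s ] (1 ≤ s × s ≤ r × Sparse e n s N)
    bound {m} n r 1≤n 2≤r (wrap R N S) KE≤ with half (g r)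
    ... | h , L≤2h , 2h≤1+L = assemble (goodScale rᵢ h 1≤h
            (λ i i≤h → iterate≥1 contracts last 2≤r i (≤-trans i≤h h≤L))
            (λ i i<h → proj₂ (contracts _ (last i (<-≤-trans i<h h≤L))))
            degrees fans E degreeSum)
      where
      L E : ℕ
      L = g r
      E = size (wrap R N S)
      last : Lasts f r L
      last = proj₂ (lasts r 2≤r)
      1≤L : 1 ≤ L
      1≤L = proj₁ (lasts r 2≤r)
      rᵢ : ℕ → ℕ
      rᵢ = fold r f
      1≤h : 1 ≤ h
      1≤h = n≢0⇒n>0 λ { refl → contradiction (≤-trans 1≤L L≤2h) λ () }
      h≤L : h ≤ L
      h≤L = *-cancelˡ-≤ 2 (≤-trans 2h≤1+L (≤-trans (+-monoˡ-≤ L 1≤L) (+-monoʳ-≤ L (≤-reflexive (sym (+-identityʳ L))))))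
      degrees fans : Fin 2 → Fin m → ℕ
      degrees zero    = col R
      degrees (suc _) = row S
      fans zero    = fanOut N S
      fans (suc _) = fanIn N
      weighted : ∀ (x y : Fin m → ℕ) → ∑[ v < m ] (4 * x v + 3 * y v) ≡ 4 * sum x + 3 * sum y
      weighted x y = trans (∑-distrib-+ (λ v → 4 * x v) (λ v → 3 * y v))
        (sym (cong₂ _+_ (*-distribˡ-sum 4 x) (*-distribˡ-sum 3 y)))
      degreeSum : ∑[ s < 2 ] ∑[ v < m ] (4 * degrees s v + 3 * fans s v) ≤ 7 * E
      degreeSum = begin
        ∑[ s < 2 ] ∑[ v < m ] (4 * degrees s v + 3 * fans s v)
          ≡⟨ cong₂ (λ u v → u + (v + 0)) (weighted (col R) (fanOut N S)) (weighted (row S) (fanIn N)) ⟩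
        4 * sum (col R) + 3 * sum (fanOut N S) + (4 * total S + 3 * sum (fanIn N) + 0)
          ≡⟨ cong (λ z → 4 * z + 3 * sum (fanOut N S) + (4 * total S + 3 * sum (fanIn N) + 0)) (sym (total≡∑col R)) ⟩
        4 * total R + 3 * sum (fanOut N S) + (4 * total S + 3 * sum (fanIn N) + 0)
          ≡⟨ regroup (total R) (total S) (sum (fanOut N S)) (sum (fanIn N)) ⟩
        4 * total R + 4 * total S + 3 * (sum (fanOut N S) + sum (fanIn N))
          ≤⟨ +-monoʳ-≤ (4 * total R + 4 * total S) (*-monoʳ-≤ 3 (∑fan≤ N S)) ⟩
        4 * total R + 4 * total S + 3 * (2 * size N + total S)
          ≤⟨ m≤m+n _ (3 * total R + size N) ⟩
        4 * total R + 4 * total S + 3 * (2 * size N + total S) + (3 * total R + size N)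
          ≡⟨ regroup′ (total R) (size N) (total S) ⟩
        7 * E ∎
        where
        regroup : ∀ r s x y → 4 * r + 3 * x + (4 * s + 3 * y + 0) ≡ 4 * r + 4 * s + 3 * (x + y)
        regroup = solve-∀
        regroup′ : ∀ r n s → 4 * r + 4 * s + 3 * (2 * n + s) + (3 * r + n) ≡ 7 * (r + n + s)
        regroup′ = solve-∀
      KE≤2nh : K * E ≤ n * (2 * h)
      KE≤2nh = ≤-trans KE≤ (*-monoʳ-≤ n L≤2h)
      scaled₁ : ∀ {z} → h * z ≤ 7 * E → 4 * ((e + K′) * z) ≤ n
      scaled₁ le = ≤-trans (scaled n 1≤h KE≤2nh (≤-trans le (≤-reflexive (sym (*-identityʳ (7 * E))))))
                           (≤-reflexive (*-identityʳ n))
      late : ∀ i → i < h → L ≤ 2 * rᵢ (suc i)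
      late i i<h with m≤n⇒∃[o]m+o≡n (≤-trans i<h h≤L)
      ... | k , eq = ≤-pred (+-cancelʳ-≤ (2 * suc i) (suc L) (suc (2 * rᵢ (suc i))) (begin
        suc L + 2 * suc i        ≤⟨ +-monoʳ-≤ (suc L) (≤-trans (*-monoʳ-≤ 2 i<h) 2h≤1+L) ⟩
        suc L + suc L            ≡⟨ cong (λ z → suc z + suc z) (sym eq) ⟩
        suc (suc i + k) + suc (suc i + k) ≡⟨ regroup i k ⟩
        2 * suc k + 2 * suc i    ≤⟨ +-monoˡ-≤ (2 * suc i) (*-monoʳ-≤ 2 (iterate≥remaining contracts last 2≤r k (suc i) (trans (+-comm k (suc i)) eq))) ⟩
        2 * rᵢ (suc i) + 2 * suc i ≤⟨ n≤1+n _ ⟩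
        suc (2 * rᵢ (suc i)) + 2 * suc i ∎))
        where
        regroup : ∀ i k → suc (suc i + k) + suc (suc i + k) ≡ 2 * suc k + 2 * suc i
        regroup = solve-∀
      assemble : GoodScale rᵢ h degrees fans E →
        ∃[ s ] (1 ≤ s × s ≤ r × Sparse e n s (wrap R N S))
      assemble (i , i<h , good) with good zero | good (suc zero)
      ... | midˡ , highˡ≤ , lowˡ≤ | midʳ , highʳ≤ , lowʳ≤ = finish
              (rec n hi 1≤n 2≤hi (sandwich P N Q) (≤-trans contractedSize (*-monoʳ-≤ n (inflate≤F hi 2≤hi))))
        where
        hi lo : ℕ
        hi = rᵢ i
        lo = rᵢ (suc i)
        2≤hi : 2 ≤ hi
        2≤hi = last i (<-≤-trans i<h h≤L)
        open Step lo hi R N S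
        contractedSize : K′ * size (sandwich P N Q) ≤ n * inflate d lo
        contractedSize = size-sandwich lo R S N K′ n
          (begin
            4 * (K′ * size N)           ≡⟨ sym (*-assoc 4 K′ (size N)) ⟩
            4 * K′ * size N             ≤⟨ *-mono-≤ (*-monoʳ-≤ 4 (m≤n+m K′ e)) (≤-trans (m≤n+m (size N) (total R)) (m≤m+n _ (total S))) ⟩
            4 * (e + K′) * E            ≤⟨ *-cancelˡ-≤ 14 (begin
              14 * (4 * (e + K′) * E)     ≡⟨ regroup (e + K′) E ⟩
              K * E                       ≤⟨ KE≤ ⟩
              n * L                       ≤⟨ *-monoʳ-≤ n (late i i<h) ⟩
              n * (2 * lo)                ≤⟨ m≤m+n _ (12 * (n * lo)) ⟩
              n * (2 * lo) + 12 * (n * lo) ≡⟨ regroup′ n lo ⟩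
              14 * (n * lo)               ∎) ⟩
            n * lo                      ∎)
          (K-part (scaled n 1≤h KE≤2nh lowˡ≤)) (K-part (scaled n 1≤h KE≤2nh lowʳ≤))
          where
          regroup : ∀ k E → 14 * (4 * k * E) ≡ 56 * k * E
          regroup = solve-∀
          regroup′ : ∀ n l → n * (2 * l) + 12 * (n * l) ≡ 14 * (n * l)
          regroup′ = solve-∀
        finish : ∃[ s ] (1 ≤ s × s ≤ hi × Sparse (3 * e) n s (sandwich P N Q)) →
                 ∃[ s ] (1 ≤ s × s ≤ r × Sparse e n s (wrap R N S))
        finish (s , 1≤s , s≤hi , sp) = s , 1≤s
          , ≤-trans s≤hi (iterate≤start contracts last 2≤r i (<⇒≤ (<-≤-trans i<h h≤L)))
          , record
            { I = λ x → I x ∨ Iᵐ x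
            ; O = O∪ O M
            ; M = M∪ O M
            ; few-I = thirds (≤-trans (count-∨ I Iᵐ) (≤-trans (+-monoʳ-≤ (count I) count-Iᵐ) (m≤m+n _ 0)))
                        few-I (e-part (scaled₁ midˡ)) nothing
            ; few-O = thirds (≤-trans (count-∨ O Oᵐ) (≤-trans (+-monoʳ-≤ (count O) count-Oᵐ) (m≤m+n _ 0)))
                        few-O (e-part (scaled₁ midʳ)) nothing
            ; few-M = thirds removed few-M (e-part (scaled₁ highˡ≤)) (e-part (scaled₁ highʳ≤))
            ; reach = λ x x∉ → let x∉I , x∉Iᵐ = ∨-false (I x) x∉ in
                ≤-trans (*-mono-≤ (m≤m+n e (e + (e + 0))) (act-wrap≤ O M x x∉Iᵐ)) (reach x x∉I)
            }
          where
          open Sparse sp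
          nothing : 3 * e * 0 ≤ n
          nothing = ≤-trans (≤-reflexive (*-zeroʳ (3 * e))) z≤n
          thirds : ∀ {z x₁ x₂ x₃} → z ≤ x₁ + x₂ + x₃ →
                   3 * e * x₁ ≤ n → 3 * e * x₂ ≤ n → 3 * e * x₃ ≤ n → e * z ≤ n
          thirds {z} {x₁} {x₂} {x₃} z≤ le₁ le₂ le₃ = *-cancelˡ-≤ 3 (begin
            3 * (e * z)                ≡⟨ sym (*-assoc 3 e z) ⟩
            3 * e * z                  ≤⟨ *-monoʳ-≤ (3 * e) z≤ ⟩
            3 * e * (x₁ + x₂ + x₃)     ≡⟨ distribute (3 * e) x₁ x₂ x₃ ⟩
            3 * e * x₁ + 3 * e * x₂ + 3 * e * x₃  ≤⟨ +-mono-≤ (+-mono-≤ le₁ le₂) le₃ ⟩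
            n + n + n                  ≡⟨ triple n ⟩
            3 * n                      ∎)
            where
            distribute : ∀ c x y z → c * (x + y + z) ≡ c * x + c * y + c * z
            distribute = solve-∀
            triple : ∀ n → n + n + n ≡ 3 * n
            triple = solve-∀
          removed : s * count (M∪ O M) ≤ s * count M + highˡ + highʳ
          removed = begin
            s * count (M∪ O M)                         ≤⟨ *-monoʳ-≤ s (≤-trans (count-∨ M _) (+-monoʳ-≤ (count M) (count-∨ Mˡ Mʳ))) ⟩
            s * (count M + (count Mˡ + count Mʳ))      ≡⟨ distribute s (count M) (count Mˡ) (count Mʳ) ⟩
            s * count M + s * count Mˡ + s * count Mʳ  ≤⟨ +-mono-≤ (+-monoʳ-≤ (s * count M)
                (≤-trans (*-monoˡ-≤ (count Mˡ) s≤hi) (count-high (col R))))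
                (≤-trans (*-monoˡ-≤ (count Mʳ) s≤hi) (count-high (row S))) ⟩
            s * count M + highˡ + highʳ                ∎
            where
            distribute : ∀ c x y z → c * (x + (y + z)) ≡ c * x + c * y + c * z
            distribute = solve-∀

module Hierarchy where
  open LowerBound
  open import Data.Bool.Base using (Bool; true; false; T)
  open import Data.Nat.Base
  open import Data.Nat.GeneralisedArithmetic using (iterate; iterate-is-fold)
  open import Data.Nat.Logarithm using (⌈log₂_⌉; ⌈log₂⌉-mono-≤; ⌈log₂⌈n/2⌉⌉≡⌈log₂n⌉∸1)
  open import Data.Nat.Properties
  open import Data.Product.Base using (_×_; _,_; proj₂)
  open import Data.Sum.Base using (inj₁; inj₂)
  open import Data.Unit.Base using (tt)
  open import Relation.Binary.PropositionalEquality
  open import Relation.Nullary using (contradiction)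

  -- The search in the definition of _⋆ is local to it; unification with the
  -- goal of search-def recovers it under a name.
  mutual
    search : (ℕ → ℕ) → ℕ → ℕ → ℕ → ℕ
    search = _

    search-def : ∀ f k → (f (suc k) ≤ᵇ 1) ≡ false → (f ⋆) (suc k) ≡ search f (suc k) k 2
    search-def f k eq rewrite eq with suc k | 2
    ... | n | i = refl

  search≥start : ∀ f n fuel i → i ≤ search f n fuel i
  search≥start f n zero       i = ≤-refl
  search≥start f n (suc fuel) i with iterate f n i ≤ᵇ 1
  ... | true  = ≤-refl
  ... | false = <⇒≤ (search≥start f n fuel (suc i))

  search-first : ∀ f n fuel i j → i ≤ j → j < search f n fuel i → 2 ≤ iterate f n j
  search-first f n zero       i j i≤j j<i = contradiction i≤j (<⇒≱ j<i)
  search-first f n (suc fuel) i j i≤j j<  with iterate f n i ≤ᵇ 1 in eq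
  ... | true  = contradiction i≤j (<⇒≱ j<)
  ... | false with m≤n⇒m<n∨m≡n i≤j
  ...   | inj₁ i<j  = search-first f n fuel (suc i) j i<j j<
  ...   | inj₂ refl = ≰⇒> λ le → subst T eq (≤⇒≤ᵇ le)

  ⋆-lasts : ∀ f r → 2 ≤ r → 1 ≤ (f ⋆) r × Lasts f r ((f ⋆) r)
  ⋆-lasts f r 2≤r = search≥start f r r 1 , lasts
    where
    lasts : Lasts f r ((f ⋆) r)
    lasts zero    _  = 2≤r
    lasts (suc i) i< = subst (2 ≤_) (sym (iterate-is-fold r f (suc i))) (search-first f r r 1 (suc i) (s≤s z≤n) i<)

  ⌈log₂⌉-lasts : ∀ r → 2 ≤ r → 1 ≤ ⌈log₂ r ⌉ × Lasts ⌈_/2⌉ r ⌈log₂ r ⌉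
  ⌈log₂⌉-lasts r 2≤r = ⌈log₂⌉-mono-≤ 2≤r , λ i i< → subst (2 ≤_) (sym (iterate-is-fold r ⌈_/2⌉ i)) (lasts i r i<)
    where
    lasts : ∀ i r → i < ⌈log₂ r ⌉ → 2 ≤ iterate ⌈_/2⌉ r i
    lasts zero    (suc (suc r)) _  = s≤s (s≤s z≤n)
    lasts (suc i) r             i< = lasts i ⌈ r /2⌉
      (subst (i <_) (sym (⌈log₂⌈n/2⌉⌉≡⌈log₂n⌉∸1 r)) (∸-monoˡ-≤ 1 i<))

  ⌈/2⌉-contracts : Contracts ⌈_/2⌉
  ⌈/2⌉-contracts m 2≤m = ⌈n/2⌉-mono 2≤m , bound m 2≤m
    where
    bound : ∀ m → 2 ≤ m → 3 * ⌈ m /2⌉ ≤ 2 * m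
    bound 1 (s≤s ())
    bound 2 _ = n≤1+n 3
    bound 3 _ = ≤-refl
    bound (suc (suc m@(suc (suc _)))) _ = begin
      3 * suc ⌈ m /2⌉      ≡⟨ *-suc 3 ⌈ m /2⌉ ⟩
      3 + 3 * ⌈ m /2⌉      ≤⟨ +-mono-≤ (n≤1+n 3) (bound m (s≤s (s≤s z≤n))) ⟩
      4 + 2 * m            ≡⟨ sym (*-distribˡ-+ 2 2 m) ⟩
      2 * suc (suc m)      ∎
      where open ≤-Reasoning

  ⌊√⌋²≤ : ∀ m → ⌊√ m ⌋ * ⌊√ m ⌋ ≤ m
  ⌊√⌋²≤ zero = z≤n
  ⌊√⌋²≤ (suc m) with suc ⌊√ m ⌋ * suc ⌊√ m ⌋ ≤ᵇ suc m in eq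
  ... | true  = ≤ᵇ⇒≤ _ _ (subst T (sym eq) tt)
  ... | false = m≤n⇒m≤1+n (⌊√⌋²≤ m)

  1≤⌊√⌋ : ∀ m → 1 ≤ ⌊√ suc m ⌋
  1≤⌊√⌋ zero    = ≤-refl
  1≤⌊√⌋ (suc m) with suc ⌊√ suc m ⌋ * suc ⌊√ suc m ⌋ ≤ᵇ suc (suc m)
  ... | true  = s≤s z≤n
  ... | false = 1≤⌊√⌋ m

  ⌊√⌋≤ : ∀ m → ⌊√ m ⌋ ≤ m
  ⌊√⌋≤ zero    = z≤n
  ⌊√⌋≤ (suc m) = ≤-trans (m≤m*n ⌊√ suc m ⌋ ⌊√ suc m ⌋ {{>-nonZero (1≤⌊√⌋ m)}}) (⌊√⌋²≤ (suc m))

  ⌊√⌋-contracts : Contracts ⌊√_⌋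
  ⌊√⌋-contracts m@(suc m′) 2≤m = 1≤⌊√⌋ m′ , bound ⌊√ m ⌋ (⌊√⌋²≤ m)
    where
    bound : ∀ s → s * s ≤ m → 3 * s ≤ 2 * m
    bound 0 _ = z≤n
    bound 1 _ = ≤-trans (n≤1+n 3) (*-monoʳ-≤ 2 2≤m)
    bound s@(suc (suc s′)) s²≤m = begin
      3 * s       ≤⟨ *-monoˡ-≤ s (≤-trans (n≤1+n 3) (*-monoʳ-≤ 2 {2} {s} (s≤s (s≤s z≤n)))) ⟩
      2 * s * s   ≡⟨ *-assoc 2 s s ⟩
      2 * (s * s) ≤⟨ *-monoʳ-≤ 2 s²≤m ⟩
      2 * m       ∎
      where open ≤-Reasoning

  lasts⇒contracts : ∀ {f g} → Contracts f → (∀ r → 2 ≤ r → 1 ≤ g r × Lasts f r (g r)) → Contracts g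
  lasts⇒contracts {f} {g} contracts lasts r 2≤r with g r | lasts r 2≤r
  ... | suc k | 1≤g , last = 1≤g
                , ≤-trans (*-monoʳ-≤ 3 (iterate≥remaining contracts last 2≤r k 1 (+-comm k 1))) (proj₂ (contracts r 2≤r))

  Λ-contracts : ∀ d → Contracts (Λ (suc d))
  Λ-contracts zero          = ⌊√⌋-contracts
  Λ-contracts (suc zero)    = lasts⇒contracts ⌈/2⌉-contracts ⌈log₂⌉-lasts
  Λ-contracts (suc (suc d)) = lasts⇒contracts (Λ-contracts d) (⋆-lasts (Λ (suc d)))

  Λ-lowerBound : ∀ d → LowerBound (suc d) (Λ (suc d))
  Λ-lowerBound zero                = weaken ⌊√⌋≤ lowerBound-1
  Λ-lowerBound (suc zero)          = lowerBound-step 0 lowerBound-1 ⌈/2⌉-contracts (λ b _ → ⌈n/2⌉≤n b) ⌈log₂⌉-lasts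
  Λ-lowerBound (suc (suc zero))    = lowerBound-step 1 lowerBound-1 ⌊√⌋-contracts (λ b _ → ⌊√⌋²≤ b) (⋆-lasts ⌊√_⌋)
  Λ-lowerBound (suc (suc (suc d))) = lowerBound-step (2 + d) (Λ-lowerBound (suc d)) (Λ-contracts (suc d))
                                       (λ b _ → ≤-refl) (⋆-lasts (Λ (2 + d)))

module Separation where
  open Sums
  open Networks
  open import Data.Bool.Base using (Bool; true; false)
  open import Data.Fin.Base using (Fin; zero; suc; splitAt; _↑ˡ_; _↑ʳ_)
  open import Data.Fin.Properties using (_≟_; any?; splitAt-↑ˡ; splitAt-↑ʳ; splitAt⁻¹-↑ˡ)
  open import Data.Fin.Subset using (Subset; inside; outside; _∈_; ∣_∣; ⊥)
  open import Data.Fin.Subset.Properties using (_∈?_; ∣⊥∣≡0)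
  import Data.List.Base as List
  import Data.Nat.ListAction as ListAction
  open import Data.Nat.Base
  open import Data.Nat.Properties hiding (_≟_)
  open import Data.Product.Base using (_×_; _,_; ∃-syntax)
  open import Data.Sum.Base using (_⊎_; inj₁; inj₂; [_,_]′)
  open import Data.Vec.Base using (Vec; []; _∷_; lookup; here; there)
  open import Function.Base using (_∘_; id)
  open import Function.Definitions using (Injective)
  open import Induction.WellFounded using (Acc; acc)
  open import Relation.Binary.Definitions using (DecidableEquality)
  open import Relation.Binary.PropositionalEquality
  open import Relation.Nullary using (yes; no; contradiction; ¬?; _×-dec_)

  gather-cong : ∀ {A : Set} {n} (p : Subset n) {f g : ∀ {i} → i ∈ p → A} →
                (∀ {i} (i∈p : i ∈ p) → f i∈p ≡ g i∈p) → gather p f ≡ gather p g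
  gather-cong []            eq = refl
  gather-cong (outside ∷ p) eq = gather-cong p (eq ∘ there)
  gather-cong (inside  ∷ p) eq = cong₂ _∷_ (eq here) (gather-cong p (eq ∘ there))

  ∑-splitAt : ∀ m n (f : Fin (m + n) → ℕ) → sum f ≡ ∑[ i < m ] f (i ↑ˡ n) + ∑[ j < n ] f (m ↑ʳ j)
  ∑-splitAt zero    n f = refl
  ∑-splitAt (suc m) n f = trans (cong (f zero +_) (∑-splitAt m n (f ∘ suc))) (sym (+-assoc (f zero) _ _))

  ∑-tabulate : ∀ {n} (f : Fin n → ℕ) → ListAction.sum (List.tabulate f) ≡ sum f
  ∑-tabulate {zero}  f = refl
  ∑-tabulate {suc n} f = cong (f zero +_) (∑-tabulate (f ∘ suc))

  ∑-∈? : ∀ {n} (p : Subset n) → ∑[ i < n ] ⟦ i ∈? p ⟧ᵈ ≡ ∣ p ∣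
  ∑-∈? [] = refl
  ∑-∈? (s ∷ p) = trans (cong (⟦ zero ∈? (s ∷ p) ⟧ᵈ +_) (trans (sum-cong-≗ shift) (∑-∈? p))) (head s)
    where
    shift : ∀ i → ⟦ suc i ∈? (s ∷ p) ⟧ᵈ ≡ ⟦ i ∈? p ⟧ᵈ
    shift i with i ∈? p
    ... | yes _ = refl
    ... | no  _ = refl
    head : ∀ s → ⟦ zero ∈? (s ∷ p) ⟧ᵈ + ∣ p ∣ ≡ ∣ s ∷ p ∣
    head inside  = refl
    head outside = refl

  module _ {A : Set} {t n : ℕ} (C : Circuit A t n) where
    open Circuit C

    isInput : Vertex → ℕ
    isInput = [ (λ _ → 1) , (λ _ → 0) ]′ ∘ splitAt t

    -- Adjacency matrix of the circuit with a loop added at each input, so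
    -- that an input-output path can be padded to any larger length.
    W : Mat (t + #gates) (t + #gates)
    W u v = ⟦ u ≟ v ⟧ᵈ * isInput v + ⟦ u ∈? predecessors v ⟧ᵈ

    total-W : total W ≡ t + wires
    total-W = begin
      ∑[ u < m ] ∑[ v < m ] (⟦ u ≟ v ⟧ᵈ * isInput v + ⟦ u ∈? predecessors v ⟧ᵈ)
        ≡⟨ sum-cong-≗ (λ u → trans (∑-distrib-+ (λ v → ⟦ u ≟ v ⟧ᵈ * isInput v) (λ v → ⟦ u ∈? predecessors v ⟧ᵈ))
             (cong (_+ ∑[ v < m ] ⟦ u ∈? predecessors v ⟧ᵈ) (∑-δ isInput u))) ⟩
      ∑[ u < m ] (isInput u + ∑[ v < m ] ⟦ u ∈? predecessors v ⟧ᵈ)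
        ≡⟨ ∑-distrib-+ isInput (λ u → ∑[ v < m ] ⟦ u ∈? predecessors v ⟧ᵈ) ⟩
      sum isInput + ∑[ u < m ] ∑[ v < m ] ⟦ u ∈? predecessors v ⟧ᵈ
        ≡⟨ cong₂ _+_ inputs (trans (∑-comm (λ u v → ⟦ u ∈? predecessors v ⟧ᵈ)) (sum-cong-≗ (∑-∈? ∘ predecessors))) ⟩
      t + ∑[ v < m ] ∣ predecessors v ∣
        ≡⟨ cong (t +_) (trans (∑-splitAt t #gates (λ v → ∣ predecessors v ∣)) (cong₂ _+_
             (∑-zero (λ i → trans (cong (λ s → ∣ [ (λ _ → ⊥) , inNeighbours ]′ s ∣) (splitAt-↑ˡ t i #gates)) (∣⊥∣≡0 m)))
             (sum-cong-≗ (λ j → cong (λ s → ∣ [ (λ _ → ⊥) , inNeighbours ]′ s ∣) (splitAt-↑ʳ t #gates j))))) ⟩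
      t + ∑[ j < #gates ] ∣ inNeighbours j ∣
        ≡⟨ cong (t +_) (sym (∑-tabulate (λ j → ∣ inNeighbours j ∣))) ⟩
      t + wires ∎
      where
      open ≡-Reasoning
      m : ℕ
      m = t + #gates
      inputs : sum isInput ≡ t
      inputs = begin
        sum isInput ≡⟨ ∑-splitAt t #gates isInput ⟩
        ∑[ i < t ] isInput (i ↑ˡ #gates) + ∑[ j < #gates ] isInput (t ↑ʳ j)
          ≡⟨ cong₂ _+_ (sum-cong-≗ (λ i → cong [ (λ _ → 1) , (λ _ → 0) ]′ (splitAt-↑ˡ t i #gates)))
                       (∑-zero (λ j → cong [ (λ _ → 1) , (λ _ → 0) ]′ (splitAt-↑ʳ t #gates j))) ⟩
        ∑[ i < t ] 1 + 0  ≡⟨ +-identityʳ _ ⟩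
        ∑[ i < t ] 1      ≡⟨ ∑-const t 1 ⟩
        t * 1             ≡⟨ *-identityʳ t ⟩
        t                 ∎

    net : ∀ d {a b} → (Fin a → Vertex) → (Fin b → Vertex) → Net (t + #gates) (suc d) a b
    net 0             φ ψ = one (λ x y → W (φ x) (ψ y))
    net 1             φ ψ = wrap (W ∘ φ) idle (λ w y → W w (ψ y))
    net (suc (suc d)) φ ψ = wrap (W ∘ φ) (net d id id) (λ w y → W w (ψ y))

    module _ {a b} {φ : Fin a → Vertex} {ψ : Fin b → Vertex} (φ-inj : Injective _≡_ _≡_ φ) (ψ-inj : Injective _≡_ _≡_ ψ) where

      total-rows : total (W ∘ φ) ≤ total W
      total-rows = ∑-injective-≤ (row W) φ-inj

      total-cols : total (λ w y → W w (ψ y)) ≤ total W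
      total-cols = ∑-mono-≤ (λ w → ∑-injective-≤ (W w) ψ-inj)

      total-restrict : total (λ x y → W (φ x) (ψ y)) ≤ total W
      total-restrict = ≤-trans (∑-mono-≤ (λ x → ∑-injective-≤ (W (φ x)) ψ-inj)) total-rows

    size-net : ∀ d {a b} {φ : Fin a → Vertex} {ψ : Fin b → Vertex} → Injective _≡_ _≡_ φ → Injective _≡_ _≡_ ψ →
               size (net d φ ψ) ≤ suc d * total W
    size-net 0             φ-inj ψ-inj = ≤-trans (total-restrict φ-inj ψ-inj) (m≤m+n _ 0)
    size-net 1             φ-inj ψ-inj = +-mono-≤ (≤-trans (≤-reflexive (+-identityʳ _)) (total-rows φ-inj ψ-inj))
                                                  (≤-trans (total-cols φ-inj ψ-inj) (m≤m+n _ 0))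
    size-net (suc (suc d)) φ-inj ψ-inj = ≤-trans
      (+-mono-≤ (+-mono-≤ (total-rows φ-inj ψ-inj) (size-net d id id)) (total-cols φ-inj ψ-inj))
      (≤-reflexive (trans (+-comm (total W + suc d * total W) (total W)) refl))

    1≤· : ∀ {a b} (A : Mat a b) X x y → 1 ≤ A x y → 1 ≤ X y → 1 ≤ (A · X) x
    1≤· A X x y 1≤A 1≤X = ≤-trans (*-mono-≤ 1≤A 1≤X) (term≤∑ (λ y → A x y * X y) y)

    1≤↿ : ∀ {m} (M : Fin m → Bool) X v → M v ≡ false → 1 ≤ X v → 1 ≤ (M ↿ X) v
    1≤↿ M X v eq 1≤X = subst (λ k → 1 ≤ keep k * X v) (sym eq) (≤-trans 1≤X (m≤m+n _ 0))

    walk⇒act : ∀ d {a b} (φ : Fin a → Vertex) (ψ : Fin b → Vertex) M X x y (q : ℕ → Vertex) →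
               q 0 ≡ ψ y → q (suc d) ≡ φ x → (∀ j → 1 ≤ W (q (suc j)) (q j)) → (∀ j → M (q j) ≡ false) →
               1 ≤ X y → 1 ≤ act (net d φ ψ) M X x
    walk⇒act 0 φ ψ M X x y q start end step avoid 1≤X =
      1≤· (λ x y → W (φ x) (ψ y)) X x y (subst₂ (λ u v → 1 ≤ W u v) end start (step 0)) 1≤X
    walk⇒act 1 φ ψ M X x y q start end step avoid 1≤X =
      1≤· (W ∘ φ) (M ↿ M ↿ last · X) x (q 1) (subst (λ u → 1 ≤ W u (q 1)) end (step 1))
        (1≤↿ M (M ↿ last · X) (q 1) (avoid 1) (1≤↿ M (last · X) (q 1) (avoid 1)
          (1≤· last X (q 1) y (subst (λ v → 1 ≤ W (q 1) v) start (step 0)) 1≤X)))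
      where
      last : Mat _ _
      last w y = W w (ψ y)
    walk⇒act (suc (suc d)) φ ψ M X x y q start end step avoid 1≤X =
      1≤· (W ∘ φ) (M ↿ inner) x (q (2 + d)) (subst (λ u → 1 ≤ W u (q (2 + d))) end (step (2 + d)))
        (1≤↿ M inner (q (2 + d)) (avoid (2 + d))
          (walk⇒act d id id M (M ↿ last · X) (q (2 + d)) (q 1) (q ∘ suc) refl refl (step ∘ suc) (avoid ∘ suc)
            (1≤↿ M (last · X) (q 1) (avoid 1)
              (1≤· last X (q 1) y (subst (λ v → 1 ≤ W (q 1) v) start (step 0)) 1≤X))))
      where
      last : Mat _ _
      last w y = W w (ψ y)
      inner : Vertex → ℕ
      inner = act (net d id id) M (M ↿ last · X)

    valueAcc-irrelevant : ∀ x v (a a′ : Acc _⟶_ v) → valueAcc x v a ≡ valueAcc x v a′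
    valueAcc-irrelevant x v (acc rs) (acc rs′) with splitAt t v
    ... | inj₁ i = refl
    ... | inj₂ j = cong (gate j) (gather-cong (inNeighbours j) (λ {u} u∈ → valueAcc-irrelevant x u (rs u∈) (rs′ u∈)))

    value-cong : ∀ x x′ v → (∀ i → v ≡ input i → lookup x i ≡ lookup x′ i) →
                 (∀ u → u ⟶ v → value x u ≡ value x′ u) → value x v ≡ value x′ v
    value-cong x x′ v inputs≡ preds≡ = go (⟶-wellFounded v)
      where
      go : (a : Acc _⟶_ v) → valueAcc x v a ≡ valueAcc x′ v a
      go (acc rs) with splitAt t v in eq
      ... | inj₁ i = inputs≡ i (sym (splitAt⁻¹-↑ˡ eq))
      ... | inj₂ j = cong (gate j) (gather-cong (inNeighbours j) (λ {u} u∈ →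
              trans (valueAcc-irrelevant x u (rs u∈) (⟶-wellFounded u))
                (trans (preds≡ u u∈) (valueAcc-irrelevant x′ u (⟶-wellFounded u) (rs u∈)))))

    value-input : ∀ x i → value x (input i) ≡ lookup x i
    value-input x i = go (⟶-wellFounded (input i))
      where
      go : (a : Acc _⟶_ (input i)) → valueAcc x (input i) a ≡ lookup x i
      go (acc rs) rewrite splitAt-↑ˡ t i #gates = refl

    _∷ʳ_ : ∀ {ℓ u v w} → Path ℓ u v → v ⟶ w → Path (suc ℓ) u w
    []      ∷ʳ e = e ∷ []
    (f ∷ p) ∷ʳ e = f ∷ (p ∷ʳ e)

    isInput-input : ∀ i → isInput (input i) ≡ 1
    isInput-input i = cong [ (λ _ → 1) , (λ _ → 0) ]′ (splitAt-↑ˡ t i #gates)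

    W-edge : ∀ {u v} → u ⟶ v → 1 ≤ W u v
    W-edge {u} {v} e = ≤-trans (≤-reflexive (sym (⟦⟧ᵈ-true (u ∈? predecessors v) e))) (m≤n+m _ (⟦ u ≟ v ⟧ᵈ * isInput v))

    W-loop : ∀ i → 1 ≤ W (input i) (input i)
    W-loop i = ≤-trans (≤-reflexive (sym (cong₂ _*_ (⟦⟧ᵈ-true (input i ≟ input i) refl) (isInput-input i)))) (m≤m+n _ _)

    -- An infinite walk backwards from v through vertices satisfying G, which
    -- reaches an input i after ℓ steps and then stays there.
    record BackWalk (G : Vertex → Set) (v : Vertex) : Set where
      field
        ℓ      : ℕ
        i      : Fin t
        q      : ℕ → Vertex
        start  : q 0 ≡ v
        step   : ∀ j → 1 ≤ W (q (suc j)) (q j)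
        good   : ∀ j → G (q j)
        settle : ∀ j → ℓ ≤ j → q j ≡ input i
        path   : Path ℓ (input i) v

    module _ (_≟ᴬ_ : DecidableEquality A) (x x′ : Vec A t) where

      Differs : Vertex → Set
      Differs v = value x v ≢ value x′ v

      differs-input : ∀ i → Differs (input i) → lookup x i ≢ lookup x′ i
      differs-input i diff eq = diff (trans (value-input x i) (trans eq (sym (value-input x′ i))))

      differs-predecessor : ∀ v → Differs v → (∃[ i ] v ≡ input i) ⊎ (∃[ u ] (u ⟶ v × Differs u))
      differs-predecessor v diff with any? (λ i → v ≟ input i)
      ... | yes isIn = inj₁ isIn
      ... | no notIn with any? (λ u → (u ∈? predecessors v) ×-dec ¬? (value x u ≟ᴬ value x′ u))
      ...   | yes pred = inj₂ pred
      ...   | no none  = contradiction (value-cong x x′ v (λ i eq → contradiction (i , eq) notIn) preds≡) diff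
        where
        preds≡ : ∀ u → u ⟶ v → value x u ≡ value x′ u
        preds≡ u u⟶v with value x u ≟ᴬ value x′ u
        ... | yes eq = eq
        ... | no neq = contradiction (u , u⟶v , neq) none

      backWalk : ∀ v → Acc _⟶_ v → Differs v → BackWalk Differs v
      backWalk v (acc rs) diff with differs-predecessor v diff
      ... | inj₁ (i , refl) = record
        { ℓ = 0 ; i = i ; q = λ _ → input i ; start = refl ; step = λ _ → W-loop i
        ; good = λ _ → diff ; settle = λ _ _ → refl ; path = [] }
      ... | inj₂ (u , u⟶v , diff-u) = record
        { ℓ = suc ℓ ; i = i
        ; q = λ { zero → v ; (suc j) → q j }
        ; start = refl
        ; step = λ { zero → W-edge (subst (_⟶ v) (sym start) u⟶v) ; (suc j) → step j }
        ; good = λ { zero → diff ; (suc j) → good j }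
        ; settle = λ { (suc j) (s≤s le) → settle j le }
        ; path = path ∷ʳ u⟶v }
        where open BackWalk (backWalk u (rs u⟶v) diff-u)

      separation : ∀ d → HasDepth (suc d) → ∀ {M X} y →
        (∀ v → M v ≡ true → value x v ≡ value x′ v) → value x (output y) ≢ value x′ (output y) → 1 ≤ X y →
        ∃[ i ] (lookup x i ≢ lookup x′ i × 1 ≤ act (net d input output) M X i)
      separation d (_ , depth≤) {M} {X} y agree diff 1≤X = i
        , differs-input i (subst Differs at-d (good (suc d)))
        , walk⇒act d input output M X i y q start at-d step avoid 1≤X
        where
        open BackWalk (backWalk (output y) (⟶-wellFounded (output y)) diff)
        at-d : q (suc d) ≡ input i
        at-d = settle (suc d) (depth≤ ℓ (i , y , path))
        avoid : ∀ j → M (q j) ≡ false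
        avoid j with M (q j) in eq
        ... | true  = contradiction (agree (q j) eq) (good j)
        ... | false = refl

module Convexity where
  open Sums
  import Algebra.Properties.CommutativeMonoid.Sum as CMSum
  open import Data.Fin.Base using (Fin; zero; suc)
  open import Data.Fin.Properties using (_≟_; any?; nonZeroIndex)
  open import Data.Nat.Base
  open import Data.Nat.Divisibility using (_∣_; quotient; ∣n⇒∣m*n; m∣m*n)
  open import Data.Nat.Properties hiding (_≟_)
  open import Data.Nat.Tactic.RingSolver using (solve-∀)
  open import Data.Product.Base using (_×_; _,_; ∃-syntax)
  open import Data.Sum.Base using (inj₁; inj₂)
  open import Function.Base using (_∘_)
  open import Relation.Binary.Definitions using (DecidableEquality; tri<; tri≈; tri>)
  open import Relation.Binary.PropositionalEquality
  open import Relation.Nullary using (yes; no; contradiction; _×-dec_)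

  open CMSum *-1-commutativeMonoid public
    using () renaming (sum to ∏; sum-cong-≗ to ∏-cong; ∑-distrib-+ to ∏-distrib-*)

  ^-distribʳ-* : ∀ m n o → (m * n) ^ o ≡ m ^ o * n ^ o
  ^-distribʳ-* m n zero    = refl
  ^-distribʳ-* m n (suc o) = trans (cong (m * n *_) (^-distribʳ-* m n o)) (interchange m n (m ^ o) (n ^ o))
    where
    interchange : ∀ a b c d → a * b * (c * d) ≡ a * c * (b * d)
    interchange = solve-∀

  ^-injectiveˡ : ∀ {m n} o → 1 ≤ o → m ^ o ≡ n ^ o → m ≡ n
  ^-injectiveˡ {m} {n} o 1≤o eq with <-cmp m n
  ... | tri≈ _ m≡n _ = m≡n
  ... | tri< m<n _ _ = contradiction eq (<⇒≢ (^-monoˡ-< o {{>-nonZero 1≤o}} m<n))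
  ... | tri> _ _ n<m = contradiction (sym eq) (<⇒≢ (^-monoˡ-< o {{>-nonZero 1≤o}} n<m))

  ∏-const : ∀ n c → ∏ {n} (λ _ → c) ≡ c ^ n
  ∏-const zero    c = refl
  ∏-const (suc n) c = cong (c *_) (∏-const n c)

  ∏≥1 : ∀ {n} (f : Fin n → ℕ) → (∀ i → 1 ≤ f i) → 1 ≤ ∏ f
  ∏≥1 {zero}  f pos = ≤-refl
  ∏≥1 {suc n} f pos = *-mono-≤ (pos zero) (∏≥1 (f ∘ suc) (pos ∘ suc))

  factor∣∏ : ∀ {n} (f : Fin n → ℕ) i → f i ∣ ∏ f
  factor∣∏ f zero    = m∣m*n _
  factor∣∏ f (suc i) = ∣n⇒∣m*n (f zero) (factor∣∏ (f ∘ suc) i)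

  ∏-mono-≤ : ∀ {n} {f g : Fin n → ℕ} → (∀ i → f i ≤ g i) → ∏ f ≤ ∏ g
  ∏-mono-≤ {zero}  le = ≤-refl
  ∏-mono-≤ {suc n} le = *-mono-≤ (le zero) (∏-mono-≤ (le ∘ suc))

  ∏-≡⇒≗ : ∀ {n} (f g : Fin n → ℕ) → (∀ i → 1 ≤ f i) → (∀ i → f i ≤ g i) → ∏ f ≡ ∏ g → ∀ i → f i ≡ g i
  ∏-≡⇒≗ {suc n} f g pos le eq = λ { zero → head≡ ; (suc i) → ∏-≡⇒≗ (f ∘ suc) (g ∘ suc) (pos ∘ suc) (le ∘ suc) tail≡ i }
    where
    instance
      ∏f≢0 : NonZero (∏ (f ∘ suc))
      ∏f≢0 = >-nonZero (∏≥1 (f ∘ suc) (pos ∘ suc))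
      f0≢0 : NonZero (f zero)
      f0≢0 = >-nonZero (pos zero)
    head≡ : f zero ≡ g zero
    head≡ with m≤n⇒m<n∨m≡n (le zero)
    ... | inj₂ f≡g = f≡g
    ... | inj₁ f<g = contradiction eq (<⇒≢ (<-≤-trans (*-monoˡ-< (∏ (f ∘ suc)) f<g)
                                                      (*-monoʳ-≤ (g zero) (∏-mono-≤ (le ∘ suc)))))
    tail≡ : ∏ (f ∘ suc) ≡ ∏ (g ∘ suc)
    tail≡ = *-cancelˡ-≡ _ _ (f zero) (trans eq (cong (_* ∏ (g ∘ suc)) (sym head≡)))

  ∑-≡⇒≗ : ∀ {n} (f g : Fin n → ℕ) → (∀ i → f i ≤ g i) → sum f ≡ sum g → ∀ i → f i ≡ g i
  ∑-≡⇒≗ {suc n} f g le eq = λ { zero → head≡ ; (suc i) → ∑-≡⇒≗ (f ∘ suc) (g ∘ suc) (le ∘ suc)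
                                  (+-cancelˡ-≡ (f zero) _ _ (trans eq (cong (_+ sum (g ∘ suc)) (sym head≡)))) i }
    where
    head≡ : f zero ≡ g zero
    head≡ with m≤n⇒m<n∨m≡n (le zero)
    ... | inj₂ f≡g = f≡g
    ... | inj₁ f<g = contradiction eq (<⇒≢ (+-mono-<-≤ f<g (∑-mono-≤ (le ∘ suc))))

  2yz≤y²+z² : ∀ y z → 2 * (y * z) ≤ y * y + z * z
  2yz≤y²+z² y z with ≤-total y z
  ... | inj₁ y≤z with m≤n⇒∃[o]m+o≡n y≤z
  ...   | k , refl = ≤-trans (m≤m+n _ (k * k)) (≤-reflexive (square y k))
    where
    square : ∀ y k → 2 * (y * (y + k)) + k * k ≡ y * y + (y + k) * (y + k)
    square = solve-∀
  2yz≤y²+z² y z | inj₂ z≤y with m≤n⇒∃[o]m+o≡n z≤y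
  ...   | k , refl = ≤-trans (m≤m+n _ (k * k)) (≤-reflexive (square z k))
    where
    square : ∀ z k → 2 * ((z + k) * z) + k * k ≡ (z + k) * (z + k) + z * z
    square = solve-∀

  bernoulli : ∀ n y z → suc n * (y * z ^ n) ≤ y ^ suc n + n * z ^ suc n
  bernoulli zero    y z = ≤-reflexive (base y)
    where
    base : ∀ y → 1 * (y * 1) ≡ y * 1 + 0 * (1 * 1)
    base = solve-∀
  bernoulli (suc n) y z = +-cancelʳ-≤ (n * (y * (z * Z))) _ _ (begin
    (2 + n) * (y * (z * Z)) + n * (y * (z * Z))        ≡⟨ regroup n y z Z ⟩
    suc n * (2 * (y * z) * Z)                          ≤⟨ *-monoʳ-≤ (suc n) (*-monoˡ-≤ Z (2yz≤y²+z² y z)) ⟩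
    suc n * ((y * y + z * z) * Z)                      ≡⟨ regroup′ n y z Z ⟩
    y * (suc n * (y * Z)) + suc n * (z * (z * Z))      ≤⟨ +-monoˡ-≤ _ (*-monoʳ-≤ y (bernoulli n y z)) ⟩
    y * (y ^ suc n + n * (z * Z)) + suc n * (z * (z * Z)) ≡⟨ regroup″ n y z Z (y ^ suc n) ⟩
    y * y ^ suc n + suc n * (z * (z * Z)) + n * (y * (z * Z)) ∎)
    where
    open ≤-Reasoning
    Z : ℕ
    Z = z ^ n
    regroup : ∀ n y z Z → (2 + n) * (y * (z * Z)) + n * (y * (z * Z)) ≡ (1 + n) * (2 * (y * z) * Z)
    regroup = solve-∀
    regroup′ : ∀ n y z Z → (1 + n) * ((y * y + z * z) * Z) ≡ y * ((1 + n) * (y * Z)) + (1 + n) * (z * (z * Z))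
    regroup′ = solve-∀
    regroup″ : ∀ n y z Z Y → y * (Y + n * (z * Z)) + (1 + n) * (z * (z * Z)) ≡ y * Y + (1 + n) * (z * (z * Z)) + n * (y * (z * Z))
    regroup″ = solve-∀

  am-gm : ∀ {n} (f : Fin n → ℕ) → n ^ n * ∏ f ≤ sum f ^ n
  am-gm {zero}        f = ≤-refl
  am-gm {suc zero}    f = ≤-reflexive (single (f zero))
    where
    single : ∀ x → 1 * 1 * (x * 1) ≡ (x + 0) * 1
    single = solve-∀
  am-gm {suc n@(suc _)} f = *-cancelˡ-≤ (n ^ suc n) {{m^n≢0 n (suc n)}} (+-cancelʳ-≤ (n * u ^ suc n) _ _ (begin
    n ^ suc n * (suc n ^ suc n * (x * p)) + n * u ^ suc n
      ≡⟨ cong (_+ n * u ^ suc n) (regroup n x p (n ^ n) (suc n ^ n)) ⟩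
    n * suc n * x * (suc n ^ n * (n ^ n * p)) + n * u ^ suc n
      ≤⟨ +-monoˡ-≤ (n * u ^ suc n) (*-monoʳ-≤ (n * suc n * x) (*-monoʳ-≤ (suc n ^ n) (am-gm (f ∘ suc)))) ⟩
    n * suc n * x * (suc n ^ n * s ^ n) + n * u ^ suc n
      ≡⟨ cong (λ z → n * suc n * x * z + n * u ^ suc n) (sym (^-distribʳ-* (suc n) s n)) ⟩
    n * suc n * x * u ^ n + n * (u * u ^ n)
      ≡⟨ regroup′ n s x (u ^ n) ⟩
    suc n * (v * u ^ n)
      ≤⟨ bernoulli n v u ⟩
    v ^ suc n + n * u ^ suc n
      ≡⟨ cong (_+ n * u ^ suc n) (^-distribʳ-* n (x + s) (suc n)) ⟩
    n ^ suc n * (x + s) ^ suc n + n * u ^ suc n ∎))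
    where
    open ≤-Reasoning
    x s p u v : ℕ
    x = f zero
    s = sum (f ∘ suc)
    p = ∏ (f ∘ suc)
    u = suc n * s
    v = n * (x + s)
    regroup : ∀ n x p N M → n * N * ((1 + n) * M * (x * p)) ≡ n * (1 + n) * x * (M * (N * p))
    regroup = solve-∀
    regroup′ : ∀ n s x U → n * (1 + n) * x * U + n * ((1 + n) * s * U) ≡ (1 + n) * (n * (x + s) * U)
    regroup′ = solve-∀

  module _ {n q : ℕ} {B : Set} (_≟ᴮ_ : DecidableEquality B) (y : Fin n → B) (s : Fin n → Fin q) where

    fibre : Fin n → ℕ
    fibre i = ∑[ j < n ] ⟦ y j ≟ᴮ y i ⟧ᵈ

    cell : B → Fin q → ℕ
    cell b σ = ∑[ j < n ] (⟦ y j ≟ᴮ b ⟧ᵈ * ⟦ s j ≟ σ ⟧ᵈ)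

    jointFibre : Fin n → ℕ
    jointFibre i = cell (y i) (s i)

    cell≥1 : ∀ i → 1 ≤ jointFibre i
    cell≥1 i = ≤-trans (≤-reflexive (sym (cong₂ _*_ (⟦⟧ᵈ-true (y i ≟ᴮ y i) refl) (⟦⟧ᵈ-true (s i ≟ s i) refl))))
                 (term≤∑ (λ j → ⟦ y j ≟ᴮ y i ⟧ᵈ * ⟦ s j ≟ s i ⟧ᵈ) i)

    joint≤fibre : ∀ i → jointFibre i ≤ fibre i
    joint≤fibre i = ∑-mono-≤ (λ j → ≤-trans (*-monoʳ-≤ ⟦ y j ≟ᴮ y i ⟧ᵈ (⟦⟧ᵈ≤1 (s j ≟ s i))) (≤-reflexive (*-identityʳ _)))

    determined : ∏ fibre ≡ ∏ jointFibre → ∀ i j → y j ≡ y i → s j ≡ s i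
    determined eq i j yj≡yi with s j ≟ s i | ∑-≡⇒≗ _ _ (λ j → ≤-trans (*-monoʳ-≤ ⟦ y j ≟ᴮ y i ⟧ᵈ (⟦⟧ᵈ≤1 (s j ≟ s i))) (≤-reflexive (*-identityʳ _)))
                                    (∏-≡⇒≗ jointFibre fibre cell≥1 joint≤fibre (sym eq) i) j
    ... | yes sj≡si | _   = sj≡si
    ... | no  _     | eq′ = contradiction (trans (sym (⟦⟧ᵈ-true (y j ≟ᴮ y i) yj≡yi)) (trans (sym eq′) (*-zeroʳ ⟦ y j ≟ᴮ y i ⟧ᵈ))) λ ()

    -- AM-GM applied to the numbers fibre i / jointFibre i (with a common
    -- denominator): their sum over one fibre of y is its size times the
    -- number of values that s takes there.
    independent : ∏ fibre ≡ q ^ n * ∏ jointFibre → ∀ i σ → ∃[ j ] (y j ≡ y i × s j ≡ σ)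
    independent eq i σ with any? (λ j → (y j ≟ᴮ y i) ×-dec (s j ≟ σ))
    ... | yes found = found
    ... | no missing = contradiction geometric≤arithmetic (<⇒≱ arithmetic<geometric)
      where
      L : ℕ
      L = ∏ jointFibre
      1≤L : 1 ≤ L
      1≤L = ∏≥1 jointFibre cell≥1
      c : Fin n → ℕ
      c j = quotient (factor∣∏ jointFibre j)
      cL : ∀ j → c j * jointFibre j ≡ L
      cL j = sym (_∣_.equality (factor∣∏ jointFibre j))
      z : Fin n → ℕ
      z j = fibre j * c j
      ∏z : ∏ z ≡ (q * L) ^ n
      ∏z = begin
        ∏ z                                ≡⟨ ∏-distrib-* fibre c ⟩
        ∏ fibre * ∏ c                      ≡⟨ cong (_* ∏ c) eq ⟩
        q ^ n * L * ∏ c                    ≡⟨ trans (*-assoc (q ^ n) L (∏ c)) (cong (q ^ n *_) (*-comm L (∏ c))) ⟩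
        q ^ n * (∏ c * L)                  ≡⟨ cong (q ^ n *_) (sym (∏-distrib-* c jointFibre)) ⟩
        q ^ n * ∏ (λ j → c j * jointFibre j) ≡⟨ cong (q ^ n *_) (trans (∏-cong cL) (∏-const n L)) ⟩
        q ^ n * L ^ n                      ≡⟨ sym (^-distribʳ-* q L n) ⟩
        (q * L) ^ n                        ∎
        where open ≡-Reasoning
      share : B → Fin q → ℕ
      share b τ = ∑[ j < n ] (⟦ y j ≟ᴮ b ⟧ᵈ * ⟦ s j ≟ τ ⟧ᵈ * c j)
      cell*share≤ : ∀ b τ → cell b τ * share b τ ≤ cell b τ * L
      cell*share≤ b τ = begin
        cell b τ * share b τ
          ≤⟨ ∑*-mono (cell b τ) (λ j → term j) ⟩
        ∑[ j < n ] (⟦ y j ≟ᴮ b ⟧ᵈ * ⟦ s j ≟ τ ⟧ᵈ * L)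
          ≡⟨ sym (*-distribʳ-sum L (λ j → ⟦ y j ≟ᴮ b ⟧ᵈ * ⟦ s j ≟ τ ⟧ᵈ)) ⟩
        cell b τ * L ∎
        where
        open ≤-Reasoning
        term : ∀ j → cell b τ * (⟦ y j ≟ᴮ b ⟧ᵈ * ⟦ s j ≟ τ ⟧ᵈ * c j) ≤ ⟦ y j ≟ᴮ b ⟧ᵈ * ⟦ s j ≟ τ ⟧ᵈ * L
        term j with y j ≟ᴮ b | s j ≟ τ
        ... | yes refl | yes refl = ≤-reflexive (trans (cong (jointFibre j *_) (*-identityˡ (c j)))
                                     (trans (*-comm (jointFibre j) (c j)) (trans (cL j) (sym (*-identityˡ L)))))
        ... | yes _    | no _     = ≤-reflexive (*-zeroʳ (cell b τ))
        ... | no _     | _        = ≤-reflexive (*-zeroʳ (cell b τ))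
      share≤L : ∀ b τ → share b τ ≤ L
      share≤L b τ with cell b τ in cell≡ | cell*share≤ b τ
      ... | suc k | le = *-cancelˡ-≤ (suc k) le
      ... | zero  | _  = ≤-trans (≤-reflexive (∑-zero (λ j → cong (_* c j)
                           (n≤0⇒n≡0 (≤-trans (term≤∑ (λ j → ⟦ y j ≟ᴮ b ⟧ᵈ * ⟦ s j ≟ τ ⟧ᵈ) j) (≤-reflexive cell≡)))))) z≤n
      no-share : share (y i) σ ≡ 0
      no-share = ∑-zero term
        where
        term : ∀ j → ⟦ y j ≟ᴮ y i ⟧ᵈ * ⟦ s j ≟ σ ⟧ᵈ * c j ≡ 0
        term j with y j ≟ᴮ y i | s j ≟ σ
        ... | yes y≡ | yes s≡ = contradiction (j , y≡ , s≡) missing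
        ... | yes _  | no _   = refl
        ... | no _   | _      = refl
      column : Fin n → ℕ
      column j = ∑[ τ < q ] share (y j) τ
      ∑z : sum z ≡ sum column
      ∑z = begin
        ∑[ i < n ] (∑[ j < n ] ⟦ y j ≟ᴮ y i ⟧ᵈ * c i)
          ≡⟨ sum-cong-≗ (λ i → *-distribʳ-sum (c i) (λ j → ⟦ y j ≟ᴮ y i ⟧ᵈ)) ⟩
        ∑[ i < n ] ∑[ j < n ] (⟦ y j ≟ᴮ y i ⟧ᵈ * c i)
          ≡⟨ ∑-comm (λ i j → ⟦ y j ≟ᴮ y i ⟧ᵈ * c i) ⟩
        ∑[ j < n ] ∑[ i < n ] (⟦ y j ≟ᴮ y i ⟧ᵈ * c i)
          ≡⟨ sum-cong-≗ (λ j → trans (sum-cong-≗ (split j)) (∑-comm (λ i τ → ⟦ y i ≟ᴮ y j ⟧ᵈ * ⟦ s i ≟ τ ⟧ᵈ * c i))) ⟩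
        ∑[ j < n ] ∑[ τ < q ] ∑[ i < n ] (⟦ y i ≟ᴮ y j ⟧ᵈ * ⟦ s i ≟ τ ⟧ᵈ * c i) ∎
        where
        open ≡-Reasoning
        ⟦⟧ᵈ-sym : ∀ a b → ⟦ a ≟ᴮ b ⟧ᵈ ≡ ⟦ b ≟ᴮ a ⟧ᵈ
        ⟦⟧ᵈ-sym a b with a ≟ᴮ b
        ... | yes eq = sym (⟦⟧ᵈ-true (b ≟ᴮ a) (sym eq))
        ... | no neq = sym (⟦⟧ᵈ-false (b ≟ᴮ a) (neq ∘ sym))
        split : ∀ j i → ⟦ y j ≟ᴮ y i ⟧ᵈ * c i ≡ ∑[ τ < q ] (⟦ y i ≟ᴮ y j ⟧ᵈ * ⟦ s i ≟ τ ⟧ᵈ * c i)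
        split j i = begin
          ⟦ y j ≟ᴮ y i ⟧ᵈ * c i   ≡⟨ cong (_* c i) (⟦⟧ᵈ-sym (y j) (y i)) ⟩
          ⟦ y i ≟ᴮ y j ⟧ᵈ * c i   ≡⟨ sym (∑-δ (λ _ → ⟦ y i ≟ᴮ y j ⟧ᵈ * c i) (s i)) ⟩
          ∑[ τ < q ] (⟦ s i ≟ τ ⟧ᵈ * (⟦ y i ≟ᴮ y j ⟧ᵈ * c i))
            ≡⟨ sum-cong-≗ (λ τ → rotate ⟦ s i ≟ τ ⟧ᵈ ⟦ y i ≟ᴮ y j ⟧ᵈ (c i)) ⟩
          ∑[ τ < q ] (⟦ y i ≟ᴮ y j ⟧ᵈ * ⟦ s i ≟ τ ⟧ᵈ * c i) ∎
          where
          rotate : ∀ a b c → a * (b * c) ≡ b * a * c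
          rotate = solve-∀
      column≤ : ∀ j → column j ≤ q * L
      column≤ j = ≤-trans (∑-mono-≤ (share≤L (y j))) (≤-reflexive (∑-const q L))
      -- The cell (y i , σ) is empty.
      column< : column i < q * L
      column< = ≤∧≢⇒< (column≤ i) λ full → contradiction
        (trans (sym no-share) (∑-≡⇒≗ (share (y i)) (λ _ → L) (share≤L (y i)) (trans full (sym (∑-const q L))) σ))
        (<⇒≢ 1≤L)
      ∑column< : sum column < n * (q * L)
      ∑column< = ≤∧≢⇒< (≤-trans (∑-mono-≤ column≤) (≤-reflexive (∑-const n (q * L)))) λ full →
        <⇒≢ column< (∑-≡⇒≗ column (λ _ → q * L) column≤ (trans full (sym (∑-const n (q * L)))) i)
      geometric≤arithmetic : n ^ n * (q * L) ^ n ≤ sum column ^ n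
      geometric≤arithmetic = subst₂ (λ u v → n ^ n * u ≤ v ^ n) ∏z ∑z (am-gm z)
      arithmetic<geometric : sum column ^ n < n ^ n * (q * L) ^ n
      arithmetic<geometric = <-≤-trans (^-monoˡ-< n {{nonZeroIndex i}} ∑column<) (≤-reflexive (^-distribʳ-* n (q * L) n))

module Sharing where
  open Sums
  open Convexity
  open Separation using (gather-cong; ∑-tabulate)
  open import Data.Fin.Base using (Fin; zero; suc; toℕ; fromℕ<; punchOut)
  open import Data.Fin.Properties using (any?; injective⇒≤; punchOut-injective; toℕ-fromℕ<; toℕ-injective; toℕ<n; nonZeroIndex)
    renaming (_≟_ to _≟ᶠ_)
  open import Data.Fin.Subset using (Subset; inside; outside; _∈_; ∣_∣; _-_)
  open import Data.Fin.Subset.Properties using (_∈?_; x∈p∧x≢y⇒x∈p-y; p─⊥≡p)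
  open import Data.List.Base as List using (List; []; _∷_; length; filter; map; cartesianProductWith)
  import Data.List.Membership.Propositional as Membership
  open import Data.List.Membership.Propositional.Properties using (∈-cartesianProductWith⁺; ∈-tabulate⁺)
  open import Data.List.Properties using (map-++; map-∘; length-tabulate; map-tabulate)
  import Data.List.Relation.Unary.Any as Any
  open import Data.List.Relation.Unary.Any.Properties using (lookup-index)
  open import Data.Nat.Base hiding (∣_-_∣)
  open import Data.Nat.ListAction using (product) renaming (sum to sumᴸ)
  open import Data.Nat.ListAction.Properties using (sum-++)
  open import Data.Nat.Properties hiding (_≟_)
  open import Data.Nat.Tactic.RingSolver using (solve-∀)
  open import Data.Product.Base using (_×_; _,_; ∃-syntax; proj₁; proj₂)
  open import Data.Product.Properties using () renaming (≡-dec to ×-≡-dec)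
  open import Data.Vec.Base using (Vec; []; _∷_; lookup; here; there; replicate)
  open import Data.Vec.Properties using () renaming (≡-dec to Vec-≡-dec; ∷-injective to Vec-∷-injective)
  open import Function.Base using (_∘_)
  open import Function.Bundles using (Inverse)
  open import Function.Definitions using (Injective)
  open import Relation.Binary.Definitions using (DecidableEquality)
  open import Relation.Binary.PropositionalEquality
  open import Relation.Nullary using (Dec; yes; no; contradiction)

  ∑ᴸ : ∀ {A : Set} → (A → ℕ) → List A → ℕ
  ∑ᴸ f xs = sumᴸ (map f xs)

  module _ {A : Set} where

    ∑ᴸ-lookup : ∀ (f : A → ℕ) xs → ∑ᴸ f xs ≡ sum (f ∘ List.lookup xs)
    ∑ᴸ-lookup f []       = refl
    ∑ᴸ-lookup f (x ∷ xs) = cong (f x +_) (∑ᴸ-lookup f xs)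

    ∏ᴸ-lookup : ∀ (f : A → ℕ) xs → product (map f xs) ≡ ∏ (f ∘ List.lookup xs)
    ∏ᴸ-lookup f []       = refl
    ∏ᴸ-lookup f (x ∷ xs) = cong (f x *_) (∏ᴸ-lookup f xs)

    ∑ᴸ-cong : ∀ {f g : A → ℕ} xs → (∀ x → f x ≡ g x) → ∑ᴸ f xs ≡ ∑ᴸ g xs
    ∑ᴸ-cong []       eq = refl
    ∑ᴸ-cong (x ∷ xs) eq = cong₂ _+_ (eq x) (∑ᴸ-cong xs eq)

    ∑ᴸ-const : ∀ c (xs : List A) → ∑ᴸ (λ _ → c) xs ≡ length xs * c
    ∑ᴸ-const c []       = refl
    ∑ᴸ-const c (x ∷ xs) = cong (c +_) (∑ᴸ-const c xs)

    ∑ᴸ-*ˡ : ∀ c (f : A → ℕ) xs → ∑ᴸ (λ x → c * f x) xs ≡ c * ∑ᴸ f xs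
    ∑ᴸ-*ˡ c f []       = sym (*-zeroʳ c)
    ∑ᴸ-*ˡ c f (x ∷ xs) = trans (cong (c * f x +_) (∑ᴸ-*ˡ c f xs)) (sym (*-distribˡ-+ c (f x) (∑ᴸ f xs)))

    length-filter≡∑ᴸ : ∀ {P : A → Set} (P? : ∀ x → Dec (P x)) xs → length (filter P? xs) ≡ ∑ᴸ (λ x → ⟦ P? x ⟧ᵈ) xs
    length-filter≡∑ᴸ P? [] = refl
    length-filter≡∑ᴸ P? (x ∷ xs) with P? x
    ... | yes _ = cong suc (length-filter≡∑ᴸ P? xs)
    ... | no  _ = length-filter≡∑ᴸ P? xs

  ∑ᴸ-cartesianProductWith : ∀ {A B C : Set} (f : A → B → C) (g : C → ℕ) xs ys →
    ∑ᴸ g (cartesianProductWith f xs ys) ≡ ∑ᴸ (λ a → ∑ᴸ (λ b → g (f a b)) ys) xs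
  ∑ᴸ-cartesianProductWith f g []       ys = refl
  ∑ᴸ-cartesianProductWith f g (x ∷ xs) ys = begin
    sumᴸ (map g (map (f x) ys List.++ cartesianProductWith f xs ys))
      ≡⟨ cong sumᴸ (map-++ g (map (f x) ys) _) ⟩
    sumᴸ (map g (map (f x) ys) List.++ map g (cartesianProductWith f xs ys))
      ≡⟨ sum-++ (map g (map (f x) ys)) _ ⟩
    sumᴸ (map g (map (f x) ys)) + ∑ᴸ g (cartesianProductWith f xs ys)
      ≡⟨ cong₂ _+_ (cong sumᴸ (sym (map-∘ ys))) (∑ᴸ-cartesianProductWith f g xs ys) ⟩
    ∑ᴸ (λ b → g (f x b)) ys + ∑ᴸ (λ a → ∑ᴸ (λ b → g (f a b)) ys) xs ∎
    where open ≡-Reasoning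

  gather-injective : ∀ {A : Set} {n} (p : Subset n) {f g : ∀ {i} → i ∈ p → A} →
                     gather p f ≡ gather p g → ∀ {i} (i∈p : i ∈ p) → f i∈p ≡ g i∈p
  gather-injective (inside  ∷ p) eq here        = proj₁ (Vec-∷-injective eq)
  gather-injective (inside  ∷ p) eq (there i∈p) = gather-injective p (proj₂ (Vec-∷-injective eq)) i∈p
  gather-injective (outside ∷ p) eq (there i∈p) = gather-injective p eq i∈p

  ∣p-x∣ : ∀ {n} (p : Subset n) {x} → x ∈ p → ∣ p - x ∣ ≡ ∣ p ∣ ∸ 1
  ∣p-x∣ (inside  ∷ p) here = cong ∣_∣ (p─⊥≡p p)
  ∣p-x∣ (outside ∷ p) (there x∈p) = ∣p-x∣ p x∈p
  ∣p-x∣ (inside  ∷ p) (there x∈p) = trans (cong suc (∣p-x∣ p x∈p)) (m+[n∸m]≡n (nonempty p x∈p))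
    where
    nonempty : ∀ {n} (p : Subset n) {x} → x ∈ p → 1 ≤ ∣ p ∣
    nonempty (inside  ∷ p) _           = s≤s z≤n
    nonempty (outside ∷ p) (there x∈p) = nonempty p x∈p

  injective⇒surjective : ∀ {n} (f : Fin n → Fin n) → Injective _≡_ _≡_ f → ∀ y → ∃[ x ] f x ≡ y
  injective⇒surjective {suc n} f inj y with any? (λ x → f x ≟ᶠ y)
  ... | yes found = found
  ... | no missed = contradiction (injective⇒≤ {f = λ x → punchOut (avoids x)}
                      (λ eq → inj (punchOut-injective (avoids _) (avoids _) eq))) 1+n≰n
    where
    avoids : ∀ x → y ≢ f x
    avoids x eq = missed (x , sym eq)

  ⟦⟧ᵈ-× : ∀ {P Q R : Set} (P? : Dec P) (Q? : Dec Q) (R? : Dec R) → (P → Q → R) → (R → P) → (R → Q) →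
          ⟦ R? ⟧ᵈ ≡ ⟦ P? ⟧ᵈ * ⟦ Q? ⟧ᵈ
  ⟦⟧ᵈ-× (yes p) (yes q) R? pair fst snd = ⟦⟧ᵈ-true R? (pair p q)
  ⟦⟧ᵈ-× (yes p) (no ¬q) R? pair fst snd = ⟦⟧ᵈ-false R? (¬q ∘ snd)
  ⟦⟧ᵈ-× (no ¬p) Q?      R? pair fst snd = ⟦⟧ᵈ-false R? (¬p ∘ fst)

  module _ (𝔽 : FiniteField) where
    open FiniteField 𝔽
    open Inverse enumeration using (to; from; strictlyInverseˡ; strictlyInverseʳ)

    to-injective : ∀ {a b} → to a ≡ to b → a ≡ b
    to-injective {a} {b} eq = trans (sym (strictlyInverseʳ a)) (trans (cong from eq) (strictlyInverseʳ b))

    ∑ᴸ-elements : ∀ v → ∑ᴸ (λ a → ⟦ a ≟ v ⟧ᵈ) elements ≡ 1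
    ∑ᴸ-elements v = begin
      ∑ᴸ (λ a → ⟦ a ≟ v ⟧ᵈ) elements                ≡⟨ cong sumᴸ (map-tabulate from (λ a → ⟦ a ≟ v ⟧ᵈ)) ⟩
      sumᴸ (List.tabulate (λ i → ⟦ from i ≟ v ⟧ᵈ))  ≡⟨ ∑-tabulate (λ i → ⟦ from i ≟ v ⟧ᵈ) ⟩
      ∑[ i < order ] ⟦ from i ≟ v ⟧ᵈ                ≡⟨ sum-cong-≗ index ⟩
      ∑[ i < order ] (⟦ to v ≟ᶠ i ⟧ᵈ * 1)           ≡⟨ ∑-δ (λ _ → 1) (to v) ⟩
      1                                             ∎
      where
      open ≡-Reasoning
      index : ∀ i → ⟦ from i ≟ v ⟧ᵈ ≡ ⟦ to v ≟ᶠ i ⟧ᵈ * 1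
      index i with to v ≟ᶠ i
      ... | yes refl = ⟦⟧ᵈ-true (from (to v) ≟ v) (strictlyInverseʳ v)
      ... | no neq   = ⟦⟧ᵈ-false (from i ≟ v) (λ { refl → neq (strictlyInverseˡ i) })

    length-vectors : ∀ t → length (vectors elements (suc t)) ≡ order * length (vectors elements t)
    length-vectors t = begin
      length (vectors elements (suc t))      ≡⟨ sym (trans (∑ᴸ-const 1 (vectors elements (suc t))) (*-identityʳ _)) ⟩
      ∑ᴸ (λ _ → 1) (vectors elements (suc t)) ≡⟨ ∑ᴸ-cartesianProductWith _∷_ (λ _ → 1) elements (vectors elements t) ⟩
      ∑ᴸ (λ _ → ∑ᴸ (λ _ → 1) (vectors elements t)) elements
        ≡⟨ ∑ᴸ-const _ elements ⟩
      length elements * ∑ᴸ (λ _ → 1) (vectors elements t)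
        ≡⟨ cong₂ _*_ (length-tabulate from) (trans (∑ᴸ-const 1 (vectors elements t)) (*-identityʳ _)) ⟩
      order * length (vectors elements t)    ∎
      where open ≡-Reasoning

    coordinate-uniform : ∀ t (i : Fin t) v →
      order * ∑ᴸ (λ x → ⟦ lookup x i ≟ v ⟧ᵈ) (vectors elements t) ≡ length (vectors elements t)
    coordinate-uniform (suc t) zero v = begin
      order * ∑ᴸ (λ x → ⟦ lookup x zero ≟ v ⟧ᵈ) (vectors elements (suc t))
        ≡⟨ cong (order *_) (∑ᴸ-cartesianProductWith _∷_ (λ x → ⟦ lookup x zero ≟ v ⟧ᵈ) elements (vectors elements t)) ⟩
      order * ∑ᴸ (λ a → ∑ᴸ (λ _ → ⟦ a ≟ v ⟧ᵈ) (vectors elements t)) elements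
        ≡⟨ cong (order *_) (trans (∑ᴸ-cong elements (λ a → ∑ᴸ-const ⟦ a ≟ v ⟧ᵈ (vectors elements t)))
             (∑ᴸ-*ˡ (length (vectors elements t)) (λ a → ⟦ a ≟ v ⟧ᵈ) elements)) ⟩
      order * (length (vectors elements t) * ∑ᴸ (λ a → ⟦ a ≟ v ⟧ᵈ) elements)
        ≡⟨ cong (order *_) (trans (cong (length (vectors elements t) *_) (∑ᴸ-elements v)) (*-identityʳ _)) ⟩
      order * length (vectors elements t)
        ≡⟨ sym (length-vectors t) ⟩
      length (vectors elements (suc t)) ∎
      where open ≡-Reasoning
    coordinate-uniform (suc t) (suc i) v = begin
      order * ∑ᴸ (λ x → ⟦ lookup x (suc i) ≟ v ⟧ᵈ) (vectors elements (suc t))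
        ≡⟨ cong (order *_) (∑ᴸ-cartesianProductWith _∷_ (λ x → ⟦ lookup x (suc i) ≟ v ⟧ᵈ) elements (vectors elements t)) ⟩
      order * ∑ᴸ (λ a → ∑ᴸ (λ b → ⟦ lookup b i ≟ v ⟧ᵈ) (vectors elements t)) elements
        ≡⟨ cong (order *_) (trans (∑ᴸ-const count elements) (cong (_* count) (length-tabulate from))) ⟩
      order * (order * ∑ᴸ (λ b → ⟦ lookup b i ≟ v ⟧ᵈ) (vectors elements t))
        ≡⟨ cong (order *_) (coordinate-uniform t i v) ⟩
      order * length (vectors elements t)
        ≡⟨ sym (length-vectors t) ⟩
      length (vectors elements (suc t)) ∎
      where
      open ≡-Reasoning
      count : ℕ
      count = ∑ᴸ (λ b → ⟦ lookup b i ≟ v ⟧ᵈ) (vectors elements t)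

    ∈-vectors : ∀ {t} (x : Vec Carrier t) → x Membership.∈ vectors elements t
    ∈-vectors []      = Any.here refl
    ∈-vectors (a ∷ x) = ∈-cartesianProductWith⁺ _∷_
      (subst (Membership._∈ elements) (strictlyInverseʳ a) (∈-tabulate⁺ {f = from} (to a))) (∈-vectors x)

    module _ {t n : ℕ} (secret : Fin t) (shares : Vec Carrier t → Vec Carrier n) where

      outcomes : List (Vec Carrier t)
      outcomes = vectors elements t

      N : ℕ
      N = length outcomes

      ω : Fin N → Vec Carrier t
      ω = List.lookup outcomes

      index : ∀ x → ∃[ i ] ω i ≡ x
      index x = Any.index (∈-vectors x) , sym (lookup-index (∈-vectors x))

      S : Vec Carrier t → Carrier
      S x = lookup x secret

      open Entropy outcomes

      #fibre≡ : ∀ {B : Set} (_≟ᴮ_ : DecidableEquality B) (Y : Vec Carrier t → B) x →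
                #fibre _≟ᴮ_ Y x ≡ ∑[ j < N ] ⟦ Y (ω j) ≟ᴮ Y x ⟧ᵈ
      #fibre≡ _≟ᴮ_ Y x = trans (length-filter≡∑ᴸ (λ x′ → Y x′ ≟ᴮ Y x) outcomes)
                           (∑ᴸ-lookup (λ x′ → ⟦ Y x′ ≟ᴮ Y x ⟧ᵈ) outcomes)

      module _ {B : Set} (_≟ᴮ_ : DecidableEquality B) (Y : Vec Carrier t → B) where

        y : Fin N → B
        y = Y ∘ ω

        s : Fin N → Fin order
        s = to ∘ S ∘ ω

        ∏-fibre : product (map (#fibre _≟ᴮ_ Y) outcomes) ≡ ∏ (fibre _≟ᴮ_ y s)
        ∏-fibre = trans (∏ᴸ-lookup (#fibre _≟ᴮ_ Y) outcomes) (∏-cong (#fibre≡ _≟ᴮ_ Y ∘ ω))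

        ∏-jointFibre : product (map (#fibre (×-≡-dec _≟_ _≟ᴮ_) (λ x → S x , Y x)) outcomes) ≡ ∏ (jointFibre _≟ᴮ_ y s)
        ∏-jointFibre = trans (∏ᴸ-lookup (#fibre (×-≡-dec _≟_ _≟ᴮ_) (λ x → S x , Y x)) outcomes)
          (∏-cong (λ i → trans (#fibre≡ (×-≡-dec _≟_ _≟ᴮ_) (λ x → S x , Y x) (ω i)) (sum-cong-≗ (λ j →
            ⟦⟧ᵈ-× (y j ≟ᴮ y i) (s j ≟ᶠ s i) (×-≡-dec _≟_ _≟ᴮ_ (S (ω j) , y j) (S (ω i) , y i))
              (λ y≡ s≡ → cong₂ _,_ (to-injective s≡) y≡) (cong proj₂) (cong (to ∘ proj₁))))))

        secret-determined : H[ _≟_ , _≟ᴮ_ ][ S ∣ Y ] ≋ 0log → ∀ x x′ → Y x ≡ Y x′ → S x ≡ S x′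
        secret-determined H≋0 x x′ Yx≡Yx′ with index x | index x′
        ... | i , refl | j , refl = to-injective (determined _≟ᴮ_ y s ∏≡ j i Yx≡Yx′)
          where
          fY fSY : ℕ
          fY  = product (map (#fibre _≟ᴮ_ Y) outcomes)
          fSY = product (map (#fibre (×-≡-dec _≟_ _≟ᴮ_) (λ x → S x , Y x)) outcomes)
          fY≡fSY : fY ≡ fSY
          fY≡fSY = begin
            fY                ≡⟨ sym (trans (cong₂ _*_ (*-identityʳ fY) (^-zeroˡ N)) (*-identityʳ fY)) ⟩
            fY ^ 1 * 1 ^ N    ≡⟨ H≋0 ⟩
            1 ^ N * fSY ^ 1   ≡⟨ trans (cong₂ _*_ (^-zeroˡ N) (*-identityʳ fSY)) (*-identityˡ fSY) ⟩
            fSY               ∎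
            where open ≡-Reasoning
          ∏≡ : ∏ (fibre _≟ᴮ_ y s) ≡ ∏ (jointFibre _≟ᴮ_ y s)
          ∏≡ = trans (sym ∏-fibre) (trans fY≡fSY ∏-jointFibre)

        secret-free : H[ _≟_ , _≟ᴮ_ ][ S ∣ Y ] ≋ H _≟_ S → ∀ x σ → ∃[ x′ ] (Y x′ ≡ Y x × S x′ ≡ σ)
        secret-free H≋H x σ = ω j , trans (proj₁ (proj₂ found)) (cong Y ωi≡x) , to-injective (proj₂ (proj₂ found))
          where
          i : Fin N
          i = proj₁ (index x)
          ωi≡x : ω i ≡ x
          ωi≡x = proj₂ (index x)
          fY fSY fS : ℕ
          fY  = product (map (#fibre _≟ᴮ_ Y) outcomes)
          fSY = product (map (#fibre (×-≡-dec _≟_ _≟ᴮ_) (λ x → S x , Y x)) outcomes)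
          fS  = product (map (#fibre _≟_ S) outcomes)
          fS≥1 : 1 ≤ fS
          fS≥1 = subst (1 ≤_) (sym (∏ᴸ-lookup (#fibre _≟_ S) outcomes)) (∏≥1 (#fibre _≟_ S ∘ ω) (λ j →
            ≤-trans (≤-trans (≤-reflexive (sym (⟦⟧ᵈ-true (S (ω j) ≟ S (ω j)) refl)))
                             (term≤∑ (λ k → ⟦ S (ω k) ≟ S (ω j) ⟧ᵈ) j))
              (≤-reflexive (sym (#fibre≡ _≟_ S (ω j))))))
          uniform : order ^ N * fS ≡ product (map (λ _ → N) outcomes)
          uniform = begin
            order ^ N * fS                          ≡⟨ cong₂ _*_ (sym (∏-const N order)) (∏ᴸ-lookup (#fibre _≟_ S) outcomes) ⟩
            ∏ {N} (λ _ → order) * ∏ (#fibre _≟_ S ∘ ω) ≡⟨ sym (∏-distrib-* (λ _ → order) (#fibre _≟_ S ∘ ω)) ⟩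
            ∏ (λ j → order * #fibre _≟_ S (ω j))    ≡⟨ ∏-cong (λ j → trans
                (cong (order *_) (length-filter≡∑ᴸ (λ x → S x ≟ S (ω j)) outcomes)) (coordinate-uniform t secret (S (ω j)))) ⟩
            ∏ {N} (λ _ → N)                         ≡⟨ sym (∏ᴸ-lookup (λ _ → N) outcomes) ⟩
            product (map (λ _ → N) outcomes)        ∎
            where open ≡-Reasoning
          fY≡ : fY ≡ order ^ N * fSY
          fY≡ = *-cancelʳ-≡ _ _ fS {{>-nonZero fS≥1}} (begin
            fY * fS                      ≡⟨ ^-injectiveˡ N (>-nonZero⁻¹ N {{nonZeroIndex i}}) (trans (^-distribʳ-* fY fS N)
                                              (trans H≋H (sym (^-distribʳ-* (product (map (λ _ → N) outcomes)) fSY N)))) ⟩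
            product (map (λ _ → N) outcomes) * fSY ≡⟨ cong (_* fSY) (sym uniform) ⟩
            order ^ N * fS * fSY         ≡⟨ exchange (order ^ N) fS fSY ⟩
            order ^ N * fSY * fS         ∎)
            where
            open ≡-Reasoning
            exchange : ∀ a b c → a * b * c ≡ a * c * b
            exchange = solve-∀
          ∏≡ : ∏ (fibre _≟ᴮ_ y s) ≡ order ^ N * ∏ (jointFibre _≟ᴮ_ y s)
          ∏≡ = trans (sym ∏-fibre) (trans fY≡ (cong (order ^ N *_) ∏-jointFibre))
          found : ∃[ j ] (y j ≡ y i × s j ≡ to σ)
          found = independent _≟ᴮ_ y s ∏≡ i (to σ)
          j : Fin N
          j = proj₁ found

      Determined Free : Set
      Determined = ∀ T → ∣ T ∣ ≡ t → ∀ x x′ → shares x ↾ T ≡ shares x′ ↾ T → S x ≡ S x′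
      Free       = ∀ T → ∣ T ∣ ≡ t ∸ 1 → ∀ x σ → ∃[ x′ ] (shares x′ ↾ T ≡ shares x ↾ T × S x′ ≡ σ)

      module _ (isDetermined : Determined) (isFree : Free) where

        -- Given the shares in T - i, every secret is possible and is determined
        -- by the i-th share, so every value of the i-th share is possible.
        change-share : ∀ T → ∣ T ∣ ≡ t → ∀ x {i} → i ∈ T → ∀ v →
          ∃[ x′ ] ((∀ j → j ∈ T → j ≢ i → lookup (shares x′) j ≡ lookup (shares x) j) × lookup (shares x′) i ≡ v)
        change-share T ∣T∣≡t x {i} i∈T v = xσ₀ , kept , to-injective (proj₂ hit)
          where
          free : ∀ σ → ∃[ x′ ] (shares x′ ↾ (T - i) ≡ shares x ↾ (T - i) × S x′ ≡ σ)
          free = isFree (T - i) (trans (∣p-x∣ T i∈T) (cong (_∸ 1) ∣T∣≡t)) x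
          φ : Fin order → Fin order
          φ σ = to (lookup (shares (proj₁ (free (from σ)))) i)
          φ-injective : Injective _≡_ _≡_ φ
          φ-injective {σ} {τ} eq = begin
            σ           ≡⟨ sym (strictlyInverseˡ σ) ⟩
            to (from σ) ≡⟨ cong to from≡ ⟩
            to (from τ) ≡⟨ strictlyInverseˡ τ ⟩
            τ           ∎
            where
            open ≡-Reasoning
            xσ xτ : Vec Carrier t
            xσ = proj₁ (free (from σ))
            xτ = proj₁ (free (from τ))
            agree : ∀ {j} → j ∈ T → lookup (shares xσ) j ≡ lookup (shares xτ) j
            agree {j} j∈T with j ≟ᶠ i
            ... | yes refl = to-injective eq
            ... | no j≢i   = gather-injective (T - i) (trans (proj₁ (proj₂ (free (from σ)))) (sym (proj₁ (proj₂ (free (from τ))))))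
                               (x∈p∧x≢y⇒x∈p-y j∈T j≢i)
            from≡ : from σ ≡ from τ
            from≡ = trans (sym (proj₂ (proj₂ (free (from σ))))) (trans
              (isDetermined T ∣T∣≡t xσ xτ (gather-cong T agree))
              (proj₂ (proj₂ (free (from τ)))))
          hit : ∃[ σ ] φ σ ≡ to v
          hit = injective⇒surjective φ φ-injective (to v)
          xσ₀ : Vec Carrier t
          xσ₀ = proj₁ (free (from (proj₁ hit)))
          kept : ∀ j → j ∈ T → j ≢ i → lookup (shares xσ₀) j ≡ lookup (shares x) j
          kept j j∈T j≢i = gather-injective (T - i) (proj₁ (proj₂ (free (from (proj₁ hit))))) (x∈p∧x≢y⇒x∈p-y j∈T j≢i)

        reach-target : ∀ T → ∣ T ∣ ≡ t → (target : Vec Carrier n) →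
          ∃[ x ] (∀ i → i ∈ T → lookup (shares x) i ≡ lookup target i)
        reach-target T ∣T∣≡t target = proj₁ (go n ≤-refl) , λ i i∈T → proj₂ (go n ≤-refl) i i∈T (toℕ<n i)
          where
          go : ∀ k → k ≤ n → ∃[ x ] (∀ i → i ∈ T → toℕ i < k → lookup (shares x) i ≡ lookup target i)
          go zero    _   = replicate t 0# , λ _ _ ()
          go (suc k) k<n with go k (<⇒≤ k<n) | fromℕ< k<n ∈? T
          ... | x , agree | no i∉T = x , λ j j∈T j<1+k → agree j j∈T
                  (≤∧≢⇒< (≤-pred j<1+k) λ j≡k → i∉T (subst (_∈ T) (toℕ-injective (trans j≡k (sym (toℕ-fromℕ< k<n)))) j∈T))
          ... | x , agree | yes i∈T with change-share T ∣T∣≡t x i∈T (lookup target (fromℕ< k<n))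
          ...   | x′ , same , new = x′ , extend
            where
            extend : ∀ j → j ∈ T → toℕ j < suc k → lookup (shares x′) j ≡ lookup target j
            extend j j∈T j<1+k with j ≟ᶠ fromℕ< k<n
            ... | yes refl = new
            ... | no j≢i   = trans (same j j∈T j≢i) (agree j j∈T (≤∧≢⇒< (≤-pred j<1+k) λ j≡k →
                               j≢i (toℕ-injective (trans j≡k (sym (toℕ-fromℕ< k<n))))))

      shares-surjective : IsThresholdScheme 𝔽 t n secret shares → ∀ T → ∣ T ∣ ≡ t → (target : Vec Carrier n) →
        ∃[ x ] (∀ i → i ∈ T → lookup (shares x) i ≡ lookup target i)
      shares-surjective scheme = reach-target
        (λ T eq → secret-determined (Vec-≡-dec _≟_) (λ x → shares x ↾ T) (proj₁ scheme T eq))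
        (λ T eq → secret-free (Vec-≡-dec _≟_) (λ x → shares x ↾ T) (proj₂ scheme T eq))

module Connectivity where
  open Sums
  open Scales using (cancelˡ)
  open Networks
  open LowerBound using (count; Sparse; LowerBound; count-∨; ∨-false; does-false)
  open Separation
  open Sharing using (gather-injective)
  open import Data.Bool.Base using (Bool; true; false; not; _∨_)
  open import Data.Fin.Base using (Fin; zero; suc; combine; remQuot)
  open import Data.Fin.Properties using (_≟_; combine-injective; combine-remQuot; injective⇒≤; nonZeroIndex)
  open import Data.Fin.Subset using (Subset; inside; outside; _∈_; _⊆_; ∣_∣; ∁; ⊤)
  open import Data.Fin.Subset.Properties using (_∈?_; ∣p∣≤n; ∣⊤∣≡n; ∣∁p∣≡n∸∣p∣; x∉∁p⇒x∈p)
  open import Data.Nat.Base hiding (∣_-_∣)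
  open import Data.Nat.Properties hiding (_≟_)
  open import Data.Nat.Tactic.RingSolver using (solve-∀)
  open import Data.Product.Base using (_×_; _,_; ∃-syntax; proj₁; proj₂)
  open import Data.Vec.Base using (Vec; []; _∷_; lookup; here; there; tabulate; replicate; _++_)
  open import Data.Vec.Properties using (lookup∘tabulate; lookup-replicate; lookup⇒[]=; []=⇒lookup; ++-injectiveˡ; ++-injectiveʳ)
  open import Data.Empty using (⊥)
  open import Function.Base using (_∘_; id)
  open import Function.Bundles using (Inverse)
  open import Function.Definitions using (Injective)
  open import Relation.Binary.PropositionalEquality
  open import Relation.Nullary using (yes; no; ¬_; does; contradiction; decidable-stable)

  ∣tabulate∣ : ∀ {n} (p : Fin n → Bool) → ∣ tabulate p ∣ ≡ count p
  ∣tabulate∣ {zero}  p = refl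
  ∣tabulate∣ {suc n} p with p zero
  ... | true  = cong suc (∣tabulate∣ (p ∘ suc))
  ... | false = ∣tabulate∣ (p ∘ suc)

  ∈-tabulate⇒ : ∀ {n} (p : Fin n → Bool) {i} → i ∈ tabulate p → p i ≡ true
  ∈-tabulate⇒ p {i} i∈ = trans (sym (lookup∘tabulate p i)) ([]=⇒lookup i∈)

  ⇒∈-tabulate : ∀ {n} (p : Fin n → Bool) {i} → p i ≡ true → i ∈ tabulate p
  ⇒∈-tabulate p {i} eq = lookup⇒[]= i (tabulate p) (trans (lookup∘tabulate p i) eq)

  count-not : ∀ {n} (p : Fin n → Bool) → count p + count (not ∘ p) ≡ n
  count-not {n} p = trans (sym (∑-distrib-+ (χ ∘ p) (χ ∘ not ∘ p)))
    (trans (sum-cong-≗ (λ i → one-of (p i))) (trans (∑-const n 1) (*-identityʳ n)))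
    where
    one-of : ∀ b → χ b + χ (not b) ≡ 1
    one-of true  = refl
    one-of false = refl

  not-true : ∀ {b} → not b ≡ true → b ≡ false
  not-true {false} _ = refl

  ⊆-ofSize : ∀ {n} (p : Subset n) k → k ≤ ∣ p ∣ → ∃[ q ] (q ⊆ p × ∣ q ∣ ≡ k)
  ⊆-ofSize []            zero    _ = [] , id , refl
  ⊆-ofSize (outside ∷ p) k       k≤ with ⊆-ofSize p k k≤
  ... | q , q⊆p , eq = outside ∷ q , (λ { (there x∈) → there (q⊆p x∈) }) , eq
  ⊆-ofSize (inside ∷ p)  zero    _ with ⊆-ofSize p zero z≤n
  ... | q , q⊆p , eq = outside ∷ q , (λ { (there x∈) → there (q⊆p x∈) }) , eq
  ⊆-ofSize (inside ∷ p)  (suc k) (s≤s k≤) with ⊆-ofSize p k k≤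
  ... | q , q⊆p , eq = inside ∷ q , (λ { here → here ; (there x∈) → there (q⊆p x∈) }) , cong suc eq

  ∋-ofSize : ∀ {n} (x : Fin n) k → 1 ≤ k → k ≤ n → ∃[ q ] (x ∈ q × ∣ q ∣ ≡ k)
  ∋-ofSize {suc n} zero (suc k) _ (s≤s k≤n) with ⊆-ofSize {n} ⊤ k (≤-trans k≤n (≤-reflexive (sym (∣⊤∣≡n n))))
  ... | q , _ , eq = inside ∷ q , here , cong suc eq
  ∋-ofSize {suc n} (suc x) 1       _ _ with ∋-ofSize x 1 ≤-refl (>-nonZero⁻¹ n {{nonZeroIndex x}})
  ... | q , x∈q , eq = outside ∷ q , there x∈q , eq
  ∋-ofSize {suc n} (suc x) (suc (suc k)) _ (s≤s k≤n) with ∋-ofSize x (suc k) (s≤s z≤n) k≤n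
  ... | q , x∈q , eq = inside ∷ q , there x∈q , cong suc eq

  scatter : ∀ {A : Set} {n} (p : Subset n) → A → Vec A ∣ p ∣ → Vec A n
  scatter []            d xs       = []
  scatter (outside ∷ p) d xs       = d ∷ scatter p d xs
  scatter (inside  ∷ p) d (x ∷ xs) = x ∷ scatter p d xs

  scatter-↾ : ∀ {A : Set} {n} (p : Subset n) d (xs : Vec A ∣ p ∣) → scatter p d xs ↾ p ≡ xs
  scatter-↾ []            d []       = refl
  scatter-↾ (outside ∷ p) d xs       = scatter-↾ p d xs
  scatter-↾ (inside  ∷ p) d (x ∷ xs) = cong (x ∷_) (scatter-↾ p d xs)

  module _ (𝔽 : FiniteField) where
    open FiniteField 𝔽 using (Carrier; enumeration; order; 0#; 1#; 0#≢1#) renaming (_≟_ to _≟ᶜ_)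
    open Inverse enumeration using (to; from; strictlyInverseˡ; strictlyInverseʳ)

    1<order : 1 < order
    1<order = two-elements (to 0#) (to 1#) (λ eq →
      0#≢1# (trans (sym (strictlyInverseʳ 0#)) (trans (cong from eq) (strictlyInverseʳ 1#))))
      where
      two-elements : ∀ {k} (i j : Fin k) → i ≢ j → 1 < k
      two-elements {suc zero}    zero zero i≢j = contradiction refl i≢j
      two-elements {suc (suc k)} _    _    _   = s≤s (s≤s z≤n)

    encode : ∀ {k} → Vec Carrier k → Fin (order ^ k)
    encode []       = zero
    encode (x ∷ xs) = combine (to x) (encode xs)

    encode-injective : ∀ {k} → Injective _≡_ _≡_ (encode {k})
    encode-injective {x = []}     {y = []}     _  = refl
    encode-injective {x = x ∷ xs} {y = y ∷ ys} eq with combine-injective (to x) (encode xs) (to y) (encode ys) eq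
    ... | to≡ , enc≡ = cong₂ _∷_ (trans (sym (strictlyInverseʳ x)) (trans (cong from to≡) (strictlyInverseʳ y)))
                                 (encode-injective enc≡)

    decode : ∀ k → Fin (order ^ k) → Vec Carrier k
    decode zero    _ = []
    decode (suc k) i = from (proj₁ (remQuot (order ^ k) i)) ∷ decode k (proj₂ (remQuot {order} (order ^ k) i))

    encode-decode : ∀ k i → encode (decode k i) ≡ i
    encode-decode zero    zero = refl
    encode-decode (suc k) i    = trans
      (cong₂ combine (strictlyInverseˡ (proj₁ (remQuot {order} (order ^ k) i))) (encode-decode k (proj₂ (remQuot {order} (order ^ k) i))))
      (combine-remQuot {order} (order ^ k) i)

    no-compression : ∀ {a b} (f : Vec Carrier a → Vec Carrier b) → Injective _≡_ _≡_ f → ¬ b < a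
    no-compression {a} {b} f inj b<a = <⇒≱ (^-monoʳ-< order 1<order b<a) (injective⇒≤ {f = encode ∘ f ∘ decode a}
      (λ {i} {j} eq → trans (sym (encode-decode a i)) (trans (cong encode (inj (encode-injective eq))) (encode-decode a j))))

    module _ {t n : ℕ} (C : Circuit Carrier t n) where
      open Circuit C

      Surjective : Set
      Surjective = ∀ T → ∣ T ∣ ≡ t → (target : Vec Carrier n) →
        ∃[ x ] (∀ i → i ∈ T → lookup ⟦ x ⟧ i ≡ lookup target i)

      lookup-⟦⟧ : ∀ x i → lookup ⟦ x ⟧ i ≡ value x (output i)
      lookup-⟦⟧ x i = lookup∘tabulate (value x ∘ output) i

      module _ (surj : Surjective) where

        output-depends : 1 ≤ t → t ≤ n → ∀ y → 1 ≤ col (W C) (output y)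
        output-depends 1≤t t≤n y with 1 ≤? col (W C) (output y)
        ... | yes 1≤col = 1≤col
        ... | no  1≰col = contradiction 0≡1 0#≢1#
          where
          no-W : ∀ u → ¬ 1 ≤ W C u (output y)
          no-W u 1≤W = 1≰col (≤-trans 1≤W (term≤∑ (λ u → W C u (output y)) u))
          constant : ∀ x x′ → value x (output y) ≡ value x′ (output y)
          constant x x′ = value-cong C x x′ (output y)
            (λ i eq → contradiction (subst (λ v → 1 ≤ W C (input i) v) (sym eq) (W-loop C i)) (no-W (input i)))
            (λ u u⟶ → contradiction (W-edge C u⟶) (no-W u))
          T : Subset n
          T = proj₁ (∋-ofSize y t 1≤t t≤n)
          y∈T : y ∈ T
          y∈T = proj₁ (proj₂ (∋-ofSize y t 1≤t t≤n))
          takes : ∀ v → ∃[ x ] value x (output y) ≡ v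
          takes v with surj T (proj₂ (proj₂ (∋-ofSize y t 1≤t t≤n))) (replicate n v)
          ... | x , agree = x , trans (sym (lookup-⟦⟧ x y)) (trans (agree y y∈T) (lookup-replicate y v))
          0≡1 : 0# ≡ 1#
          0≡1 = trans (sym (proj₂ (takes 0#))) (trans (constant _ _) (proj₂ (takes 1#)))

        outputs≤ : 1 ≤ t → t ≤ n → n ≤ t + wires
        outputs≤ 1≤t t≤n = begin
          n                               ≡⟨ sym (trans (∑-const n 1) (*-identityʳ n)) ⟩
          ∑[ y < n ] 1                    ≤⟨ ∑-mono-≤ (output-depends 1≤t t≤n) ⟩
          ∑[ y < n ] col (W C) (output y) ≤⟨ ∑-injective-≤ (col (W C)) output-injective ⟩
          sum (col (W C))                 ≡⟨ sym (total≡∑col (W C)) ⟩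
          total (W C)                     ≡⟨ total-W C ⟩
          t + wires                       ∎
          where open ≤-Reasoning

        module _ (d : ℕ) (M : Vertex → Bool) (O : Fin n → Bool) (X : Subset t) where

          N : Net (t + #gates) (suc d) t n
          N = net C d input output

          paths : Fin n → Fin t → ℕ
          paths y = act N M (λ w → ⟦ w ≟ y ⟧ᵈ * keep (O y))

          hits : Fin n → ℕ
          hits y = ∑[ i < t ] (⟦ i ∈? X ⟧ᵈ * paths y i)

          reached : Fin n → Bool
          reached y = O y ∨ does (1 ≤? hits y)

          ∑hits : sum hits ≡ ∑[ i < t ] (⟦ i ∈? X ⟧ᵈ * act N M (keep ∘ O) i)
          ∑hits = trans (∑-comm (λ y i → ⟦ i ∈? X ⟧ᵈ * paths y i)) (sum-cong-≗ (λ i →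
            trans (sym (*-distribˡ-sum ⟦ i ∈? X ⟧ᵈ (λ y → paths y i))) (cong (⟦ i ∈? X ⟧ᵈ *_) (∑paths i))))
            where
            ∑paths : ∀ i → ∑[ y < n ] paths y i ≡ act N M (keep ∘ O) i
            ∑paths i = trans (sym (act-∑ N M (λ y w → ⟦ w ≟ y ⟧ᵈ * keep (O y)) i)) (act-cong N M (∑-δ (keep ∘ O)) i)

          ∑hits≤ : ∀ c s → (∀ {i} → i ∈ X → c * act N M (keep ∘ O) i ≤ s) → c * sum hits ≤ ∣ X ∣ * s
          ∑hits≤ c s few = begin
            c * sum hits                                                ≡⟨ cong (c *_) ∑hits ⟩
            c * ∑[ i < t ] (⟦ i ∈? X ⟧ᵈ * act N M (keep ∘ O) i)         ≤⟨ ∑*-mono c (λ i → few′ i (act N M (keep ∘ O) i) few) ⟩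
            ∑[ i < t ] (⟦ i ∈? X ⟧ᵈ * s)                                ≡⟨ sym (*-distribʳ-sum s (λ i → ⟦ i ∈? X ⟧ᵈ)) ⟩
            ∑[ i < t ] ⟦ i ∈? X ⟧ᵈ * s                                  ≡⟨ cong (_* s) (∑-∈? X) ⟩
            ∣ X ∣ * s                                                   ∎
            where
            open ≤-Reasoning
            few′ : ∀ i z → (i ∈ X → c * z ≤ s) → c * (⟦ i ∈? X ⟧ᵈ * z) ≤ ⟦ i ∈? X ⟧ᵈ * s
            few′ i z le with i ∈? X
            ... | no  _   = ≤-reflexive (*-zeroʳ c)
            ... | yes i∈X = ≤-trans (≤-reflexive (cong (c *_) (*-identityˡ z))) (≤-trans (le i∈X) (m≤m+n s 0))

          count-reached : count reached ≤ count O + sum hits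
          count-reached = ≤-trans (count-∨ O (λ y → does (1 ≤? hits y))) (+-monoʳ-≤ (count O) (∑-mono-≤ (λ y → nonzero (hits y))))
            where
            nonzero : ∀ z → χ (does (1 ≤? z)) ≤ z
            nonzero zero    = z≤n
            nonzero (suc z) = s≤s z≤n

          module _ (depth : HasDepth (suc d)) (T : Subset n) (unreached : ∀ {y} → y ∈ T → reached y ≡ false) where

            functional : ∀ x x′ → (∀ {i} → i ∈ ∁ X → lookup x i ≡ lookup x′ i) →
                         (∀ {v} → v ∈ tabulate M → value x v ≡ value x′ v) →
                         ∀ {y} → y ∈ T → value x (output y) ≡ value x′ (output y)
            functional x x′ agreeX agreeM {y} y∈T = decidable-stable (value x (output y) ≟ᶜ value x′ (output y)) λ neq →
              impossible (separation C _≟ᶜ_ x x′ d depth {M} {λ w → ⟦ w ≟ y ⟧ᵈ * keep (O y)} y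
                (λ v v∈M → agreeM (⇒∈-tabulate M v∈M)) neq
                (≤-reflexive (sym (cong₂ _*_ (⟦⟧ᵈ-true (y ≟ y) refl) (cong keep y∉O)))))
              where
              y∉O : O y ≡ false
              y∉O = proj₁ (∨-false (O y) (unreached y∈T))
              no-hits : ¬ 1 ≤ hits y
              no-hits = does-false (1 ≤? hits y) (proj₂ (∨-false (O y) (unreached y∈T)))
              impossible : ∃[ i ] (lookup x i ≢ lookup x′ i × 1 ≤ paths y i) → ⊥
              impossible (i , differ , 1≤paths) = no-hits (≤-trans
                (*-mono-≤ (≤-reflexive (sym (⟦⟧ᵈ-true (i ∈? X) (x∉∁p⇒x∈p (differ ∘ agreeX))))) 1≤paths)
                (term≤∑ (λ i → ⟦ i ∈? X ⟧ᵈ * paths y i) i))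

            module _ (∣T∣≡t : ∣ T ∣ ≡ t) where

              preimage : Vec Carrier ∣ T ∣ → Vec Carrier t
              preimage z = proj₁ (surj T ∣T∣≡t (scatter T 0# z))

              preimage-shares : ∀ z {y} → y ∈ T → value (preimage z) (output y) ≡ lookup (scatter T 0# z) y
              preimage-shares z {y} y∈T = trans (sym (lookup-⟦⟧ (preimage z) y)) (proj₂ (surj T ∣T∣≡t (scatter T 0# z)) y y∈T)

              values : Vec Carrier t → Vec Carrier (t + #gates)
              values x = tabulate (value x)

              code : Vec Carrier ∣ T ∣ → Vec Carrier (∣ ∁ X ∣ + ∣ tabulate M ∣)
              code z = preimage z ↾ ∁ X ++ values (preimage z) ↾ tabulate M

              code-injective : Injective _≡_ _≡_ code
              code-injective {z} {z′} eq = trans (sym (scatter-↾ T 0# z)) (trans (gather-cong T same) (scatter-↾ T 0# z′))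
                where
                agreeX : ∀ {i} → i ∈ ∁ X → lookup (preimage z) i ≡ lookup (preimage z′) i
                agreeX = gather-injective (∁ X) (++-injectiveˡ (preimage z ↾ ∁ X) (preimage z′ ↾ ∁ X) eq)
                agreeM : ∀ {v} → v ∈ tabulate M → value (preimage z) v ≡ value (preimage z′) v
                agreeM {v} v∈M = trans (sym (lookup∘tabulate (value (preimage z)) v)) (trans
                  (gather-injective (tabulate M) (++-injectiveʳ (preimage z ↾ ∁ X) (preimage z′ ↾ ∁ X) eq) v∈M)
                  (lookup∘tabulate (value (preimage z′)) v))
                same : ∀ {y} → y ∈ T → lookup (scatter T 0# z) y ≡ lookup (scatter T 0# z′) y
                same y∈T = trans (sym (preimage-shares z y∈T))
                  (trans (functional (preimage z) (preimage z′) agreeX agreeM y∈T) (preimage-shares z′ y∈T))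

              ∣X∣≤∣M∣ : ∣ X ∣ ≤ count M
              ∣X∣≤∣M∣ = +-cancelˡ-≤ ∣ ∁ X ∣ _ _ (begin
                ∣ ∁ X ∣ + ∣ X ∣        ≡⟨ trans (cong (_+ ∣ X ∣) (∣∁p∣≡n∸∣p∣ X)) (m∸n+n≡m (∣p∣≤n X)) ⟩
                t                      ≡⟨ sym ∣T∣≡t ⟩
                ∣ T ∣                  ≤⟨ ≮⇒≥ (no-compression code code-injective) ⟩
                ∣ ∁ X ∣ + ∣ tabulate M ∣ ≡⟨ cong (∣ ∁ X ∣ +_) (∣tabulate∣ M) ⟩
                ∣ ∁ X ∣ + count M      ∎)
                where open ≤-Reasoning

        -- Some |M| + 1 inputs X reach, outside M, only few outputs, so that
        -- some t outputs T are functions of the inputs outside X and of the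
        -- values at M.  These are t - 1 values, while the outputs in T take
        -- all possible t-tuples of values.
        not-sparse : ∀ d b s → HasDepth (suc d) → 1 ≤ b → n ≤ b * t → n + b * t ≤ b * n → 3 * b ≤ n →
                1 ≤ s → s ≤ n → ¬ Sparse (3 * b) n s (net C d input output)
        not-sparse d b s depth 1≤b n≤bt n+bt≤bn 3b≤n 1≤s s≤n sparse =
          choose (⊆-ofSize (tabulate (not ∘ I)) k (≤-trans k≤¬I (≤-reflexive (sym (∣tabulate∣ (not ∘ I))))))
          where
          open ≤-Reasoning
          open Sparse sparse
          k : ℕ
          k = suc (count M)
          1≤3b : 1 ≤ 3 * b
          1≤3b = ≤-trans 1≤b (m≤m+n b _)
          sM≤n : s * count M ≤ n
          sM≤n = ≤-trans (≤-trans (≤-reflexive (sym (*-identityˡ _))) (*-monoˡ-≤ (s * count M) 1≤3b)) few-M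
          3b*M≤n : 3 * b * count M ≤ n
          3b*M≤n = ≤-trans (*-monoʳ-≤ (3 * b) (≤-trans (≤-reflexive (sym (*-identityˡ (count M)))) (*-monoˡ-≤ (count M) 1≤s))) few-M
          k+I≤t : k + count I ≤ t
          k+I≤t = cancelˡ 1≤3b (begin
            3 * b * (k + count I)                            ≡⟨ distribute b (count M) (count I) ⟩
            3 * b + 3 * b * count M + 3 * b * count I        ≤⟨ +-mono-≤ (+-mono-≤ 3b≤n 3b*M≤n) few-I ⟩
            n + n + n                                        ≤⟨ +-mono-≤ (+-mono-≤ n≤bt n≤bt) n≤bt ⟩
            b * t + b * t + b * t                            ≡⟨ triple b t ⟩
            3 * b * t                                        ∎)
            where
            distribute : ∀ b m i → 3 * b * (1 + m + i) ≡ 3 * b + 3 * b * m + 3 * b * i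
            distribute = solve-∀
            triple : ∀ b t → b * t + b * t + b * t ≡ 3 * b * t
            triple = solve-∀
          k≤¬I : k ≤ count (not ∘ I)
          k≤¬I = +-cancelʳ-≤ (count I) k (count (not ∘ I)) (≤-trans k+I≤t (≤-reflexive (trans (sym (count-not I)) (+-comm (count I) _))))
          choose : ∃[ X ] (X ⊆ tabulate (not ∘ I) × ∣ X ∣ ≡ k) → ⊥
          choose (X , X⊆ , ∣X∣≡k) = chooseT (⊆-ofSize (tabulate (not ∘ R)) t (≤-trans t≤¬R (≤-reflexive (sym (∣tabulate∣ (not ∘ R))))))
            where
            R : Fin n → Bool
            R = reached d M O X
            3b*R≤3n : 3 * b * count R ≤ 3 * n
            3b*R≤3n = begin
              3 * b * count R                        ≤⟨ *-monoʳ-≤ (3 * b) (count-reached d M O X) ⟩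
              3 * b * (count O + sum (hits d M O X)) ≡⟨ *-distribˡ-+ (3 * b) (count O) _ ⟩
              3 * b * count O + 3 * b * sum (hits d M O X)
                ≤⟨ +-mono-≤ few-O (∑hits≤ d M O X (3 * b) s (λ {i} i∈X → reach i (not-true (∈-tabulate⇒ (not ∘ I) (X⊆ i∈X))))) ⟩
              n + ∣ X ∣ * s                          ≡⟨ cong (λ z → n + z * s) ∣X∣≡k ⟩
              n + (s + count M * s)                  ≤⟨ +-monoʳ-≤ n (+-mono-≤ s≤n (≤-trans (≤-reflexive (*-comm (count M) s)) sM≤n)) ⟩
              n + (n + n)                            ≡⟨ triple n ⟩
              3 * n                                  ∎
              where
              triple : ∀ n → n + (n + n) ≡ 3 * n
              triple = solve-∀
            t≤¬R : t ≤ count (not ∘ R)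
            t≤¬R = +-cancelˡ-≤ (count R) t _ (≤-trans (cancelˡ 1≤b (begin
              b * (count R + t)       ≡⟨ *-distribˡ-+ b (count R) t ⟩
              b * count R + b * t     ≤⟨ +-monoˡ-≤ (b * t) (*-cancelˡ-≤ 3 (≤-trans (≤-reflexive (sym (*-assoc 3 b (count R)))) 3b*R≤3n)) ⟩
              n + b * t               ≤⟨ n+bt≤bn ⟩
              b * n                   ∎)) (≤-reflexive (sym (count-not R))))
            chooseT : ∃[ T ] (T ⊆ tabulate (not ∘ R) × ∣ T ∣ ≡ t) → ⊥
            chooseT (T , T⊆ , ∣T∣≡t) = 1+n≰n (≤-trans (≤-reflexive (sym ∣X∣≡k))
              (∣X∣≤∣M∣ d M O X depth T (λ y∈T → not-true (∈-tabulate⇒ (not ∘ R) (T⊆ y∈T))) ∣T∣≡t))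

module Wires where
  open Networks using (size)
  open LowerBound using (LowerBound)
  open Hierarchy using (Λ-lowerBound)
  open Separation using (net; size-net; total-W)
  open Sharing using (shares-surjective)
  open Connectivity using (outputs≤; not-sparse)
  open import Data.Fin.Base using (Fin)
  open import Data.Fin.Properties using (↑ˡ-injective; nonZeroIndex)
  open import Data.Nat.Base
  open import Data.Nat.Properties
  open import Data.Nat.Tactic.RingSolver using (solve-∀)
  open import Data.Product.Base using (_×_; _,_; ∃-syntax)
  open import Relation.Binary.PropositionalEquality
  open import Relation.Nullary using (yes; no; contradiction)

  -- The real bounds n / b ≤ t and n / b ≤ n - t, cleared of denominators
  -- and subtraction.
  LinearGap : (b n t : ℕ) → Set
  LinearGap b n t = n ≤ b * t × n + b * t ≤ b * n

  wires-bound : ∀ b → 1 ≤ b → ∀ d → ∃[ K ] ∃[ n₀ ] (∀ n t → n₀ ≤ n → LinearGap b n t →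
    (𝔽 : FiniteField) (C : Circuit (FiniteField.Carrier 𝔽) t n) (secret : Fin t) →
    Circuit.HasDepth C (suc d) → IsThresholdScheme 𝔽 t n secret (Circuit.⟦_⟧ C) →
    Λ (suc d) n * n ≤ K * Circuit.wires C)
  wires-bound b 1≤b d with Λ-lowerBound d (3 * b) (≤-trans 1≤b (m≤m+n b _))
  ... | K , _ , sparsify = K * (suc d * suc b) , 2 + 3 * b , bound
    where
    bound : ∀ n t → 2 + 3 * b ≤ n → LinearGap b n t →
      (𝔽 : FiniteField) (C : Circuit (FiniteField.Carrier 𝔽) t n) (secret : Fin t) →
      Circuit.HasDepth C (suc d) → IsThresholdScheme 𝔽 t n secret (Circuit.⟦_⟧ C) →
      Λ (suc d) n * n ≤ K * (suc d * suc b) * Circuit.wires C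
    bound n t n₀≤n (n≤bt , n+bt≤bn) 𝔽 C secret depth scheme = conclude
      where
      open Circuit C
      open ≤-Reasoning
      2≤n : 2 ≤ n
      2≤n = ≤-trans (m≤m+n 2 _) n₀≤n
      t≤n : t ≤ n
      t≤n = *-cancelˡ-≤ b {{>-nonZero 1≤b}} (≤-trans (m≤n+m (b * t) n) n+bt≤bn)
      surjective : Connectivity.Surjective 𝔽 C
      surjective = shares-surjective 𝔽 secret ⟦_⟧ scheme
      N≤ : size (net C d input output) ≤ suc d * (t + wires)
      N≤ = ≤-trans (size-net C d (↑ˡ-injective #gates _ _) output-injective) (≤-reflexive (cong (suc d *_) (total-W C)))
      n≤b*wires : n ≤ b * wires
      n≤b*wires = +-cancelʳ-≤ (b * t) n (b * wires) (begin
        n + b * t           ≤⟨ n+bt≤bn ⟩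
        b * n               ≤⟨ *-monoʳ-≤ b (outputs≤ 𝔽 C surjective (>-nonZero⁻¹ t {{nonZeroIndex secret}}) t≤n) ⟩
        b * (t + wires)     ≡⟨ trans (*-distribˡ-+ b t wires) (+-comm (b * t) (b * wires)) ⟩
        b * wires + b * t   ∎)
      conclude : Λ (suc d) n * n ≤ K * (suc d * suc b) * wires
      conclude with K * size (net C d input output) ≤? n * Λ (suc d) n
      ... | yes le with sparsify n n (<⇒≤ 2≤n) 2≤n (net C d input output) le
      ...   | s , 1≤s , s≤n , sparse = contradiction sparse
                (not-sparse 𝔽 C surjective d b s depth 1≤b n≤bt n+bt≤bn (≤-trans (m≤n+m (3 * b) 2) n₀≤n) 1≤s s≤n)
      conclude | no ≰ = begin
        Λ (suc d) n * n                         ≡⟨ *-comm _ n ⟩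
        n * Λ (suc d) n                         ≤⟨ <⇒≤ (≰⇒> ≰) ⟩
        K * size (net C d input output)         ≤⟨ *-monoʳ-≤ K N≤ ⟩
        K * (suc d * (t + wires))               ≤⟨ *-monoʳ-≤ K (*-monoʳ-≤ (suc d) (+-monoˡ-≤ wires (≤-trans t≤n n≤b*wires))) ⟩
        K * (suc d * (b * wires + wires))       ≡⟨ regroup K d b wires ⟩
        K * (suc d * suc b) * wires             ∎
        where
        regroup : ∀ K d b w → K * ((1 + d) * (b * w + w)) ≡ K * ((1 + d) * (1 + b)) * w
        regroup = solve-∀

module Rationals where
  open Wires using (LinearGap)
  open import Data.Integer.Base as ℤ using (ℤ; +_; +[1+_]; -[1+_]; +<+; +≤+)
  import Data.Integer.Properties as ℤ
  open import Data.Nat.Base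
  open import Data.Nat.Properties
  open import Data.Nat.Tactic.RingSolver using (solve-∀)
  open import Data.Product.Base using (_×_; _,_; ∃-syntax)
  open import Data.Rational.Base as ℚ using (ℚ; mkℚ; 0ℚ; 1ℚ; toℚᵘ; *<*)
  import Data.Rational.Properties as ℚ
  open import Data.Rational.Unnormalised.Base as ℚᵘ using (ℚᵘ; mkℚᵘ; *≡*; *≤*; _≃_)
  import Data.Rational.Unnormalised.Properties as ℚᵘ
  open import Relation.Binary.PropositionalEquality

  fromℕᵘ : ∀ n → toℚᵘ (fromℕ n) ≃ mkℚᵘ (+ n) 0
  fromℕᵘ n = ℚ.toℚᵘ-fromℚᵘ (mkℚᵘ (+ n) 0)

  linearGap : ∀ c → 0ℚ ℚ.< c → c ℚ.< 1ℚ →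
              ∃[ b ] (1 ≤ b × (∀ n t → c ℚ.* fromℕ n ≡ fromℕ t → LinearGap b n t))
  linearGap (mkℚ (+ zero)     b-1 _) (*<* (+<+ ())) _
  linearGap (mkℚ (-[1+ a ])   b-1 _) (*<* ())       _
  linearGap c@(mkℚ (+[1+ a ]) b-1 _) _ (*<* a<b) = suc b-1 , s≤s z≤n , gap
    where
    open ≤-Reasoning
    1+a<b : suc a < suc b-1
    1+a<b = subst₂ _<_ (*-identityʳ (suc a)) (*-identityˡ (suc b-1)) (ℤ.drop‿+<+ a<b)
    gap : ∀ n t → c ℚ.* fromℕ n ≡ fromℕ t → LinearGap (suc b-1) n t
    gap n t cn≡t = (begin
        n                    ≤⟨ m≤m+n n (a * n) ⟩
        suc a * n            ≡⟨ an≡bt ⟩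
        suc b-1 * t          ∎) , (begin
        n + suc b-1 * t      ≡⟨ cong (λ z → n + z) (sym an≡bt) ⟩
        suc (suc a) * n      ≤⟨ *-monoˡ-≤ n 1+a<b ⟩
        suc b-1 * n          ∎)
      where
      cross : toℚᵘ c ℚᵘ.* mkℚᵘ (+ n) 0 ≃ mkℚᵘ (+ t) 0
      cross = ℚᵘ.≃-trans (ℚᵘ.*-congˡ {toℚᵘ c} (ℚᵘ.≃-sym (fromℕᵘ n)))
        (ℚᵘ.≃-trans (ℚᵘ.≃-sym (ℚ.toℚᵘ-homo-* c (fromℕ n)))
          (ℚᵘ.≃-trans (ℚᵘ.≃-reflexive (cong toℚᵘ cn≡t)) (fromℕᵘ t)))
      an≡bt : suc a * n ≡ suc b-1 * t
      an≡bt with cross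
      ... | *≡* eq = ℤ.+-injective +an≡+bt
        where
        +an≡+bt : + (suc a * n) ≡ + (suc b-1 * t)
        +an≡+bt = trans (ℤ.pos-* (suc a) n) (trans (sym (ℤ.*-identityʳ _)) (trans eq
          (trans (cong (λ z → + t ℤ.* + z) (*-identityʳ (suc b-1))) (trans (ℤ.*-comm (+ t) (+ suc b-1)) (sym (ℤ.pos-* (suc b-1) t))))))

  0<1/ : ∀ K → 0ℚ ℚ.< (+ 1 ℚ./ suc K)
  0<1/ K = ℚ.positive⁻¹ (+ 1 ℚ./ suc K) {{ℚ.normalize-pos 1 (suc K)}}

  scaled≤ : ∀ K x y z → x * y ≤ K * z → (+ 1 ℚ./ suc K) ℚ.* (fromℕ x ℚ.* fromℕ y) ℚ.≤ fromℕ z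
  scaled≤ K x y z xy≤Kz = ℚ.toℚᵘ-cancel-≤ (ℚᵘ.≤-respˡ-≃ (ℚᵘ.≃-sym lhs) (ℚᵘ.≤-respʳ-≃ (ℚᵘ.≃-sym (fromℕᵘ z)) (*≤* cross)))
    where
    lhs : toℚᵘ ((+ 1 ℚ./ suc K) ℚ.* (fromℕ x ℚ.* fromℕ y)) ≃ mkℚᵘ (+ 1) K ℚᵘ.* (mkℚᵘ (+ x) 0 ℚᵘ.* mkℚᵘ (+ y) 0)
    lhs = ℚᵘ.≃-trans (ℚ.toℚᵘ-homo-* (+ 1 ℚ./ suc K) (fromℕ x ℚ.* fromℕ y))
      (ℚᵘ.*-cong (ℚ.toℚᵘ-fromℚᵘ (mkℚᵘ (+ 1) K))
        (ℚᵘ.≃-trans (ℚ.toℚᵘ-homo-* (fromℕ x) (fromℕ y)) (ℚᵘ.*-cong (fromℕᵘ x) (fromℕᵘ y))))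
    cross : ℚᵘ.↥ (mkℚᵘ (+ 1) K ℚᵘ.* (mkℚᵘ (+ x) 0 ℚᵘ.* mkℚᵘ (+ y) 0)) ℤ.* + 1 ℤ.≤
            + z ℤ.* ℚᵘ.↧ (mkℚᵘ (+ 1) K ℚᵘ.* (mkℚᵘ (+ x) 0 ℚᵘ.* mkℚᵘ (+ y) 0))
    cross = subst₂ ℤ._≤_
      (sym (trans (ℤ.*-identityʳ _) (trans (ℤ.*-identityˡ _) (sym (ℤ.pos-* x y)))))
      (ℤ.pos-* z (suc K * 1))
      (+≤+ (≤-trans xy≤Kz (≤-trans (m≤n+m (K * z) z) (≤-reflexive (commute K z)))))
      where
      commute : ∀ K z → z + K * z ≡ z * ((1 + K) * 1)
      commute = solve-∀

open import Data.Nat.Base using (ℕ; suc) renaming (_≤_ to _≤ⁿ_)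
open import Data.Fin.Base using (Fin)
open import Data.Product.Base using (_×_; _,_; ∃-syntax)
open import Data.Rational.Base using (ℚ; 0ℚ; 1ℚ; _<_; _≤_; _*_)
open import Relation.Binary.PropositionalEquality using (_≡_)

theorem3 : (c : ℚ) → 0ℚ < c → c < 1ℚ → (d : ℕ) → 1 ≤ⁿ d →
    ∃[ κ ] ∃[ n₀ ] (0ℚ < κ ×
    ((n t : ℕ) → n₀ ≤ⁿ n → c * fromℕ n ≡ fromℕ t →
    (𝔽 : FiniteField) (C : Circuit (FiniteField.Carrier 𝔽) t n) (secret : Fin t) →
    Circuit.HasDepth C d →
    IsThresholdScheme 𝔽 t n secret (Circuit.⟦_⟧ C) →
    κ * (fromℕ (Λ d n) * fromℕ n) ≤ fromℕ (Circuit.wires C)))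
theorem3 c 0<c c<1 (suc d) _ with Rationals.linearGap c 0<c c<1
... | b , 1≤b , gap with Wires.wires-bound b 1≤b d
...   | K , n₀ , bound = _ , n₀ , Rationals.0<1/ K , λ n t n₀≤n cn≡t 𝔽 C secret depth scheme →
        Rationals.scaled≤ K (Λ (suc d) n) n (Circuit.wires C)
          (bound n t n₀≤n (gap n t cn≡t) 𝔽 C secret depth scheme)
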